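{- Let $n$ be a positive integer and let $\lambda=(1^{m_1}2^{m_2}\cdots)$ be a partition of $n$ (with $m_i$ parts of size $i$ for each $i\ge 1$). Let $\mathfrak{S}_n(\lambda)$ be the set of permutations in $\mathfrak{S}_n$ of cycle type $\lambda$, and let $z_\lambda=\prod_{i\ge1} i^{m_i}m_i!$. Then $$\sum_{\pi\in\mathfrak{S}_n(\lambda)} t^{\mathrm{cval}(\pi)}=\frac{n!}{z_\lambda}\left(1+\sqrt{1-t}\right)^{n-m_1}\prod_{i\ge1}\left[\frac{A_{i-1}(w)}{(i-1)!}\right]^{m_i},$$ where $w=2t^{ -1}(1-\sqrt{1-t})-1$.
   Context: $[n]=\{1,\dots,n\}$ and $\mathfrak{S}_n$ is the symmetric group on $[n]$. For $\pi\in\mathfrak{S}_n$, a cyclic valley of $\pi$ is an $i\in[n]$ with $\pi^{ -1}(i)>i<\pi(i)$, and $\mathrm{cval}(\pi)$ is the number of cyclic valleys. An excedance of $\pi$ is an $i\in[n]$ with $i<\pi(i)$, and $\mathrm{exc}(\pi)$ is the number of excedances. The Eulerian polynomials are $A_0(t)=1$ and, for $n\ge1$, $A_n(t)=\sum_{\pi\in\mathfrak{S}_n}t^{\mathrm{des}(\pi)+1}=\sum_{\pi\in\mathfrak{S}_n}t^{\mathrm{exc}(\pi)+1}$, where $\mathrm{des}(\pi)$ is the number of $i\in[n-1]$ with $\pi(i)>\pi(i+1)$. The identity is understood in the formal power series ring $\mathbb{Q}[[t]]$, with $\sqrt{1-t}$ the power series with constant term $1$ (then $w$ is a power series in $t$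 with zero constant term). -}

module Defs where

open import Algebra.Bundles using (CommutativeRing)
open import Algebra.Bundles.Raw using (RawRing)
import Data.Bool.Properties as Bool
open import Data.Fin.Base using (Fin; zero; suc; toℕ; inject₁; punchIn)
open import Data.Fin.Permutation using (Permutation′; _⟨$⟩ʳ_; _⟨$⟩ˡ_; _≈_; insert; remove; reverse; insert-remove)
  renaming (id to idₚ)
import Data.Fin.Properties as Fin
open import Data.Fin.Subset using (Subset; ⁅_⁆; ⋃; ∣_∣)
open import Data.Integer.Base as ℤ using (+_)
import Data.Integer.Properties as ℤ
open import Data.List.Base using (List; []; _∷_; allFin; cartesianProductWith; deduplicate; filter; foldr; iterate; length; map; upTo)
import Data.List.Membership.Setoid.Properties as Membershipₚ
open import Data.List.Membership.Propositional.Properties using (∈-allFin)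
import Data.List.Properties as List
import Data.List.Relation.Binary.Equality.Propositional as ≋
open import Data.List.Relation.Binary.Permutation.Propositional using (_↭_; ↭-sym; ↭-trans; ↭-reflexive; ↭⇒↭ₛ)
open import Data.List.Relation.Unary.All using (All; [])
import Data.List.Relation.Unary.All.Properties as All
open import Data.List.Relation.Unary.AllPairs using (AllPairs; []; _∷_)
open import Data.List.Relation.Unary.Any using (Any; here)
open import Data.List.Relation.Unary.Linked using (Linked)
open import Data.List.Relation.Unary.Sorted.TotalOrder.Properties using (↗↭↗⇒≋)
open import Data.List.Relation.Unary.Unique.Propositional.Properties using (allFin⁺)
import Data.List.Relation.Unary.Unique.Setoid.Properties as Uniqueₛ
open import Data.Nat.Base as ℕ using (ℕ; zero; suc; _∸_; _!; NonZero)
open import Data.Nat.ListAction using (sum; product)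
open import Data.Nat.ListAction.Properties using (product≢0)
import Data.Nat.Properties as ℕ
open import Data.Product.Base using (_×_; _,_)
open import Data.Rational.Base as ℚ using (ℚ; 0ℚ; 1ℚ; ½)
import Data.Rational.Properties as ℚ
open import Data.Rational.Solver using (module +-*-Solver)
import Data.Rational.Unnormalised.Base as ℚᵘ
import Data.Rational.Unnormalised.Properties as ℚᵘ
open import Data.Vec.Functional using (Vector)
import Data.Vec.Properties as Vec
open import Function.Base using (id)
open import Level using (0ℓ)
open import Relation.Binary.Bundles using (Setoid)
import Relation.Binary.Definitions as B
open import Relation.Binary.PropositionalEquality using (_≡_; _≗_; refl; sym; trans; cong; cong₂; setoid; module ≡-Reasoning)
open import Relation.Nullary using (¬_; Dec)
open import Relation.Nullary.Decidable using (map′; _×-dec_)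
import Algebra.Definitions.RawSemiring as RawSemiringDefs
import Algebra.Properties.Semiring.Sum as SemiringSum

[1…_] : ℕ → List ℕ
[1… n ] = map suc (upTo n)

-- Fin n stands for [n]; only its order matters to the statistics below.
--
-- A permutation of suc n letters is determined by the image of the
-- first letter and by what remains after deleting that letter.
permutations : ∀ n → List (Permutation′ n)
permutations zero    = idₚ ∷ []
permutations (suc n) = cartesianProductWith (insert zero) (allFin (suc n)) (permutations n)

private
  permutationSetoid : ℕ → Setoid 0ℓ 0ℓ
  permutationSetoid n = record
    { Carrier       = Permutation′ n
    ; _≈_           = _≈_
    ; isEquivalence = record
      { refl  = λ _ → refl
      ; sym   = λ p i → sym (p i)
      ; trans = λ p q i → trans (p i) (q i)
      }
    }

  insert-cong : ∀ {n} {j k : Fin (suc n)} {π ρ : Permutation′ n} →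
                j ≡ k → π ≈ ρ → insert zero j π ≈ insert zero k ρ
  insert-cong refl p zero    = refl
  insert-cong refl p (suc i) = cong (punchIn _) (p i)

  insert-injective : ∀ {n} {j k : Fin (suc n)} {π ρ : Permutation′ n} →
                     insert zero j π ≈ insert zero k ρ → j ≡ k × π ≈ ρ
  insert-injective {j = j} {k} {π} {ρ} p with refl ← p zero =
    refl , λ i → Fin.punchIn-injective j _ _ (p (suc i))

permutations-complete : ∀ n (π : Permutation′ n) → Any (π ≈_) (permutations n)
permutations-complete zero    π = here λ ()
permutations-complete (suc n) π =
  Membershipₚ.∈-resp-≈ (permutationSetoid (suc n)) {x = insert zero (π ⟨$⟩ʳ zero) (remove zero π)} {y = π} (insert-remove zero π)
    (Membershipₚ.∈-cartesianProductWith⁺ (setoid (Fin (suc n))) (permutationSetoid n) (permutationSetoid (suc n))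
      (λ {_} {_} {π} {ρ} → insert-cong {π = π} {ρ}) (∈-allFin (π ⟨$⟩ʳ zero)) (permutations-complete n (remove zero π)))

permutations-unique : ∀ n → AllPairs (λ π ρ → ¬ π ≈ ρ) (permutations n)
permutations-unique zero    = [] ∷ []
permutations-unique (suc n) =
  Uniqueₛ.cartesianProductWith⁺ (setoid _) (permutationSetoid n) (permutationSetoid (suc n))
    (insert zero) (λ {_} {_} {π} {ρ} → insert-injective {π = π} {ρ}) (allFin⁺ (suc n)) (permutations-unique n)

cval : ∀ {n} → Permutation′ n → ℕ
cval {n} π = length (filter (λ i → (i Fin.<? π ⟨$⟩ˡ i) ×-dec (i Fin.<? π ⟨$⟩ʳ i)) (allFin n))

des : ∀ {n} → Permutation′ (suc n) → ℕ
des {n} π = length (filter (λ i → π ⟨$⟩ʳ suc i Fin.<? π ⟨$⟩ʳ inject₁ i) (allFin n))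

-- The first n iterates of i under π already exhaust its cycle.
cycle : ∀ {n} → Permutation′ n → Fin n → Subset n
cycle {n} π i = ⋃ (map ⁅_⁆ (iterate (π ⟨$⟩ʳ_) i n))

cycles : ∀ {n} → Permutation′ n → List (Subset n)
cycles {n} π = deduplicate (Vec.≡-dec Bool._≟_) (map (cycle π) (allFin n))

record Partition (n : ℕ) : Set where
  field
    parts    : List ℕ
    positive : All NonZero parts
    sorted   : Linked ℕ._≥_ parts
    sum≡     : sum parts ≡ n

open Partition public

m : ∀ {n} → Partition n → ℕ → ℕ
m Λ i = length (filter (i ℕ.≟_) (parts Λ))

HasCycleType : ∀ {n} → Partition n → Permutation′ n → Set
HasCycleType Λ π = map ∣_∣ (cycles π) ↭ parts Λ

_↭?_ : B.Decidable (_↭_ {A = ℕ})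
xs ↭? ys = map′ to from (List.≡-dec ℕ._≟_ (sort xs) (sort ys))
  where
  open import Data.List.Sort.InsertionSort ℕ.≤-decTotalOrder using (insertionSort)
  open import Data.List.Sort.Base ℕ.≤-totalOrder using (module SortingAlgorithm)
  open SortingAlgorithm insertionSort using (sort; sort-↭; sort-↗)

  to : sort xs ≡ sort ys → xs ↭ ys
  to eq = ↭-trans (↭-sym (sort-↭ xs)) (↭-trans (↭-reflexive eq) (sort-↭ ys))

  from : xs ↭ ys → sort xs ≡ sort ys
  from p = ≋.≋⇒≡ (↗↭↗⇒≋ ℕ.≤-totalOrder (sort-↗ xs) (sort-↗ ys)
    (↭⇒↭ₛ (↭-trans (sort-↭ xs) (↭-trans p (↭-sym (sort-↭ ys))))))

hasCycleType? : ∀ {n} (Λ : Partition n) (π : Permutation′ n) → Dec (HasCycleType Λ π)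
hasCycleType? Λ π = map ∣_∣ (cycles π) ↭? parts Λ

𝔖 : ∀ {n} → Partition n → List (Permutation′ n)
𝔖 {n} Λ = filter (hasCycleType? Λ) (permutations n)

-- Parts of a partition of n are at most n, so the factors with i > n are 1.
z : ∀ {n} → Partition n → ℕ
z {n} Λ = product (map (λ i → i ℕ.^ m Λ i ℕ.* m Λ i !) [1… n ])

z≢0 : ∀ {n} (Λ : Partition n) → NonZero (z Λ)
z≢0 {n} Λ = product≢0 (All.map⁺ (All.map⁺ (All.applyUpTo⁺₂ id n factor≢0)))
  where
  factor≢0 : ∀ i → NonZero (suc i ℕ.^ m Λ (suc i) ℕ.* m Λ (suc i) !)
  factor≢0 i = ℕ.m*n≢0 _ _ {{ℕ.m^n≢0 (suc i) (m Λ (suc i))}} {{ℕ._!≢0 (m Λ (suc i))}}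

private
  module ℚR = CommutativeRing ℚ.+-*-commutativeRing
  module ℚΣ = SemiringSum ℚR.semiring

-- A series is its sequence of coefficients.
ℚ⟦t⟧ : RawRing 0ℓ 0ℓ
ℚ⟦t⟧ = record
  { Carrier = ℕ → ℚ
  ; _≈_     = _≗_
  ; _+_     = λ f g n → f n ℚ.+ g n
  ; _*_     = λ f g n → ℚΣ.sum {suc n} λ i → f (toℕ i) ℚ.* g (n ∸ toℕ i)
  ; -_      = λ f n → ℚ.- f n
  ; 0#      = λ _ → 0ℚ
  ; 1#      = λ { zero → 1ℚ ; (suc _) → 0ℚ }
  }

open RawRing ℚ⟦t⟧ public
  using (0#; 1#; _+_; _*_; -_)
  renaming (Carrier to Series)

open RawSemiringDefs (RawRing.rawSemiring ℚ⟦t⟧) public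
  using (_^_)

infixl 6 _-_
_-_ : Series → Series → Series
f - g = f + (- g)

infixr 8 _•_
_•_ : ℚ → Series → Series
(q • f) n = q ℚ.* f n

∑ ∏ : List Series → Series
∑ = foldr _+_ 0#
∏ = foldr _*_ 1#

t : Series
t 1 = 1ℚ
t _ = 0ℚ

-- t⁻¹ f for a series f with zero constant term.
t⁻¹_ : Series → Series
(t⁻¹ f) n = f (suc n)

-- The binomial series Σₙ (-1)ⁿ C(½,n) tⁿ; see √[1-t]² below.
√[1-t] : Series
√[1-t] zero    = 1ℚ
√[1-t] (suc n) = (+ n ℚ./ 1 ℚ.- ½) ℚ.* √[1-t] n ℚ.* (+ 1 ℚ./ suc n)

private
  ι : ℕ → ℚ
  ι n = + n ℚ./ 1

  ι-suc : ∀ n → ι (suc n) ≡ 1ℚ ℚ.+ ι n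
  ι-suc n = ℚ.toℚᵘ-injective (begin
    ℚ.toℚᵘ (ι (suc n))                    ≈⟨ ℚ.toℚᵘ-fromℚᵘ (ℚᵘ.mkℚᵘ (+ suc n) 0) ⟩
    ℚᵘ.mkℚᵘ (+ suc n) 0                   ≈⟨ ℚᵘ.*≡* (cong (ℤ._* + 1) (cong₂ ℤ._+_ (refl {x = + 1}) (sym (ℤ.*-identityʳ (+ n))))) ⟩
    ℚᵘ.1ℚᵘ ℚᵘ.+ ℚᵘ.mkℚᵘ (+ n) 0           ≈⟨ ℚᵘ.+-congʳ ℚᵘ.1ℚᵘ (ℚ.toℚᵘ-fromℚᵘ (ℚᵘ.mkℚᵘ (+ n) 0)) ⟨
    ℚ.toℚᵘ 1ℚ ℚᵘ.+ ℚ.toℚᵘ (ι n)           ≈⟨ ℚ.toℚᵘ-homo-+ 1ℚ (ι n) ⟨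
    ℚ.toℚᵘ (1ℚ ℚ.+ ι n)                   ∎)
    where open import Relation.Binary.Reasoning.Setoid ℚᵘ.≃-setoid

  ι-+ : ∀ a b → ι (a ℕ.+ b) ≡ ι a ℚ.+ ι b
  ι-+ zero    b = sym (ℚ.+-identityˡ (ι b))
  ι-+ (suc a) b = begin
    ι (suc (a ℕ.+ b))       ≡⟨ ι-suc (a ℕ.+ b) ⟩
    1ℚ ℚ.+ ι (a ℕ.+ b)      ≡⟨ cong (1ℚ ℚ.+_) (ι-+ a b) ⟩
    1ℚ ℚ.+ (ι a ℚ.+ ι b)    ≡⟨ ℚ.+-assoc 1ℚ (ι a) (ι b) ⟨
    1ℚ ℚ.+ ι a ℚ.+ ι b      ≡⟨ cong (ℚ._+ ι b) (ι-suc a) ⟨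
    ι (suc a) ℚ.+ ι b       ∎
    where open ≡-Reasoning

  1/*ι : ∀ n → (+ 1 ℚ./ suc n) ℚ.* ι (suc n) ≡ 1ℚ
  1/*ι n = ℚ.toℚᵘ-injective (begin
    ℚ.toℚᵘ ((+ 1 ℚ./ suc n) ℚ.* ι (suc n))             ≈⟨ ℚ.toℚᵘ-homo-* (+ 1 ℚ./ suc n) (ι (suc n)) ⟩
    ℚ.toℚᵘ (+ 1 ℚ./ suc n) ℚᵘ.* ℚ.toℚᵘ (ι (suc n))     ≈⟨ ℚᵘ.*-cong (ℚ.toℚᵘ-fromℚᵘ (ℚᵘ.mkℚᵘ (+ 1) n)) (ℚ.toℚᵘ-fromℚᵘ (ℚᵘ.mkℚᵘ (+ suc n) 0)) ⟩
    ℚᵘ.mkℚᵘ (+ 1) n ℚᵘ.* ℚᵘ.mkℚᵘ (+ suc n) 0           ≈⟨ ℚᵘ.*≡* (ℤ.*-assoc (+ 1) (+ suc n) (+ 1)) ⟩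
    ℚᵘ.1ℚᵘ                                             ∎)
    where open import Relation.Binary.Reasoning.Setoid ℚᵘ.≃-setoid

  ι-cancel : ∀ n {p q} → ι (suc n) ℚ.* p ≡ ι (suc n) ℚ.* q → p ≡ q
  ι-cancel n {p} {q} eq = begin
    p                                              ≡⟨ unit p ⟩
    (+ 1 ℚ./ suc n) ℚ.* (ι (suc n) ℚ.* p)          ≡⟨ cong ((+ 1 ℚ./ suc n) ℚ.*_) eq ⟩
    (+ 1 ℚ./ suc n) ℚ.* (ι (suc n) ℚ.* q)          ≡⟨ unit q ⟨
    q                                              ∎
    where
    open ≡-Reasoning
    unit : ∀ r → r ≡ (+ 1 ℚ./ suc n) ℚ.* (ι (suc n) ℚ.* r)
    unit r = trans (sym (ℚ.*-identityˡ r))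
      (trans (cong (ℚ._* r) (sym (1/*ι n))) (ℚ.*-assoc (+ 1 ℚ./ suc n) (ι (suc n)) r))

  c : ℕ → ℚ
  c = √[1-t]

  c-rec : ∀ n → ι (suc n) ℚ.* c (suc n) ≡ (ι n ℚ.- ½) ℚ.* c n
  c-rec n = begin
    ι (suc n) ℚ.* (x ℚ.* (+ 1 ℚ./ suc n))      ≡⟨ ℚ.*-comm (ι (suc n)) _ ⟩
    x ℚ.* (+ 1 ℚ./ suc n) ℚ.* ι (suc n)        ≡⟨ ℚ.*-assoc x _ _ ⟩
    x ℚ.* ((+ 1 ℚ./ suc n) ℚ.* ι (suc n))      ≡⟨ cong (x ℚ.*_) (1/*ι n) ⟩
    x ℚ.* 1ℚ                                   ≡⟨ ℚ.*-identityʳ x ⟩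
    x                                          ∎
    where
    open ≡-Reasoning
    x = (ι n ℚ.- ½) ℚ.* c n

  module _ (n : ℕ) where
    cc icc jcc : Vector ℚ (suc n)
    cc  i = c (toℕ i) ℚ.* c (n ∸ toℕ i)
    icc i = ι (toℕ i) ℚ.* cc i
    jcc i = ι (n ∸ toℕ i) ℚ.* cc i

    ∑jcc≡∑icc : ℚΣ.sum jcc ≡ ℚΣ.sum icc
    ∑jcc≡∑icc = trans (ℚΣ.sum-permute jcc reverse) (ℚΣ.sum-cong-≗ λ i →
      trans (cong (λ k → ι (n ∸ k) ℚ.* (c k ℚ.* c (n ∸ k))) (Fin.opposite-prop i))
      (trans (cong (λ k → ι k ℚ.* (c (n ∸ toℕ i) ℚ.* c k)) (ℕ.m∸[m∸n]≡n (Fin.toℕ≤pred[n] i)))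
             (cong (ι (toℕ i) ℚ.*_) (ℚ.*-comm (c (n ∸ toℕ i)) (c (toℕ i))))))

    n*∑cc : ι n ℚ.* ℚΣ.sum cc ≡ ℚΣ.sum icc ℚ.+ ℚΣ.sum icc
    n*∑cc = begin
      ι n ℚ.* ℚΣ.sum cc                      ≡⟨ ℚΣ.*-distribˡ-sum (ι n) cc ⟩
      ℚΣ.sum (λ i → ι n ℚ.* cc i)            ≡⟨ ℚΣ.sum-cong-≗ split ⟩
      ℚΣ.sum (λ i → icc i ℚ.+ jcc i)         ≡⟨ ℚΣ.∑-distrib-+ icc jcc ⟩
      ℚΣ.sum icc ℚ.+ ℚΣ.sum jcc              ≡⟨ cong (ℚΣ.sum icc ℚ.+_) ∑jcc≡∑icc ⟩
      ℚΣ.sum icc ℚ.+ ℚΣ.sum icc              ∎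
      where
      open ≡-Reasoning
      split : ∀ i → ι n ℚ.* cc i ≡ icc i ℚ.+ jcc i
      split i = trans
        (cong (ℚ._* cc i) (trans (cong ι (sym (ℕ.m+[n∸m]≡n (Fin.toℕ≤pred[n] i)))) (ι-+ (toℕ i) _)))
        (ℚ.*-distribʳ-+ (cc i) (ι (toℕ i)) (ι (n ∸ toℕ i)))

  ∑icc-suc : ∀ n → ℚΣ.sum (icc (suc n)) ≡ ℚΣ.sum (icc n) ℚ.- ½ ℚ.* ℚΣ.sum (cc n)
  ∑icc-suc n = begin
    icc (suc n) zero ℚ.+ ℚΣ.sum (λ i → icc (suc n) (suc i))       ≡⟨ cong₂ ℚ._+_ (ℚ.*-zeroˡ (cc (suc n) zero)) (ℚΣ.sum-cong-≗ step) ⟩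
    0ℚ ℚ.+ ℚΣ.sum (λ i → icc n i ℚ.+ ℚ.- ½ ℚ.* cc n i)             ≡⟨ ℚ.+-identityˡ _ ⟩
    ℚΣ.sum (λ i → icc n i ℚ.+ ℚ.- ½ ℚ.* cc n i)                    ≡⟨ ℚΣ.∑-distrib-+ (icc n) (λ i → ℚ.- ½ ℚ.* cc n i) ⟩
    ℚΣ.sum (icc n) ℚ.+ ℚΣ.sum (λ i → ℚ.- ½ ℚ.* cc n i)             ≡⟨ cong (ℚΣ.sum (icc n) ℚ.+_) (ℚΣ.*-distribˡ-sum (ℚ.- ½) (cc n)) ⟨
    ℚΣ.sum (icc n) ℚ.+ ℚ.- ½ ℚ.* ℚΣ.sum (cc n)                     ≡⟨ cong (ℚΣ.sum (icc n) ℚ.+_) (ℚ.neg-distribˡ-* ½ (ℚΣ.sum (cc n))) ⟨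
    ℚΣ.sum (icc n) ℚ.- ½ ℚ.* ℚΣ.sum (cc n)                         ∎
    where
    open ≡-Reasoning
    step : ∀ i → icc (suc n) (suc i) ≡ icc n i ℚ.+ ℚ.- ½ ℚ.* cc n i
    step i = begin
      ι (suc k) ℚ.* (c (suc k) ℚ.* d)        ≡⟨ ℚ.*-assoc (ι (suc k)) (c (suc k)) d ⟨
      ι (suc k) ℚ.* c (suc k) ℚ.* d          ≡⟨ cong (ℚ._* d) (c-rec k) ⟩
      (ι k ℚ.- ½) ℚ.* c k ℚ.* d              ≡⟨ ℚ.*-assoc (ι k ℚ.- ½) (c k) d ⟩
      (ι k ℚ.- ½) ℚ.* (c k ℚ.* d)            ≡⟨ ℚ.*-distribʳ-+ (c k ℚ.* d) (ι k) (ℚ.- ½) ⟩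
      icc n i ℚ.+ ℚ.- ½ ℚ.* cc n i           ∎
      where
      k = toℕ i
      d = c (n ∸ k)

  square-rec : ∀ n → ι (suc n) ℚ.* (√[1-t] * √[1-t]) (suc n) ≡ (ι n ℚ.- 1ℚ) ℚ.* (√[1-t] * √[1-t]) n
  square-rec n = begin
    ι (suc n) ℚ.* ℚΣ.sum (cc (suc n))                         ≡⟨ n*∑cc (suc n) ⟩
    ℚΣ.sum (icc (suc n)) ℚ.+ ℚΣ.sum (icc (suc n))             ≡⟨ cong₂ ℚ._+_ (∑icc-suc n) (∑icc-suc n) ⟩
    (s ℚ.- ½ ℚ.* u) ℚ.+ (s ℚ.- ½ ℚ.* u)                       ≡⟨ solve 2 (λ s u → (s :- con ½ :* u) :+ (s :- con ½ :* u) := (s :+ s) :- u) refl s u ⟩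
    (s ℚ.+ s) ℚ.- u                                           ≡⟨ cong (ℚ._- u) (n*∑cc n) ⟨
    ι n ℚ.* u ℚ.- u                                           ≡⟨ solve 2 (λ a u → a :* u :- u := (a :- con 1ℚ) :* u) refl (ι n) u ⟩
    (ι n ℚ.- 1ℚ) ℚ.* u                                        ∎
    where
    open ≡-Reasoning
    open +-*-Solver
    s = ℚΣ.sum (icc n)
    u = ℚΣ.sum (cc n)

√[1-t]² : √[1-t] * √[1-t] ≗ 1# - t
√[1-t]² 0 = refl
√[1-t]² 1 = refl
√[1-t]² 2 = refl
√[1-t]² (suc n@(suc (suc _))) = ι-cancel n (begin
  ι (suc n) ℚ.* (√[1-t] * √[1-t]) (suc n)    ≡⟨ square-rec n ⟩
  (ι n ℚ.- 1ℚ) ℚ.* (√[1-t] * √[1-t]) n       ≡⟨ cong ((ι n ℚ.- 1ℚ) ℚ.*_) (√[1-t]² n) ⟩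
  (ι n ℚ.- 1ℚ) ℚ.* 0ℚ                        ≡⟨ ℚ.*-zeroʳ (ι n ℚ.- 1ℚ) ⟩
  0ℚ                                         ≡⟨ ℚ.*-zeroʳ (ι (suc n)) ⟨
  ι (suc n) ℚ.* 0ℚ                           ∎)
  where open ≡-Reasoning

w : Series
w = (+ 2 ℚ./ 1) • (t⁻¹ (1# - √[1-t])) - 1#

-- The Eulerian polynomial Aₙ evaluated at a power series.
A : ℕ → Series → Series
A zero    x = 1#
A (suc n) x = ∑ (map (λ π → x ^ suc (des π)) (permutations (suc n)))

{-# OPTIONS --safe #-}

-- Build permutations by inserting a new least element, either as a fixed point or on an arc i → π(i) of a
-- cycle. The effect on the cyclic valleys depends only on the length of that cycle and on its number of
-- valleys, so the sum over all permutations becomes a sum over set partitions of products of cycle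
-- polynomials, and the number of set partitions of type λ is n! / ∏ (i!)^mᵢ mᵢ!. The cycle polynomials obey
-- the recursion of the grammar a ↦ ab, b ↦ ab, read in terms of ab and a + b; so do the homogeneous Eulerian
-- polynomials, read in terms of a and b (insert a new least letter into a word). Put a = 1 - √(1 - t) and
-- b = 1 + √(1 - t): then ab = t, a + b = 2 and w = a / b.

module Submission where

open import Algebra.Bundles using (CommutativeMonoid; CommutativeRing; CommutativeSemiring)
import Algebra.Properties.CommutativeMonoid.Sum as MonoidSum
open import Data.Bool.Base using (true; false; if_then_else_)
import Data.Bool.Properties as Bool
open import Data.Fin.Base as Fin using (Fin; zero; suc; toℕ; inject₁; punchOut)
open import Data.Fin.Permutation using (Permutation′; _⟨$⟩ʳ_; _⟨$⟩ˡ_; _∘ₚ_; flip; insert; inverseˡ; inverseʳ; lift₀; lift₀-cong; lift₀-remove; remove; transpose)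
  renaming (id to idₚ; _≈_ to _≈ₚ_)
open import Data.Fin.Permutation.Components using (transpose-inverse)
open import Data.Fin.Properties using (_≟_; _<?_; <-asym; <-irrefl; pigeonhole; punchIn-punchOut; suc-injective; toℕ≤pred[n])
open import Data.Fin.Subset as Subset using (Subset; ⁅_⁆; ⋃; ∣_∣)
import Data.Fin.Subset.Properties as Subset
import Data.Integer.Base as ℤ
import Data.Integer.Properties as ℤ
open import Data.List.Base as List using (List; []; _∷_; _++_; allFin; cartesianProductWith; concatMap; deduplicate; filter; foldr; iterate; length; map; tabulate)
open import Data.List.Membership.Propositional using (_∈_)
open import Data.List.Membership.Propositional.Properties using (∈-allFin; ∈-deduplicate⁺; ∈-deduplicate⁻; ∈-map⁺; ∈-map⁻; ∈-tabulate⁺; ∈-tabulate⁻; ∈-upTo⁺)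
open import Data.List.Membership.Propositional.Properties.WithK using (unique∧set⇒bag)
import Data.List.Properties as List
open import Data.List.Relation.Binary.BagAndSetEquality using (∼bag⇒↭)
open import Data.List.Relation.Binary.Permutation.Propositional as ↭ using (_↭_; prep; swap; ↭-refl; ↭-reflexive; ↭-sym; ↭-trans)
import Data.List.Relation.Binary.Permutation.Propositional.Properties as ↭
open import Data.List.Relation.Unary.All as All using (All; []; _∷_)
import Data.List.Relation.Unary.All.Properties as All
open import Data.List.Relation.Unary.AllPairs as AllPairs using (AllPairs; []; _∷_)
import Data.List.Relation.Unary.AllPairs.Properties as AllPairs
open import Data.List.Relation.Unary.Any as Any using (Any; here; there)
import Data.List.Relation.Unary.Any.Properties as Any
open import Data.List.Relation.Unary.Unique.Propositional using (Unique)
import Data.List.Relation.Unary.Unique.DecPropositional.Properties as DecUnique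
import Data.List.Relation.Unary.Unique.Propositional.Properties as Unique
import Data.List.Relation.Unary.Unique.Setoid.Properties as Uniqueₛ
open import Data.Nat.Base as ℕ using (ℕ; zero; suc; pred; NonZero; _∸_; _!)
import Data.Nat.ListAction as ℕ
import Data.Nat.Properties as ℕ
open import Data.Nat.Properties using (_!≢0)
open import Data.Nat.Tactic.RingSolver using (solve-∀)
open import Data.Product.Base as Product using (∃; _,_; proj₁; proj₂)
open import Data.Rational.Base as ℚ using (ℚ; 0ℚ; 1ℚ; _/_)
import Data.Rational.Properties as ℚ
open import Data.Rational.Solver using (module +-*-Solver)
import Data.Rational.Unnormalised.Base as ℚᵘ
import Data.Rational.Unnormalised.Properties as ℚᵘ
open import Data.Sum.Base using (inj₁; inj₂)
open import Data.Vec.Base as Vec using (Vec)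
open import Data.Vec.Functional using (insertAt; updateAt)
open import Data.Vec.Functional.Properties using (insertAt-lookup; insertAt-punchIn; updateAt-minimal; updateAt-updates)
import Data.Vec.Properties as Vec
open import Function.Base using (_∘_; const)
open import Function.Bundles using (mk⇔)
open import Level using (0ℓ)
open import Relation.Binary.Bundles using (Setoid)
open import Relation.Binary.Construct.Closure.ReflexiveTransitive using (Star; ε; _◅_; _◅◅_)
open import Relation.Binary.PropositionalEquality as ≡ using (_≡_; _≗_)
open import Relation.Nullary using (Dec; yes; no; does; contradiction; ¬_)
open import Relation.Nullary.Decidable using (_×-dec_; dec-false; dec-true; does-⇔)
open import Relation.Unary using (Decidable)

open import Defs using (cval; cycle; cycles; des; permutations; permutations-complete; permutations-unique)

-- No two valleys of a cycle are adjacent, so a cycle with `v` valleys and `e` arcs off them has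
-- length `v + v + e`, and these two numbers are all that later insertions see. In the grammar it is
-- (ab)^v ((a + b)/2)^e: a fixed point is (a + b)/2, its first insertion gives ab, and ab is also
-- the one-letter word at which the Eulerian recursion starts. This shift by one is why a part i
-- carries A_(i-1). As (a + b)/2 becomes 1, a fixed point brings no power of b, whence the exponent
-- n - m_1.
--
-- Both recursions act on test functions, not on polynomials: an insertion replaces the function to
-- be summed by its transform, and each induction runs over all functions at once.
--
-- The obstacle is that `permutations` and `cycles` are not built by inserting minima. Every
-- insertion therefore carries along a labelling of the cycles, which is matched with `cycles`
-- afterwards, and sums over different enumerations of the permutations are compared through their
-- words.

private
  module ℕSum = MonoidSum ℕ.+-0-commutativeMonoid


-- Indicators, multiplicities and folds over lists

[_] : ∀ {p} {P : Set p} → Dec P → ℕ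
[ P? ] = if does P? then 1 else 0

[]-yes : ∀ {p} {P : Set p} (P? : Dec P) → P → [ P? ] ≡ 1
[]-yes P? p = ≡.cong (if_then 1 else 0) (dec-true P? p)

[]-no : ∀ {p} {P : Set p} (P? : Dec P) → ¬ P → [ P? ] ≡ 0
[]-no P? ¬p = ≡.cong (if_then 1 else 0) (dec-false P? ¬p)

[≟]-sym : ∀ i j → [ i ℕ.≟ j ] ≡ [ j ℕ.≟ i ]
[≟]-sym i j = ≡.cong (if_then 1 else 0) (does-⇔ (mk⇔ ≡.sym ≡.sym) (i ℕ.≟ j) (j ℕ.≟ i))

multiplicity : ℕ → List ℕ → ℕ
multiplicity k ks = length (filter (k ℕ.≟_) ks)

multiplicity-∷ : ∀ k x xs → multiplicity k (x ∷ xs) ≡ [ k ℕ.≟ x ] ℕ.+ multiplicity k xs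
multiplicity-∷ k x xs with does (k ℕ.≟ x)
... | true  = ≡.refl
... | false = ≡.refl

-- Written additively but also instantiated at multiplicative monoids, where `∑ₗ` is a product and
-- `_×_` a power.
module ListFold {c ℓ} (M : CommutativeMonoid c ℓ) where
  open CommutativeMonoid M renaming
    ( _∙_ to _+_; ε to 0#; ∙-cong to +-cong; ∙-congˡ to +-congˡ; ∙-congʳ to +-congʳ
    ; assoc to +-assoc; identityˡ to +-identityˡ; identityʳ to +-identityʳ)
  open import Algebra.Properties.CommutativeMonoid.Sum M public using (sum)
  open import Algebra.Properties.CommutativeMonoid.Mult M
  open import Algebra.Properties.CommutativeSemigroup commutativeSemigroup using (interchange; x∙yz≈y∙xz)

  ∑ₗ : ∀ {a} {A : Set a} → List A → (A → Carrier) → Carrier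
  ∑ₗ xs f = foldr _+_ 0# (map f xs)

  module _ {a} {A : Set a} where

    ∑ₗ-cong : ∀ (xs : List A) {f g} → (∀ x → f x ≈ g x) → ∑ₗ xs f ≈ ∑ₗ xs g
    ∑ₗ-cong []       f≈g = refl
    ∑ₗ-cong (x ∷ xs) f≈g = +-cong (f≈g x) (∑ₗ-cong xs f≈g)

    ∑ₗ-++ : ∀ (xs ys : List A) f → ∑ₗ (xs ++ ys) f ≈ ∑ₗ xs f + ∑ₗ ys f
    ∑ₗ-++ []       ys f = sym (+-identityˡ _)
    ∑ₗ-++ (x ∷ xs) ys f = trans (+-congˡ (∑ₗ-++ xs ys f)) (sym (+-assoc _ _ _))

    ∑ₗ-map : ∀ {b} {B : Set b} (g : B → A) xs f → ∑ₗ (map g xs) f ≈ ∑ₗ xs (f ∘ g)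
    ∑ₗ-map g xs f = reflexive (≡.cong (foldr _+_ 0#) (≡.sym (List.map-∘ xs)))

    ∑ₗ-concatMap : ∀ {b} {B : Set b} (g : B → List A) xs f →
                   ∑ₗ (concatMap g xs) f ≈ ∑ₗ xs (λ x → ∑ₗ (g x) f)
    ∑ₗ-concatMap g []       f = refl
    ∑ₗ-concatMap g (x ∷ xs) f =
      trans (∑ₗ-++ (g x) (concatMap g xs) f) (+-congˡ (∑ₗ-concatMap g xs f))

    ∑ₗ-tabulate : ∀ {n} (g : Fin n → A) f → ∑ₗ (tabulate g) f ≈ sum (f ∘ g)
    ∑ₗ-tabulate {zero}  g f = refl
    ∑ₗ-tabulate {suc n} g f = +-congˡ (∑ₗ-tabulate (g ∘ suc) f)

    ∑ₗ-cartesianProductWith : ∀ {b d} {B : Set b} {D : Set d} (g : B → D → A) xs ys f →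
      ∑ₗ (cartesianProductWith g xs ys) f ≈ ∑ₗ xs (λ x → ∑ₗ ys (λ y → f (g x y)))
    ∑ₗ-cartesianProductWith g []       ys f = refl
    ∑ₗ-cartesianProductWith g (x ∷ xs) ys f = trans (∑ₗ-++ (map (g x) ys) _ f)
      (+-cong (∑ₗ-map (g x) ys f) (∑ₗ-cartesianProductWith g xs ys f))

    ∑ₗ-zero : ∀ (xs : List A) → ∑ₗ xs (λ _ → 0#) ≈ 0#
    ∑ₗ-zero []       = refl
    ∑ₗ-zero (x ∷ xs) = trans (+-identityˡ _) (∑ₗ-zero xs)

    ∑ₗ-+ : ∀ (xs : List A) f g → ∑ₗ xs (λ x → f x + g x) ≈ ∑ₗ xs f + ∑ₗ xs g
    ∑ₗ-+ []       f g = sym (+-identityˡ _)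
    ∑ₗ-+ (x ∷ xs) f g = trans (+-congˡ (∑ₗ-+ xs f g)) (interchange _ _ _ _)

    ∑ₗ-↭ : ∀ {xs ys : List A} f → xs ↭ ys → ∑ₗ xs f ≈ ∑ₗ ys f
    ∑ₗ-↭ f ↭.refl        = refl
    ∑ₗ-↭ f (prep x p)    = +-congˡ (∑ₗ-↭ f p)
    ∑ₗ-↭ f (swap x y p)  = trans (+-congˡ (+-congˡ (∑ₗ-↭ f p))) (x∙yz≈y∙xz _ _ _)
    ∑ₗ-↭ f (↭.trans p q) = trans (∑ₗ-↭ f p) (∑ₗ-↭ f q)

    ∑ₗ-filter : ∀ {p} {P : A → Set p} (P? : Decidable P) xs f →
                ∑ₗ (filter P? xs) f ≈ ∑ₗ xs (λ x → if does (P? x) then f x else 0#)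
    ∑ₗ-filter P? []       f = refl
    ∑ₗ-filter P? (x ∷ xs) f with does (P? x)
    ... | true  = +-congˡ (∑ₗ-filter P? xs f)
    ... | false = trans (∑ₗ-filter P? xs f) (sym (+-identityˡ _))

  ∑ₗ-swap : ∀ {a b} {A : Set a} {B : Set b} (xs : List A) (ys : List B) (f : A → B → Carrier) →
            ∑ₗ xs (λ x → ∑ₗ ys (f x)) ≈ ∑ₗ ys (λ y → ∑ₗ xs (λ x → f x y))
  ∑ₗ-swap []       ys f = sym (∑ₗ-zero ys)
  ∑ₗ-swap (x ∷ xs) ys f = trans (+-congˡ (∑ₗ-swap xs ys f)) (sym (∑ₗ-+ ys (f x) _))

  ∑ₗ-indicator : ∀ k (is : List ℕ) x → ∑ₗ is (λ i → [ i ℕ.≟ k ] × x) ≈ multiplicity k is × x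
  ∑ₗ-indicator k []       x = refl
  ∑ₗ-indicator k (i ∷ is) x = trans (+-cong (×-congˡ ([≟]-sym i k)) (∑ₗ-indicator k is x))
    (trans (sym (×-homo-+ x [ k ℕ.≟ i ] (multiplicity k is))) (×-congˡ (≡.sym (multiplicity-∷ k i is))))

  -- Every `k` in `ks` meets exactly one index in `is`. In a multiplicative monoid this passes
  -- between a product over the parts of a partition and a product over the sizes with
  -- multiplicities as exponents.
  ∑ₗ-multiplicity : ∀ (is ks : List ℕ) f → All (λ k → multiplicity k is ≡ 1) ks →
                    ∑ₗ is (λ i → multiplicity i ks × f i) ≈ ∑ₗ ks f
  ∑ₗ-multiplicity is []       f []       = ∑ₗ-zero is
  ∑ₗ-multiplicity is (k ∷ ks) f (p ∷ ps) = trans (∑ₗ-cong is split)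
    (trans (∑ₗ-+ is _ _) (+-cong
      (trans (∑ₗ-indicator k is (f k)) (trans (×-congˡ p) (×-homo-1 (f k))))
      (∑ₗ-multiplicity is ks f ps)))
    where
    at : ∀ i (i≟k : Dec (i ≡ k)) → [ i≟k ] × f i ≈ [ i≟k ] × f k
    at i (yes ≡.refl) = refl
    at i (no _)       = refl
    split : ∀ i → multiplicity i (k ∷ ks) × f i ≈ [ i ℕ.≟ k ] × f k + multiplicity i ks × f i
    split i = trans (×-congˡ (multiplicity-∷ i k ks)) (trans (×-homo-+ (f i) [ i ℕ.≟ k ] _) (+-congʳ (at i (i ℕ.≟ k))))

module ListSum {c ℓ} (R : CommutativeSemiring c ℓ) where
  open CommutativeSemiring R
  open ListFold +-commutativeMonoid public
  open import Algebra.Properties.CommutativeMonoid.Mult +-commutativeMonoid public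
  open ListFold *-commutativeMonoid public using () renaming (∑ₗ to ∏ₗ)

  module _ {a} {A : Set a} where

    ∑ₗ-*ˡ : ∀ (xs : List A) f r → ∑ₗ xs (λ x → r * f x) ≈ r * ∑ₗ xs f
    ∑ₗ-*ˡ []       f r = sym (zeroʳ r)
    ∑ₗ-*ˡ (x ∷ xs) f r = trans (+-congˡ (∑ₗ-*ˡ xs f r)) (sym (distribˡ r _ _))

    ∑ₗ-× : ∀ (xs : List A) (f : A → ℕ) x → ∑ₗ xs (λ y → f y × x) ≈ foldr ℕ._+_ 0 (map f xs) × x
    ∑ₗ-× []       f x = refl
    ∑ₗ-× (y ∷ ys) f x = trans (+-congˡ (∑ₗ-× ys f x)) (sym (×-homo-+ x (f y) _))

-- Cycles and set partitions under insertion of a minimum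

bumps : List ℕ → List (List ℕ)
bumps []       = []
bumps (k ∷ ks) = (suc k ∷ ks) ∷ map (k ∷_) (bumps ks)

-- The block sizes, each diminished by one, of all the set partitions of n elements.
types : ℕ → List (List ℕ)
types zero    = [] ∷ []
types (suc n) = concatMap (λ ks → (0 ∷ ks) ∷ bumps ks) (types n)

module Valleys {c ℓ} (R : CommutativeSemiring c ℓ) where
  open CommutativeSemiring R hiding (zero)
  open ListSum R
  open import Algebra.Properties.Semiring.Mult semiring using (×-assoc-*)
  open import Algebra.Properties.CommutativeSemigroup +-commutativeSemigroup using (interchange)
  open import Relation.Binary.Reasoning.Setoid setoid

  Stats : Set
  Stats = ℕ Product.× ℕ

  -- The pair (v , e) describes a cycle with v valleys and e arcs having no valley as an end. A new minimum
  -- is itself a valley: put on one of the v + v arcs at a valley it supersedes that valley and frees its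
  -- other arc; put on one of the e remaining arcs it adds a valley.
  grow : (ℕ → ℕ → Carrier) → ℕ → ℕ → Carrier
  grow f v e = (v ℕ.+ v) × f v (suc e) + e × f (suc v) (pred e)

  growAny : (List Stats → Carrier) → List Stats → Carrier
  growAny G []            = 0#
  growAny G ((v , e) ∷ L) = grow (λ v e → G ((v , e) ∷ L)) v e + growAny (G ∘ ((v , e) ∷_)) L

  -- (0 , 1) is the new minimum as a fixed point.
  insertMin : (List Stats → Carrier) → List Stats → Carrier
  insertMin G L = G ((0 , 1) ∷ L) + growAny G L

  -- onCycles k f is the sum of f over all cycles of suc k given elements, and onTypes ks G the sum of G over
  -- all choices of a cycle on each block of a set partition with block sizes map suc ks.
  onCycles : ℕ → (ℕ → ℕ → Carrier) → Carrier
  onCycles zero    f = f 0 1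
  onCycles (suc k) f = onCycles k (grow f)

  onTypes : List ℕ → (List Stats → Carrier) → Carrier
  onTypes []       G = G []
  onTypes (k ∷ ks) G = onCycles k (λ v e → onTypes ks (G ∘ ((v , e) ∷_)))

  size : Stats → ℕ
  size (v , e) = v ℕ.+ v ℕ.+ e

  -- An insertion lengthens a cycle by one, so agreement is asked only at the matching size. This
  -- restriction later lets a test of the cycle type be decided from the blocks alone.
  grow-cong : ∀ {f g} k → (∀ v e → size (v , e) ≡ suc k → f v e ≈ g v e) →
              ∀ v e → size (v , e) ≡ k → grow f v e ≈ grow g v e
  grow-cong {f} {g} k f≈g v e s = +-cong (×-congʳ (v ℕ.+ v) (f≈g v (suc e) p)) (q e s)
    where
    open import Data.Nat.Properties using (+-suc)
    p = ≡.trans (+-suc (v ℕ.+ v) e) (≡.cong suc s)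
    q : ∀ e → size (v , e) ≡ k → e × f (suc v) (pred e) ≈ e × g (suc v) (pred e)
    -- At `pred 0` the size relation fails, but the coefficient there is 0.
    q zero    s = refl
    q (suc e) s = ×-congʳ (suc e) (f≈g (suc v) e
      (≡.cong suc (≡.trans (≡.cong (ℕ._+ e) (+-suc v v)) (≡.trans (≡.sym (+-suc (v ℕ.+ v) e)) s))))

  onCycles-cong : ∀ k {f g} → (∀ v e → size (v , e) ≡ suc k → f v e ≈ g v e) → onCycles k f ≈ onCycles k g
  onCycles-cong zero    f≈g = f≈g 0 1 ≡.refl
  onCycles-cong (suc k) f≈g = onCycles-cong k (grow-cong (suc k) f≈g)

  onTypes-cong : ∀ ks {G H} → (∀ L → map size L ≡ map suc ks → G L ≈ H L) → onTypes ks G ≈ onTypes ks H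
  onTypes-cong []       G≈H = G≈H [] ≡.refl
  onTypes-cong (k ∷ ks) G≈H = onCycles-cong k λ v e s →
    onTypes-cong ks λ L p → G≈H ((v , e) ∷ L) (≡.cong₂ _∷_ s p)

  grow-+ : ∀ f g v e → grow (λ v e → f v e + g v e) v e ≈ grow f v e + grow g v e
  grow-+ f g v e = trans (+-cong (×-distrib-+ _ _ (v ℕ.+ v)) (×-distrib-+ _ _ e)) (interchange _ _ _ _)

  ×-0 : ∀ n → n × 0# ≈ 0#
  ×-0 zero    = refl
  ×-0 (suc n) = trans (+-identityˡ _) (×-0 n)

  ×-swap : ∀ m n x → m × (n × x) ≈ n × (m × x)
  ×-swap m n x = trans (×-assocˡ x m n) (trans (×-congˡ (ℕ.*-comm m n)) (sym (×-assocˡ x n m)))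
    where import Data.Nat.Properties as ℕ

  grow-0 : ∀ v e → grow (λ _ _ → 0#) v e ≈ 0#
  grow-0 v e = trans (+-cong (×-0 (v ℕ.+ v)) (×-0 e)) (+-identityˡ 0#)

  grow-× : ∀ n f v e → grow (λ v e → n × f v e) v e ≈ n × grow f v e
  grow-× n f v e = trans (+-cong (×-swap (v ℕ.+ v) n _) (×-swap e n _)) (sym (×-distrib-+ _ _ n))

  grow-* : ∀ f x v e → grow (λ v e → f v e * x) v e ≈ grow f v e * x
  grow-* f x v e = trans (+-cong (sym (×-assoc-* (v ℕ.+ v) _ x)) (sym (×-assoc-* e _ x))) (sym (distribʳ x _ _))

  onCycles-+ : ∀ k f g → onCycles k (λ v e → f v e + g v e) ≈ onCycles k f + onCycles k g
  onCycles-+ zero    f g = refl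
  onCycles-+ (suc k) f g = trans (onCycles-cong k λ v e _ → grow-+ f g v e) (onCycles-+ k (grow f) (grow g))

  onCycles-0 : ∀ k → onCycles k (λ _ _ → 0#) ≈ 0#
  onCycles-0 zero    = refl
  onCycles-0 (suc k) = trans (onCycles-cong k λ v e _ → grow-0 v e) (onCycles-0 k)

  onCycles-* : ∀ k f x → onCycles k (λ v e → f v e * x) ≈ onCycles k f * x
  onCycles-* zero    f x = refl
  onCycles-* (suc k) f x = trans (onCycles-cong k λ v e _ → grow-* f x v e) (onCycles-* k (grow f) x)

  onCycles-× : ∀ k n f → onCycles k (λ v e → n × f v e) ≈ n × onCycles k f
  onCycles-× zero    n f = refl
  onCycles-× (suc k) n f = trans (onCycles-cong k λ v e _ → grow-× n f v e) (onCycles-× k n (grow f))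

  onTypes-+ : ∀ ks G H → onTypes ks (λ L → G L + H L) ≈ onTypes ks G + onTypes ks H
  onTypes-+ []       G H = refl
  onTypes-+ (k ∷ ks) G H = trans (onCycles-cong k λ v e _ → onTypes-+ ks _ _) (onCycles-+ k _ _)

  onTypes-× : ∀ ks n G → onTypes ks (λ L → n × G L) ≈ n × onTypes ks G
  onTypes-× []       n G = refl
  onTypes-× (k ∷ ks) n G = trans (onCycles-cong k λ v e _ → onTypes-× ks n _) (onCycles-× k n _)

  onCycles-∑ : ∀ {a} {A : Set a} k (xs : List A) (f : A → ℕ → ℕ → Carrier) →
    onCycles k (λ v e → ∑ₗ xs (λ x → f x v e)) ≈ ∑ₗ xs (λ x → onCycles k (f x))
  onCycles-∑ k []       f = onCycles-0 k
  onCycles-∑ k (x ∷ xs) f = trans (onCycles-+ k _ _) (+-congˡ (onCycles-∑ k xs f))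

  -- Growing the first cycle is the step from `onCycles k` to `onCycles (suc k)`; growing a later
  -- one leaves the first block alone. These are the head and the tail of `bumps`.
  onTypes-growAny : ∀ ks G → onTypes ks (growAny G) ≈ ∑ₗ (bumps ks) (λ b → onTypes b G)
  onTypes-growAny []       G = refl
  onTypes-growAny (k ∷ ks) G = begin
    onCycles k (λ v e → onTypes ks (λ L → grow (λ v e → G ((v , e) ∷ L)) v e + growAny (G ∘ ((v , e) ∷_)) L))
      ≈⟨ onCycles-cong k (λ v e _ → trans (onTypes-+ ks _ _)
           (+-cong (trans (onTypes-+ ks _ _) (+-cong (onTypes-× ks (v ℕ.+ v) _) (onTypes-× ks e _)))
                   (onTypes-growAny ks (G ∘ ((v , e) ∷_))))) ⟩
    onCycles k (λ v e → grow (λ v e → onTypes ks (G ∘ ((v , e) ∷_))) v e + ∑ₗ (bumps ks) (λ b → onTypes b (G ∘ ((v , e) ∷_))))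
      ≈⟨ onCycles-+ k _ _ ⟩
    onTypes (suc k ∷ ks) G + onCycles k (λ v e → ∑ₗ (bumps ks) (λ b → onTypes b (G ∘ ((v , e) ∷_))))
      ≈⟨ +-congˡ (onCycles-∑ k (bumps ks) _) ⟩
    onTypes (suc k ∷ ks) G + ∑ₗ (bumps ks) (λ b → onTypes (k ∷ b) G)
      ≈⟨ +-congˡ (∑ₗ-map (k ∷_) (bumps ks) (λ b → onTypes b G)) ⟨
    ∑ₗ (bumps (k ∷ ks)) (λ b → onTypes b G)
      ∎

  onTypes-insertMin : ∀ ks G → onTypes ks (insertMin G) ≈ ∑ₗ ((0 ∷ ks) ∷ bumps ks) (λ b → onTypes b G)
  onTypes-insertMin ks G = trans (onTypes-+ ks _ _) (+-congˡ (onTypes-growAny ks G))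

  -- The cycles on different blocks are chosen independently, so this is distributivity.
  onTypes-∏ : ∀ ks (h : Stats → Carrier) →
              onTypes ks (λ L → ∏ₗ L h) ≈ ∏ₗ ks (λ k → onCycles k (λ v e → h (v , e)))
  onTypes-∏ []       h = refl
  onTypes-∏ (k ∷ ks) h = begin
    onCycles k (λ v e → onTypes ks (λ L → h (v , e) * ∏ₗ L h)) ≈⟨ onCycles-cong k (λ v e _ → onTypes-*ˡ ks (h (v , e)) (λ L → ∏ₗ L h)) ⟩
    onCycles k (λ v e → h (v , e) * onTypes ks (λ L → ∏ₗ L h))         ≈⟨ onCycles-* k _ _ ⟩
    onCycles k (λ v e → h (v , e)) * onTypes ks (λ L → ∏ₗ L h)         ≈⟨ *-congˡ (onTypes-∏ ks h) ⟩
    ∏ₗ (k ∷ ks) (λ k → onCycles k (λ v e → h (v , e)))         ∎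
    where
    onTypes-*ˡ : ∀ ks x G → onTypes ks (λ L → x * G L) ≈ x * onTypes ks G
    onTypes-*ˡ []       x G = refl
    onTypes-*ˡ (k ∷ ks) x G = trans
      (onCycles-cong k λ v e _ → trans (onTypes-*ˡ ks x _) (*-comm x _))
      (trans (onCycles-* k _ x) (*-comm _ x))

-- Valleys under insertion, and labellings of the cycles

module _ where
  open ≡ using (refl; sym; trans; cong; cong₂; subst)
  open import Data.Nat.Base using (_+_; _*_)
  open import Data.Fin.Base using (_<_)
  open import Data.Product.Base using (_×_)
  open ℕSum using (sum; sum-cong-≗; ∑-distrib-+; sum-permute; sum-replicate-zero)

  δ : ∀ {n} → Fin n → Fin n → ℕ
  δ i j = [ i ≟ j ]

  length-filter-tabulate : ∀ {a p} {A : Set a} {P : A → Set p} (P? : Decidable P) {n} (f : Fin n → A) →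
                           length (filter P? (tabulate f)) ≡ sum (λ i → [ P? (f i) ])
  length-filter-tabulate P? {zero}  f = refl
  length-filter-tabulate P? {suc n} f with does (P? (f zero))
  ... | true  = cong suc (length-filter-tabulate P? (f ∘ suc))
  ... | false = length-filter-tabulate P? (f ∘ suc)

  IsValley : ∀ {n} → Permutation′ n → Fin n → Set
  IsValley π i = i < π ⟨$⟩ˡ i × i < π ⟨$⟩ʳ i

  isValley? : ∀ {n} (π : Permutation′ n) → Decidable (IsValley π)
  isValley? π i = (i <? π ⟨$⟩ˡ i) ×-dec (i <? π ⟨$⟩ʳ i)

  valley : ∀ {n} → Permutation′ n → Fin n → ℕ
  valley π i = [ isValley? π i ]

  -- Here `j` stands for the arc that ends at `j`, whose other end is `π ⟨$⟩ˡ j`.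
  atValley : ∀ {n} → Permutation′ n → Fin n → ℕ
  atValley π j = valley π j + valley π (π ⟨$⟩ˡ j)

  offValley : ∀ {n} → Permutation′ n → Fin n → ℕ
  offValley π j = 1 ∸ atValley π j

  cval≡∑valley : ∀ {n} (π : Permutation′ n) → cval π ≡ sum (valley π)
  cval≡∑valley π = length-filter-tabulate (isValley? π) (λ i → i)

  -- Each of the two would have to be smaller than the other. Hence an arc touches at most one
  -- valley, and the truncated difference in `offValley` is a true complement.
  ¬adjacentValleys : ∀ {n} (π : Permutation′ n) {j} → IsValley π j → ¬ IsValley π (π ⟨$⟩ˡ j)
  ¬adjacentValleys π {j} (j<πˡj , _) (_ , πˡj<j) = <-asym j<πˡj (subst (π ⟨$⟩ˡ j <_) (inverseʳ π) πˡj<j)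

  atValley+offValley≡1 : ∀ {n} (π : Permutation′ n) j → atValley π j + offValley π j ≡ 1
  atValley+offValley≡1 π j = exclusive (isValley? π j) (isValley? π (π ⟨$⟩ˡ j)) (¬adjacentValleys π)
    where
    exclusive : ∀ {p q} {P : Set p} {Q : Set q} (P? : Dec P) (Q? : Dec Q) → (P → ¬ Q) →
                [ P? ] + [ Q? ] + (1 ∸ ([ P? ] + [ Q? ])) ≡ 1
    exclusive (yes p) (yes q) ¬pq = contradiction q (¬pq p)
    exclusive (yes _) (no _)  _   = refl
    exclusive (no _)  (yes _) _   = refl
    exclusive (no _)  (no _)  _   = refl

  ¬fixedValley : ∀ {n} (π : Permutation′ n) {i} → π ⟨$⟩ʳ i ≡ i → ¬ IsValley π i
  ¬fixedValley π πi≡i (_ , i<πi) = <-irrefl refl (subst (_ <_) πi≡i i<πi)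

  -- insertBefore (suc j) π puts a new least element on the arc ending at j, insertBefore zero π adds it as a fixed point.
  insertBefore : ∀ {n} → Fin (suc n) → Permutation′ n → Permutation′ (suc n)
  insertBefore zero    π = lift₀ π
  insertBefore (suc j) π = lift₀ π ∘ₚ transpose zero (suc j)

  module _ {n} (π : Permutation′ n) where

    module _ (j : Fin n) where
      private
        σ = insertBefore (suc j) π
        y = π ⟨$⟩ˡ j

      insertBefore-ʳ-≡ : ∀ {i} → π ⟨$⟩ʳ i ≡ j → σ ⟨$⟩ʳ suc i ≡ zero
      insertBefore-ʳ-≡ {i} p rewrite dec-true (π ⟨$⟩ʳ i ≟ j) p = refl

      insertBefore-ʳ-≢ : ∀ {i} → ¬ π ⟨$⟩ʳ i ≡ j → σ ⟨$⟩ʳ suc i ≡ suc (π ⟨$⟩ʳ i)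
      insertBefore-ʳ-≢ {i} p rewrite dec-false (π ⟨$⟩ʳ i ≟ j) p = refl

      insertBefore-ˡ-≡ : ∀ {i} → i ≡ j → σ ⟨$⟩ˡ suc i ≡ zero
      insertBefore-ˡ-≡ {i} p rewrite dec-true (i ≟ j) p = refl

      insertBefore-ˡ-≢ : ∀ {i} → ¬ i ≡ j → σ ⟨$⟩ˡ suc i ≡ suc (π ⟨$⟩ˡ i)
      insertBefore-ˡ-≢ {i} p rewrite dec-false (i ≟ j) p = refl

      -- Only the ends of the subdivided arc get a new neighbour; it is smaller than they are, so
      -- they stop being valleys. The form without subtraction can be summed over a class as it
      -- stands.
      valley-insertBefore-suc : ∀ i → valley σ (suc i) + δ i j * valley π j + δ i y * valley π y ≡ valley π i
      valley-insertBefore-suc i = split (i ≟ j) (i ≟ y)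
        where
        after : ∀ {i} → i ≡ j → valley σ (suc i) ≡ 0
        after {i} p = []-no (isValley? σ (suc i)) λ (q , _) → ℕ.n≮0 (subst (suc i <_) (insertBefore-ˡ-≡ p) q)
        before : ∀ {i} → i ≡ y → valley σ (suc i) ≡ 0
        before {i} p = []-no (isValley? σ (suc i)) λ (_ , q) →
          ℕ.n≮0 (subst (suc i <_) (insertBefore-ʳ-≡ (trans (cong (π ⟨$⟩ʳ_) p) (inverseʳ π))) q)
        split : (p : Dec (i ≡ j)) (q : Dec (i ≡ y)) →
                valley σ (suc i) + [ p ] * valley π j + [ q ] * valley π y ≡ valley π i
        -- Both ends coincide, so `j` is a fixed point, is no valley, and every term vanishes.
        split (yes p) (yes q) = trans
          (cong₂ _+_ (cong₂ _+_ (after p) (cong (1 *_) fixed)) (cong (1 *_) (trans (cong (valley π) (trans (sym q) p)) fixed)))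
          (sym (trans (cong (valley π) p) fixed))
          where
          fixed : valley π j ≡ 0
          fixed = []-no (isValley? π j) (¬fixedValley π (trans (cong (π ⟨$⟩ʳ_) (trans (sym p) q)) (inverseʳ π)))
        split (yes p) (no _) = trans (cong (λ a → a + 1 * valley π j + 0) (after p))
          (trans (ℕ.+-identityʳ _) (trans (ℕ.*-identityˡ _) (cong (valley π) (sym p))))
        split (no _) (yes q) = trans (cong (λ a → a + 0 + 1 * valley π y) (before q))
          (trans (ℕ.*-identityˡ _) (cong (valley π) (sym q)))
        split (no i≢j) (no i≢y) = trans (ℕ.+-identityʳ _) (trans (ℕ.+-identityʳ _)
          (cong₂ (λ a b → [ (suc i <? a) ×-dec (suc i <? b) ])
            (insertBefore-ˡ-≢ i≢j)
            (insertBefore-ʳ-≢ λ p → i≢y (trans (sym (inverseˡ π)) (cong (π ⟨$⟩ˡ_) p)))))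

  -- The classes of equally labelled elements are exactly the cycles of π.
  record Labelling {n} (π : Permutation′ n) : Set where
    field
      {count}    : ℕ
      label      : Fin n → Fin count
      invariant  : ∀ i → label (π ⟨$⟩ʳ i) ≡ label i
      surjective : ∀ c → ∃ λ i → label i ≡ c
      reachable  : ∀ {i j} → label i ≡ label j → Star (λ x y → π ⟨$⟩ʳ x ≡ y) i j

    invariantˡ : ∀ i → label (π ⟨$⟩ˡ i) ≡ label i
    invariantˡ i = trans (sym (invariant (π ⟨$⟩ˡ i))) (cong label (inverseʳ π))

    classSum : (Fin n → ℕ) → Fin count → ℕ
    classSum f c = sum (λ i → δ (label i) c * f i)

    stats : Fin count → ℕ × ℕ
    stats c = classSum (valley π) c , classSum (offValley π) c

    cycleStats : List (ℕ × ℕ)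
    cycleStats = tabulate stats

    -- A valley is an end of two arcs, the one arriving and the one leaving. The second count is the
    -- first one shifted along `π`, which preserves labels.
    classSum-atValley : ∀ c → classSum (atValley π) c ≡ classSum (valley π) c + classSum (valley π) c
    classSum-atValley c = begin
      sum (λ i → δ (label i) c * (valley π i + valley π (π ⟨$⟩ˡ i)))
        ≡⟨ sum-cong-≗ (λ i → ℕ.*-distribˡ-+ (δ (label i) c) _ _) ⟩
      sum (λ i → δ (label i) c * valley π i + δ (label i) c * valley π (π ⟨$⟩ˡ i))
        ≡⟨ ∑-distrib-+ _ (λ i → δ (label i) c * valley π (π ⟨$⟩ˡ i)) ⟩
      v + sum (λ i → δ (label i) c * valley π (π ⟨$⟩ˡ i))
        ≡⟨ cong (v +_) (sum-cong-≗ λ i → cong (λ l → δ l c * valley π (π ⟨$⟩ˡ i)) (sym (invariantˡ i))) ⟩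
      v + sum (λ i → δ (label (π ⟨$⟩ˡ i)) c * valley π (π ⟨$⟩ˡ i))
        ≡⟨ cong (v +_) (sym (sum-permute (λ i → δ (label i) c * valley π i) (flip π))) ⟩
      v + v ∎
      where
      open ≡.≡-Reasoning
      v = classSum (valley π) c

    classSum-1 : ∀ c → classSum (λ _ → 1) c ≡ (let v , e = stats c in v + v + e)
    classSum-1 c = begin
      classSum (λ _ → 1) c
        ≡⟨ sum-cong-≗ (λ i → cong (δ (label i) c *_) (sym (atValley+offValley≡1 π i))) ⟩
      sum (λ i → δ (label i) c * (atValley π i + offValley π i))
        ≡⟨ sum-cong-≗ (λ i → ℕ.*-distribˡ-+ (δ (label i) c) _ _) ⟩
      sum (λ i → δ (label i) c * atValley π i + δ (label i) c * offValley π i)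
        ≡⟨ ∑-distrib-+ _ (λ i → δ (label i) c * offValley π i) ⟩
      classSum (atValley π) c + classSum (offValley π) c
        ≡⟨ cong (_+ classSum (offValley π) c) (classSum-atValley c) ⟩
      _ ∎
      where open ≡.≡-Reasoning

  open Labelling

  ∑-δ : ∀ {n} (i : Fin n) (f : Fin n → ℕ) → sum (λ c → δ i c * f c) ≡ f i
  ∑-δ {suc n} zero    f = trans (cong₂ _+_ (ℕ.*-identityˡ (f zero)) (sum-replicate-zero n)) (ℕ.+-identityʳ _)
  ∑-δ         (suc i) f = ∑-δ i (f ∘ suc)

  ∑-δ′ : ∀ {n} (i : Fin n) (f : Fin n → ℕ) → sum (λ c → δ c i * f c) ≡ f i
  ∑-δ′ {suc n} zero    f = trans (cong₂ _+_ (ℕ.*-identityˡ (f zero)) (sum-replicate-zero n)) (ℕ.+-identityʳ _)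
  ∑-δ′         (suc i) f = ∑-δ′ i (f ∘ suc)

  lift₀-labelling : ∀ {n} {π : Permutation′ n} → Labelling π → Labelling (lift₀ π)
  lift₀-labelling {n} {π} L = record
    { label      = label′
    ; invariant  = λ { zero → refl ; (suc i) → cong suc (L .invariant i) }
    ; surjective = λ { zero → zero , refl ; (suc c) → let i , p = L .surjective c in suc i , cong suc p }
    ; reachable  = reach
    }
    where
    label′ : Fin (suc n) → Fin (suc (L .count))
    label′ zero    = zero
    label′ (suc i) = suc (L .label i)
    lift : ∀ {i j} → Star (λ x y → π ⟨$⟩ʳ x ≡ y) i j → Star (λ x y → lift₀ π ⟨$⟩ʳ x ≡ y) (suc i) (suc j)
    lift ε       = ε
    lift (p ◅ s) = cong suc p ◅ lift s
    reach : ∀ {i j} → label′ i ≡ label′ j → Star (λ x y → lift₀ π ⟨$⟩ʳ x ≡ y) i j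
    reach {zero}  {zero}  _ = ε
    reach {suc i} {suc j} p = lift (L .reachable (suc-injective p))

  -- For `suc j` the old labels stay and the new element copies the label of `j`, so that
  -- `cycleStats` changes at one position only. A path of `π` lifts by a detour through `zero`
  -- wherever it uses the subdivided arc.
  insertBefore-labelling : ∀ {n} {π : Permutation′ n} j → Labelling π → Labelling (insertBefore j π)
  insertBefore-labelling zero    L = lift₀-labelling L
  insertBefore-labelling {n} {π} (suc j) L = record
    { label      = label′
    ; invariant  = inv
    ; surjective = λ c → let i , p = L .surjective c in suc i , p
    ; reachable  = reach
    }
    where
    σ = insertBefore (suc j) π
    label′ : Fin (suc n) → Fin (L .count)
    label′ zero    = L .label j
    label′ (suc i) = L .label i
    inv : ∀ i → label′ (σ ⟨$⟩ʳ i) ≡ label′ i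
    inv zero = refl
    inv (suc i) = at (π ⟨$⟩ʳ i ≟ j)
      where
      at : Dec (π ⟨$⟩ʳ i ≡ j) → label′ (σ ⟨$⟩ʳ suc i) ≡ L .label i
      at (yes p) = trans (cong label′ (insertBefore-ʳ-≡ π j {i} p)) (trans (cong (L .label) (sym p)) (L .invariant i))
      at (no ¬p) = trans (cong label′ (insertBefore-ʳ-≢ π j {i} ¬p)) (L .invariant i)
    step : ∀ i → Star (λ x y → σ ⟨$⟩ʳ x ≡ y) (suc i) (suc (π ⟨$⟩ʳ i))
    step i = at (π ⟨$⟩ʳ i ≟ j)
      where
      at : Dec (π ⟨$⟩ʳ i ≡ j) → Star (λ x y → σ ⟨$⟩ʳ x ≡ y) (suc i) (suc (π ⟨$⟩ʳ i))
      at (yes p) = insertBefore-ʳ-≡ π j {i} p ◅ cong suc (sym p) ◅ ε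
      at (no ¬p) = insertBefore-ʳ-≢ π j {i} ¬p ◅ ε
    lift : ∀ {i k} → Star (λ x y → π ⟨$⟩ʳ x ≡ y) i k → Star (λ x y → σ ⟨$⟩ʳ x ≡ y) (suc i) (suc k)
    lift ε = ε
    lift (_◅_ {i} refl s) = step i ◅◅ lift s
    into : ∀ i → L .label i ≡ L .label j → Star (λ x y → σ ⟨$⟩ʳ x ≡ y) (suc i) zero
    into i p = lift (L .reachable (trans p (sym (invariantˡ L j)))) ◅◅ insertBefore-ʳ-≡ π j {π ⟨$⟩ˡ j} (inverseʳ π) ◅ ε
    reach : ∀ {i k} → label′ i ≡ label′ k → Star (λ x y → σ ⟨$⟩ʳ x ≡ y) i k
    reach {zero}  {zero}  p = ε
    reach {zero}  {suc k} p = refl ◅ lift (L .reachable p)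
    reach {suc i} {zero}  p = into i p
    reach {suc i} {suc k} p = lift (L .reachable p)

  cycleStats-lift₀ : ∀ {n} {π : Permutation′ n} (L : Labelling π) →
                     cycleStats (lift₀-labelling L) ≡ (0 , 1) ∷ cycleStats L
  cycleStats-lift₀ {n} L = cong₂ _∷_
    (cong₂ _,_ (sum-replicate-zero n) (cong suc (sum-replicate-zero n))) refl

  -- Here `d` is 1 on the class that receives the new element and 0 elsewhere, and `a` counts the
  -- valleys on the subdivided arc. With the size known, `e′` follows from `v′` by cancellation
  -- instead of a second count of arcs.
  module _ {v e v′ e′ d a : ℕ} (valleys : v′ + d * a ≡ v + d) (sizes : v′ + v′ + e′ ≡ d + (v + v + e)) where

    private
      e-from-v : ∀ {u} → v′ ≡ u → u + u + e′ ≡ d + (v + v + e)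
      e-from-v p = trans (cong (λ u → u + u + e′) (sym p)) sizes

    unchanged : d ≡ 0 → (v′ , e′) ≡ (v , e)
    unchanged refl = cong₂ _,_ p (ℕ.+-cancelˡ-≡ (v + v) _ _ (e-from-v p))
      where p = trans (sym (ℕ.+-identityʳ v′)) (trans valleys (ℕ.+-identityʳ v))

    valleyMoved : d ≡ 1 → a ≡ 1 → (v′ , e′) ≡ (v , suc e)
    valleyMoved refl refl = cong₂ _,_ p
      (ℕ.+-cancelˡ-≡ (v + v) _ _ (trans (e-from-v p) (sym (ℕ.+-suc (v + v) e))))
      where p = ℕ.+-cancelʳ-≡ 1 v′ v valleys

    valleyAdded : d ≡ 1 → a ≡ 0 → (v′ , e′) ≡ (suc v , pred e)
    valleyAdded refl refl = cong₂ _,_ p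
      -- The size equation forces `e` to be a successor, so `pred e` is an honest predecessor.
      (cong pred (ℕ.+-cancelˡ-≡ (suc (v + v)) (suc e′) e (trans (sym (arith v e′)) (e-from-v p))))
      where
      p = trans (sym (ℕ.+-identityʳ v′)) (trans valleys (ℕ.+-comm v 1))
      arith : ∀ v e → suc v + suc v + e ≡ suc (v + v) + suc e
      arith = solve-∀

  module _ {n} {π : Permutation′ n} (j : Fin n) (L : Labelling π) where
    private
      L′ = insertBefore-labelling (suc j) L
      σ = insertBefore (suc j) π
      v e v′ e′ : Fin (L .count) → ℕ
      v = proj₁ ∘ stats L
      e = proj₂ ∘ stats L
      v′ = proj₁ ∘ stats L′
      e′ = proj₂ ∘ stats L′

    valleys-insertBefore : ∀ c → v′ c + δ (L .label j) c * atValley π j ≡ v c + δ (L .label j) c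
    valleys-insertBefore c = begin
      -- The factor `1` is `valley σ zero`, which computes because both neighbours of the new
      -- minimum are successors.
      δ lj c * 1 + s + δ lj c * (valley π j + valley π y)
        ≡⟨ arith (δ lj c) s (valley π j) (valley π y) ⟩
      s + δ lj c * valley π j + δ lj c * valley π y + δ lj c
        ≡⟨ cong (_+ δ lj c) (sym split) ⟩
      v c + δ lj c ∎
      where
      open ≡.≡-Reasoning
      lj = L .label j
      y = π ⟨$⟩ˡ j
      s = sum (λ i → δ (L .label i) c * valley σ (suc i))
      arith : ∀ d s a b → d * 1 + s + d * (a + b) ≡ s + d * a + d * b + d
      arith = solve-∀
      arith′ : ∀ d w a p b q → d * (w + a * p + b * q) ≡ d * w + a * (d * p) + b * (d * q)
      arith′ = solve-∀
      split : v c ≡ s + δ lj c * valley π j + δ lj c * valley π y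
      split = begin
        v c
          ≡⟨ sum-cong-≗ (λ i → cong (δ (L .label i) c *_) (sym (valley-insertBefore-suc π j i))) ⟩
        sum (λ i → δ (L .label i) c * (valley σ (suc i) + δ i j * valley π j + δ i y * valley π y))
          ≡⟨ sum-cong-≗ (λ i → arith′ (δ (L .label i) c) (valley σ (suc i)) (δ i j) (valley π j) (δ i y) (valley π y)) ⟩
        sum (λ i → δ (L .label i) c * valley σ (suc i) + δ i j * (δ (L .label i) c * valley π j)
                   + δ i y * (δ (L .label i) c * valley π y))
          ≡⟨ ∑-distrib-+ _ (λ i → δ i y * (δ (L .label i) c * valley π y)) ⟩
        _ ≡⟨ cong₂ _+_ (∑-distrib-+ _ (λ i → δ i j * (δ (L .label i) c * valley π j)))
                       (∑-δ′ y (λ i → δ (L .label i) c * valley π y)) ⟩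
        -- Both ends of the arc lie in one class, so the two corrections carry the same factor
        -- `δ lj c`.
        _ ≡⟨ cong₂ (λ a l → s + a + δ l c * valley π y) (∑-δ′ j (λ i → δ (L .label i) c * valley π j)) (invariantˡ L j) ⟩
        _ ∎

    size-insertBefore : ∀ c → v′ c + v′ c + e′ c ≡ δ (L .label j) c + (v c + v c + e c)
    size-insertBefore c = begin
      v′ c + v′ c + e′ c                                   ≡⟨ sym (classSum-1 L′ c) ⟩
      δ (L .label j) c * 1 + classSum L (λ _ → 1) c
        ≡⟨ cong₂ _+_ (ℕ.*-identityʳ (δ (L .label j) c)) (classSum-1 L c) ⟩
      δ (L .label j) c + (v c + v c + e c)                 ∎
      where open ≡.≡-Reasoning

    stats-other : ∀ c → ¬ L .label j ≡ c → stats L′ c ≡ stats L c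
    stats-other c p = unchanged (valleys-insertBefore c) (size-insertBefore c) ([]-no (L .label j ≟ c) p)

    stats-atValley : atValley π j ≡ 1 → stats L′ (L .label j) ≡ (v (L .label j) , suc (e (L .label j)))
    stats-atValley = valleyMoved (valleys-insertBefore c) (size-insertBefore c) ([]-yes (c ≟ c) refl)
      where c = L .label j

    stats-offValley : atValley π j ≡ 0 → stats L′ (L .label j) ≡ (suc (v (L .label j)) , pred (e (L .label j)))
    stats-offValley = valleyAdded (valleys-insertBefore c) (size-insertBefore c) ([]-yes (c ≟ c) refl)
      where c = L .label j

-- The sum over all permutations as a sum over set partitions

Labelled : ℕ → Set
Labelled n = ∃ λ (π : Permutation′ n) → Labelling π

open Labelling

labelled : ∀ n → List (Labelled n)
labelled zero    = (idₚ , record { count = 0 ; label = λ () ; invariant = λ () ; surjective = λ () ; reachable = λ { {()} } }) ∷ []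
labelled (suc n) = cartesianProductWith (λ (π , L) j → insertBefore j π , insertBefore-labelling j L)
                     (labelled n) (allFin (suc n))

module Insertion {c ℓ} (R : CommutativeSemiring c ℓ) where
  open CommutativeSemiring R hiding (zero)
  open ListSum R
  open Valleys R
  open MonoidSum +-commutativeMonoid using (sum-cong-≋; ∑-distrib-+; ∑-comm; sum-replicate-zero)
  open import Relation.Binary.Reasoning.Setoid setoid

  sum-× : ∀ {n} (a : Fin n → ℕ) x → MonoidSum.sum ℕ.+-0-commutativeMonoid a × x ≈ sum (λ i → a i × x)
  sum-× {zero}  a x = refl
  sum-× {suc n} a x = trans (×-homo-+ x (a zero) _) (+-congˡ (sum-× (a ∘ suc) x))

  ∑-δ-× : ∀ {n} (i : Fin n) a (x : Fin n → Carrier) → sum (λ c → (δ i c ℕ.* a) × x c) ≈ a × x i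
  ∑-δ-× {suc n} zero    a x = trans (+-cong (×-congˡ (ℕ.*-identityˡ a)) (sum-replicate-zero n)) (+-identityʳ _)
  ∑-δ-×         (suc i) a x = trans (+-identityˡ _) (∑-δ-× i a (x ∘ suc))

  growAny-tabulate : ∀ {n} (f : Fin n → Stats) G → growAny G (tabulate f) ≈
    sum (λ c → grow (λ v e → G (tabulate (updateAt f c (const (v , e))))) (proj₁ (f c)) (proj₂ (f c)))
  growAny-tabulate {zero}  f G = refl
  growAny-tabulate {suc n} f G = +-congˡ (growAny-tabulate (f ∘ suc) (G ∘ (f zero ∷_)))

  tabulate-updateAt : ∀ {n} {f g : Fin n → Stats} c {x} → (∀ d → c ≡ d → g d ≡ x) → (∀ d → ¬ c ≡ d → g d ≡ f d) →
                      tabulate g ≡ tabulate (updateAt f c (const x))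
  tabulate-updateAt {f = f} {g} c {x} at off = List.tabulate-cong eq
    where
    eq : ∀ d → g d ≡ updateAt f c (const x) d
    eq d with c ≟ d
    ... | yes ≡.refl = ≡.trans (at d ≡.refl) (≡.sym (updateAt-updates c f))
    ... | no c≢d     = ≡.trans (off d c≢d) (≡.sym (updateAt-minimal d c f (c≢d ∘ ≡.sym)))

  module _ {n} {π : Permutation′ n} (L : Labelling π) where

    -- Summation over the fibres of `label`: introduce the indicator of the class and exchange the
    -- sums.
    ∑-byClass : ∀ (a : Fin n → ℕ) (h : Fin (count L) → Carrier) →
                sum (λ j → a j × h (label L j)) ≈ sum (λ c → classSum L a c × h c)
    ∑-byClass a h = begin
      sum (λ j → a j × h (label L j))
        ≈⟨ sum-cong-≋ (λ j → ∑-δ-× (label L j) (a j) h) ⟨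
      sum (λ j → sum (λ c → (δ (label L j) c ℕ.* a j) × h c))
        ≈⟨ ∑-comm (λ j c → (δ (label L j) c ℕ.* a j) × h c) ⟩
      sum (λ c → sum (λ j → (δ (label L j) c ℕ.* a j) × h c))
        ≈⟨ sum-cong-≋ (λ c → sum-× (λ j → δ (label L j) c ℕ.* a j) (h c)) ⟨
      sum (λ c → classSum L a c × h c) ∎

    module _ (G : List Stats → Carrier) where
      private
        v e : Fin (count L) → ℕ
        v = proj₁ ∘ stats L
        e = proj₂ ∘ stats L
        G⁺ G⁻ : Fin (count L) → Carrier
        G⁺ c = G (tabulate (updateAt (stats L) c (const (v c , suc (e c)))))
        G⁻ c = G (tabulate (updateAt (stats L) c (const (suc (v c) , pred (e c)))))

      -- Exactly one of the coefficients is 1, and it selects the right update. Keeping both terms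
      -- lets the sum over `j` split into two class sums.
      insertBefore-stats : ∀ j → G (cycleStats (insertBefore-labelling (suc j) L)) ≈
                           atValley π j × G⁺ (label L j) + offValley π j × G⁻ (label L j)
      insertBefore-stats j = cases (atValley π j) (offValley π j) ≡.refl (atValley+offValley≡1 π j)
        where
        cases : ∀ a b → atValley π j ≡ a → a ℕ.+ b ≡ 1 →
                G (cycleStats (insertBefore-labelling (suc j) L)) ≈ a × G⁺ (label L j) + b × G⁻ (label L j)
        cases 1 0 p q = trans
          (reflexive (≡.cong G (tabulate-updateAt {f = stats L} (label L j)
            (λ { d ≡.refl → stats-atValley j L p }) (stats-other j L))))
          (sym (trans (+-identityʳ _) (×-homo-1 _)))
        cases 0 1 p q = trans
          (reflexive (≡.cong G (tabulate-updateAt {f = stats L} (label L j)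
            (λ { d ≡.refl → stats-offValley j L p }) (stats-other j L))))
          (sym (trans (+-identityˡ _) (×-homo-1 _)))

      ∑-insertBefore : ∑ₗ (allFin (suc n)) (λ j → G (cycleStats (insertBefore-labelling j L))) ≈ insertMin G (cycleStats L)
      ∑-insertBefore = begin
        ∑ₗ (allFin (suc n)) (λ j → G (cycleStats (insertBefore-labelling j L)))
          ≈⟨ ∑ₗ-tabulate (λ j → j) (λ j → G (cycleStats (insertBefore-labelling j L))) ⟩
        G (cycleStats (lift₀-labelling L)) + sum (λ j → G (cycleStats (insertBefore-labelling (suc j) L)))
          ≈⟨ +-cong (reflexive (≡.cong G (cycleStats-lift₀ L))) (sum-cong-≋ insertBefore-stats) ⟩
        G ((0 , 1) ∷ cycleStats L) + sum (λ j → atValley π j × G⁺ (label L j) + offValley π j × G⁻ (label L j))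
          ≈⟨ +-congˡ (∑-distrib-+ (λ j → atValley π j × G⁺ (label L j)) (λ j → offValley π j × G⁻ (label L j))) ⟩
        G ((0 , 1) ∷ cycleStats L) + (sum (λ j → atValley π j × G⁺ (label L j)) + sum (λ j → offValley π j × G⁻ (label L j)))
          ≈⟨ +-congˡ (+-cong (∑-byClass (atValley π) G⁺) (∑-byClass (offValley π) G⁻)) ⟩
        G ((0 , 1) ∷ cycleStats L) + (sum (λ c → classSum L (atValley π) c × G⁺ c) + sum (λ c → e c × G⁻ c))
          ≈⟨ +-congˡ (+-congʳ (sum-cong-≋ (λ c → ×-congˡ (classSum-atValley L c)))) ⟩
        G ((0 , 1) ∷ cycleStats L) + (sum (λ c → (v c ℕ.+ v c) × G⁺ c) + sum (λ c → e c × G⁻ c))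
          ≈⟨ +-congˡ (∑-distrib-+ (λ c → (v c ℕ.+ v c) × G⁺ c) (λ c → e c × G⁻ c)) ⟨
        G ((0 , 1) ∷ cycleStats L) + sum (λ c → (v c ℕ.+ v c) × G⁺ c + e c × G⁻ c)
          ≈⟨ +-congˡ (growAny-tabulate (stats L) G) ⟨
        insertMin G (cycleStats L) ∎

  -- The last insertion is absorbed into `G`, so the induction hypothesis is used at `insertMin G`;
  -- on set partitions this transform unfolds to the step of `types`.
  ∑-labelled : ∀ n G → ∑ₗ (labelled n) (λ (_ , L) → G (cycleStats L)) ≈ ∑ₗ (types n) (λ ks → onTypes ks G)
  ∑-labelled zero    G = refl
  ∑-labelled (suc n) G = begin
    ∑ₗ (labelled (suc n)) (λ (_ , L) → G (cycleStats L))
      ≈⟨ ∑ₗ-cartesianProductWith _ (labelled n) (allFin (suc n)) _ ⟩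
    ∑ₗ (labelled n) (λ (π , L) → ∑ₗ (allFin (suc n)) (λ j → G (cycleStats (insertBefore-labelling j L))))
      ≈⟨ ∑ₗ-cong (labelled n) (λ (_ , L) → ∑-insertBefore L G) ⟩
    ∑ₗ (labelled n) (λ (_ , L) → insertMin G (cycleStats L))
      ≈⟨ ∑-labelled n (insertMin G) ⟩
    ∑ₗ (types n) (λ ks → onTypes ks (insertMin G))
      ≈⟨ ∑ₗ-cong (types n) (λ ks → onTypes-insertMin ks G) ⟩
    ∑ₗ (types n) (λ ks → ∑ₗ ((0 ∷ ks) ∷ bumps ks) (λ b → onTypes b G))
      ≈⟨ ∑ₗ-concatMap _ (types n) _ ⟨
    ∑ₗ (types (suc n)) (λ ks → onTypes ks G) ∎

-- The computed cycles are the label classes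

module _ where
  open ≡ using (refl; sym; trans; cong; subst)
  open import Data.Nat.Base using (_+_; _*_; _<_; _≤_)
  open import Data.Product.Base using (_×_)
  open ℕSum using (sum; sum-cong-≗; ∑-comm)

  ∈-⋃⁺ : ∀ {n} {x : Fin n} {xs} → x ∈ xs → x Subset.∈ ⋃ (map ⁅_⁆ xs)
  ∈-⋃⁺ (here refl) = Subset.x∈p∪q⁺ (inj₁ (Subset.x∈⁅x⁆ _))
  ∈-⋃⁺ (there p)   = Subset.x∈p∪q⁺ (inj₂ (∈-⋃⁺ p))

  ∈-⋃⁻ : ∀ {n} {x : Fin n} xs → x Subset.∈ ⋃ (map ⁅_⁆ xs) → x ∈ xs
  ∈-⋃⁻ []       p = contradiction p Subset.∉⊥
  ∈-⋃⁻ (y ∷ xs) p with Subset.x∈p∪q⁻ ⁅ y ⁆ (⋃ (map ⁅_⁆ xs)) p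
  ... | inj₁ q = here (Subset.x∈⁅y⁆⇒x≡y y q)
  ... | inj₂ q = there (∈-⋃⁻ xs q)

  module _ {a} {A : Set a} (f : A → A) where

    power : ℕ → A → A
    power zero    x = x
    power (suc k) x = f (power k x)

    power-shift : ∀ k x → power k (f x) ≡ f (power k x)
    power-shift zero    x = refl
    power-shift (suc k) x = cong f (power-shift k x)

    power-∈-iterate : ∀ {n k} x → k < n → power k x ∈ iterate f x n
    power-∈-iterate {suc n} {zero}  x _ = here refl
    power-∈-iterate {suc n} {suc k} x (ℕ.s≤s k<n) =
      there (subst (_∈ iterate f (f x) n) (power-shift k x) (power-∈-iterate (f x) k<n))

    -- Stripping `f` from both sides until the smaller exponent is 0 leaves the difference of the
    -- exponents as a period.
    power-injective : (∀ {x y} → f x ≡ f y → x ≡ y) → ∀ {a b} x → a < b → power a x ≡ power b x →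
                      ∃ λ p → p < b × power (suc p) x ≡ x
    power-injective inj {zero}  {suc b} x _ q = b , ℕ.n<1+n b , sym q
    power-injective inj {suc a} {suc b} x (ℕ.s≤s a<b) q =
      let p , p<b , r = power-injective inj x a<b (inj q) in p , ℕ.m<n⇒m<1+n p<b , r

  module _ {n} (π : Permutation′ n) where
    private
      f : Fin n → Fin n
      f = π ⟨$⟩ʳ_

    period : ∀ i → ∃ λ p → p < n × power f (suc p) i ≡ i
    period i with pigeonhole (ℕ.n<1+n n) (λ (k : Fin (suc n)) → power f (toℕ k) i)
    ... | a , b , a<b , q =
      let p , p<b , r = power-injective f (λ {x} {y} e → trans (sym (inverseˡ π)) (trans (cong (π ⟨$⟩ˡ_) e) (inverseˡ π))) i a<b q
      in p , ℕ.<-≤-trans p<b (toℕ≤pred[n] b) , r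

    -- Some period `suc p` is at most `n`. A walk along the orbit restarts at exponent 0 after
    -- exponent `p`, so it never leaves the first `n` iterates.
    reachable⇒∈-iterate : ∀ {i j} → Star (λ x y → π ⟨$⟩ʳ x ≡ y) i j → j ∈ iterate f i n
    reachable⇒∈-iterate {i} s with period i
    ... | p , p<n , r = let k , k≤p , e = follow s (0 , ℕ.z≤n , refl) in
      subst (_∈ iterate f i n) e (power-∈-iterate f i (ℕ.≤-<-trans k≤p p<n))
      where
      Early : Fin n → Set
      Early y = ∃ λ k → k ≤ p × power f k i ≡ y
      next : ∀ {x} → Early x → Early (f x)
      next (k , k≤p , e) with k ℕ.≟ p
      ... | yes refl = 0 , ℕ.z≤n , trans (sym r) (cong f e)
      ... | no k≢p = suc k , ℕ.≤∧≢⇒< k≤p k≢p , cong f e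
      follow : ∀ {x y} → Star (λ x y → π ⟨$⟩ʳ x ≡ y) x y → Early x → Early y
      follow ε          q = q
      follow (refl ◅ s) q = follow s (next q)

  ∣tabulate∣ : ∀ {n p} {P : Fin n → Set p} (P? : ∀ i → Dec (P i)) → ∣ Vec.tabulate (does ∘ P?) ∣ ≡ sum (λ i → [ P? i ])
  ∣tabulate∣ {zero}  P? = refl
  ∣tabulate∣ {suc n} P? with does (P? zero)
  ... | true  = cong suc (∣tabulate∣ (P? ∘ suc))
  ... | false = ∣tabulate∣ (P? ∘ suc)

  sum-tabulate : ∀ {n} (f : Fin n → ℕ) → ℕ.sum (tabulate f) ≡ sum f
  sum-tabulate {zero}  f = refl
  sum-tabulate {suc n} f = cong (f zero +_) (sum-tabulate (f ∘ suc))

  module _ {n} {π : Permutation′ n} (L : Labelling π) where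

    cval-labelling : cval π ≡ ℕ.sum (map proj₁ (cycleStats L))
    cval-labelling = sym (begin
      ℕ.sum (map proj₁ (cycleStats L))                        ≡⟨ cong ℕ.sum (List.map-tabulate (stats L) proj₁) ⟩
      ℕ.sum (tabulate (classSum L (valley π)))                ≡⟨ sum-tabulate (classSum L (valley π)) ⟩
      sum (λ c → sum (λ i → δ (label L i) c * valley π i))    ≡⟨ ∑-comm (λ c i → δ (label L i) c * valley π i) ⟩
      sum (λ i → sum (λ c → δ (label L i) c * valley π i))    ≡⟨ sum-cong-≗ (λ i → ∑-δ (label L i) (λ _ → valley π i)) ⟩
      sum (valley π)                                          ≡⟨ cval≡∑valley π ⟨
      cval π                                                  ∎)
      where open ≡.≡-Reasoning

    class : Fin (count L) → Subset n
    class c = Vec.tabulate (λ i → does (label L i ≟ c))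

    ∈-class⁺ : ∀ {i c} → label L i ≡ c → i Subset.∈ class c
    ∈-class⁺ {i} {c} p = Vec.lookup⇒[]= i (class c)
      (trans (Vec.lookup∘tabulate _ i) (dec-true (label L i ≟ c) p))

    ∈-class⁻ : ∀ {i c} → i Subset.∈ class c → label L i ≡ c
    ∈-class⁻ {i} {c} p with label L i ≟ c | trans (sym (Vec.lookup∘tabulate (λ i → does (label L i ≟ c)) i)) (Vec.[]=⇒lookup p)
    ... | yes q | _ = q
    ... | no _  | ()

    ∈-iterate⇒label : ∀ k {i j} → j ∈ iterate (π ⟨$⟩ʳ_) i k → label L j ≡ label L i
    ∈-iterate⇒label (suc k) (here refl) = refl
    ∈-iterate⇒label (suc k) (there p)   = trans (∈-iterate⇒label k p) (invariant L _)

    cycle≡class : ∀ i → cycle π i ≡ class (label L i)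
    cycle≡class i = Subset.⊆-antisym
      (λ p → ∈-class⁺ (∈-iterate⇒label n (∈-⋃⁻ (iterate (π ⟨$⟩ʳ_) i n) p)))
      (λ p → ∈-⋃⁺ (reachable⇒∈-iterate π (reachable L (sym (∈-class⁻ p)))))

    -- Both lists are free of repetitions and have the same members. Surjectivity of the labels is
    -- used twice: nonempty classes are distinct, and each arises as the cycle of one of its
    -- elements.
    cycles↭classes : cycles π ↭ tabulate class
    cycles↭classes = ∼bag⇒↭ (unique∧set⇒bag (DecUnique.deduplicate-! _≟ₛ_ _) (Unique.tabulate⁺ class-injective) (mk⇔ to from))
      where
      _≟ₛ_ = Vec.≡-dec Bool._≟_
      class-injective : ∀ {c d} → class c ≡ class d → c ≡ d
      class-injective {c} {d} p = let i , q = surjective L c in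
        trans (sym q) (∈-class⁻ (subst (i Subset.∈_) p (∈-class⁺ q)))
      to : ∀ {S} → S ∈ cycles π → S ∈ tabulate class
      to S∈ = let i , _ , q = ∈-map⁻ (cycle π) (∈-deduplicate⁻ _≟ₛ_ _ S∈) in
        subst (_∈ tabulate class) (sym (trans q (cycle≡class i))) (∈-tabulate⁺ (label L i))
      from : ∀ {S} → S ∈ tabulate class → S ∈ cycles π
      from S∈ = let c , q = ∈-tabulate⁻ S∈ ; i , r = surjective L c in
        ∈-deduplicate⁺ _≟ₛ_ (subst (_∈ map (cycle π) (allFin n))
          (trans (cycle≡class i) (trans (cong class r) (sym q))) (∈-map⁺ (cycle π) (∈-allFin i)))

    cycleSizes : map ∣_∣ (cycles π) ↭ map (λ (v , e) → v + v + e) (cycleStats L)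
    cycleSizes = ↭-trans (↭.map⁺ ∣_∣ cycles↭classes) (↭-reflexive (begin
      map ∣_∣ (tabulate class)                               ≡⟨ List.map-tabulate class ∣_∣ ⟩
      tabulate (∣_∣ ∘ class)                                 ≡⟨ List.tabulate-cong sizes ⟩
      tabulate (λ c → let v , e = stats L c in v + v + e)    ≡⟨ List.map-tabulate (stats L) (λ (v , e) → v + v + e) ⟨
      map (λ (v , e) → v + v + e) (cycleStats L)             ∎))
      where
      open ≡.≡-Reasoning
      sizes : ∀ c → ∣ class c ∣ ≡ (let v , e = stats L c in v + v + e)
      sizes c = trans (∣tabulate∣ (λ i → label L i ≟ c))
        (trans (sum-cong-≗ (λ i → sym (ℕ.*-identityʳ (δ (label L i) c)))) (classSum-1 L c))

-- Independence of sums from the enumeration of permutations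

module _ where
  open ≡ using (refl; sym; trans; cong)
  open import Data.Product.Base using (_×_)

  -- Pointwise equal permutations need not be propositionally equal, but their words are, so
  -- enumerations are compared as lists of words.
  word : ∀ {n} → Permutation′ n → Vec (Fin n) n
  word π = Vec.tabulate (π ⟨$⟩ʳ_)

  word-cong : ∀ {n} {π ρ : Permutation′ n} → π ≈ₚ ρ → word π ≡ word ρ
  word-cong = Vec.tabulate-cong

  word-injective : ∀ {n} (π ρ : Permutation′ n) → word π ≡ word ρ → π ≈ₚ ρ
  word-injective π ρ p i = trans (sym (Vec.lookup∘tabulate (π ⟨$⟩ʳ_) i))
    (trans (cong (λ w → Vec.lookup w i) p) (Vec.lookup∘tabulate (ρ ⟨$⟩ʳ_) i))

  record Enumerates {n} (πs : List (Permutation′ n)) : Set where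
    field
      complete : ∀ π → Any (π ≈ₚ_) πs
      distinct : AllPairs (λ π ρ → ¬ π ≈ₚ ρ) πs

  open Enumerates

  enumerations-↭ : ∀ {n} {πs ρs : List (Permutation′ n)} → Enumerates πs → Enumerates ρs → map word πs ↭ map word ρs
  enumerations-↭ {n} {πs} {ρs} P Q = ∼bag⇒↭ (unique∧set⇒bag (unique P) (unique Q) (mk⇔ (⊆ πs Q) (⊆ ρs P)))
    where
    unique : ∀ {πs : List (Permutation′ n)} → Enumerates πs → AllPairs (λ v w → ¬ v ≡ w) (map word πs)
    unique P = AllPairs.map⁺ (AllPairs.map (λ {π} {ρ} π≉ρ → π≉ρ ∘ word-injective π ρ) (P .distinct))
    ⊆ : ∀ πs {ρs : List (Permutation′ n)} → Enumerates ρs → ∀ {w} → w ∈ map word πs → w ∈ map word ρs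
    ⊆ πs Q w∈ with ∈-map⁻ word w∈
    ... | π , _ , refl = Any.map⁺ (Any.map (λ {ρ} → word-cong {π = π} {ρ}) (Q .complete π))

  permutations-enumerates : ∀ n → Enumerates (permutations n)
  permutations-enumerates n = record { complete = permutations-complete n ; distinct = permutations-unique n }

  flip-cong : ∀ {n} (π ρ : Permutation′ n) → π ≈ₚ ρ → flip π ≈ₚ flip ρ
  flip-cong π ρ p i = trans (cong (π ⟨$⟩ˡ_) (trans (sym (inverseʳ ρ)) (sym (p (ρ ⟨$⟩ˡ i))))) (inverseˡ π)

  flips-enumerate : ∀ n → Enumerates (map flip (permutations n))
  flips-enumerate n = record
    { complete = λ π → Any.map⁺ (Any.map (λ {ρ} → flip-cong (flip π) ρ) (permutations-complete n (flip π)))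
    ; distinct = AllPairs.map⁺ (AllPairs.map (λ {π} {ρ} π≉ρ → π≉ρ ∘ flip-cong (flip π) (flip ρ)) (permutations-unique n))
    }

  insertBefore-cong : ∀ {n} j (π ρ : Permutation′ n) → π ≈ₚ ρ → insertBefore j π ≈ₚ insertBefore j ρ
  insertBefore-cong zero    π ρ p i = lift₀-cong π ρ p i
  insertBefore-cong (suc j) π ρ p i = cong (transpose zero (suc j) ⟨$⟩ʳ_) (lift₀-cong π ρ p i)

  insertBefore-injective : ∀ {n} {j k : Fin (suc n)} (π ρ : Permutation′ n) → insertBefore j π ≈ₚ insertBefore k ρ → j ≡ k × π ≈ₚ ρ
  insertBefore-injective {j = zero}  {zero}  π ρ p = refl , suc-injective ∘ p ∘ suc
  insertBefore-injective {j = zero}  {suc k} π ρ p with () ← p zero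
  insertBefore-injective {j = suc j} {zero}  π ρ p with () ← p zero
  insertBefore-injective {j = suc j} {suc k} π ρ p with refl ← p zero = refl , λ i → suc-injective
    (trans (sym (transpose-inverse (suc j) zero))
      (trans (cong (transpose (suc j) zero ⟨$⟩ʳ_) (p (suc i))) (transpose-inverse (suc j) zero)))

  -- Following `σ` by the transposition of `zero` and its image makes `zero` a fixed point, which
  -- can then be removed.
  insertBefore-surjective : ∀ {n} (σ : Permutation′ (suc n)) → ∃ λ j → ∃ λ π → σ ≈ₚ insertBefore j π
  insertBefore-surjective {n} σ = surj (σ ⟨$⟩ʳ zero) refl
    where
    surj : ∀ j → σ ⟨$⟩ʳ zero ≡ j → ∃ λ j → ∃ λ π → σ ≈ₚ insertBefore j π
    surj zero    p = zero , remove zero σ , λ i → sym (lift₀-remove σ p i)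
    surj (suc j) p = suc j , remove zero τ , λ i →
      sym (trans (cong (transpose zero (suc j) ⟨$⟩ʳ_) (lift₀-remove τ fixes i)) (transpose-inverse zero (suc j)))
      where
      τ = σ ∘ₚ transpose (suc j) zero
      fixes : τ ⟨$⟩ʳ zero ≡ zero
      fixes rewrite p | dec-true (j ≟ j) refl = refl

  labelledSetoid : ℕ → Setoid 0ℓ 0ℓ
  labelledSetoid n = record
    { Carrier       = Labelled n
    ; _≈_           = λ (π , _) (ρ , _) → π ≈ₚ ρ
    ; isEquivalence = record
      { refl  = λ _ → refl
      ; sym   = λ p i → sym (p i)
      ; trans = λ p q i → trans (p i) (q i)
      }
    }

  labelled-enumerates : ∀ n → Enumerates (map proj₁ (labelled n))
  labelled-enumerates n = record
    { complete = λ π → Any.map⁺ (labelled-complete n π)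
    ; distinct = AllPairs.map⁺ (labelled-distinct n)
    }
    where
    labelled-complete : ∀ n (π : Permutation′ n) → Any (λ (ρ , _) → π ≈ₚ ρ) (labelled n)
    labelled-complete zero    π = here λ ()
    labelled-complete (suc n) σ with insertBefore-surjective σ
    ... | j , π , p = Any.cartesianProductWith⁺ _
      (λ { {ρ , _} q refl i → trans (p i) (insertBefore-cong j π ρ q i) })
      (labelled-complete n π) (∈-allFin j)
    labelled-distinct : ∀ n → AllPairs (λ (π , _) (ρ , _) → ¬ π ≈ₚ ρ) (labelled n)
    labelled-distinct zero    = [] ∷ []
    labelled-distinct (suc n) = Uniqueₛ.cartesianProductWith⁺ (labelledSetoid n) (≡.setoid (Fin (suc n))) (labelledSetoid (suc n))
      (λ (π , L) j → insertBefore j π , insertBefore-labelling j L)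
      (λ { {π , _} {ρ , _} p → Product.swap (insertBefore-injective π ρ p) }) (labelled-distinct n) (Unique.allFin⁺ (suc n))

  module Reindexing {c ℓ} (R : CommutativeSemiring c ℓ) where
    open CommutativeSemiring R using (Carrier; +-cong)
      renaming (_≈_ to _≈ᵣ_; refl to ≈-refl; trans to ≈-trans; sym to ≈-sym; reflexive to ≈-reflexive)
    open ListSum R

    -- The rearrangement of words pulls back to one of `πs` into a list with the same words as `ρs`,
    -- and there `f` agrees entry by entry.
    ∑-reindex : ∀ {n} {πs ρs : List (Permutation′ n)} (f : Permutation′ n → Carrier) →
                (∀ π ρ → π ≈ₚ ρ → f π ≈ᵣ f ρ) → Enumerates πs → Enumerates ρs → ∑ₗ πs f ≈ᵣ ∑ₗ ρs f
    ∑-reindex {n} {πs} {ρs} f f-cong P Q with ↭.↭-map-inv word (enumerations-↭ P Q)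
    ... | ρs′ , q , πs↭ρs′ = ≈-trans (∑ₗ-↭ f πs↭ρs′) (≈-sym (byWord ρs ρs′ q))
      where
      byWord : ∀ (ρs ρs′ : List (Permutation′ n)) → map word ρs ≡ map word ρs′ → ∑ₗ ρs f ≈ᵣ ∑ₗ ρs′ f
      byWord []       []         _ = ≈-refl
      byWord (ρ ∷ ρs) (ρ′ ∷ ρs′) q =
        +-cong (f-cong ρ ρ′ (word-injective ρ ρ′ (List.∷-injectiveˡ q))) (byWord ρs ρs′ (List.∷-injectiveʳ q))

-- The number of set partitions with given block sizes

module _ where
  open ≡ using (refl; sym; trans; cong; cong₂; module ≡-Reasoning)
  open ≡-Reasoning
  open import Data.Nat.Base using (_+_; _*_)
  open import Data.Product.Base using (_×_; uncurry)
  open ListSum ℕ.+-*-commutativeSemiring using (∑ₗ; ∑ₗ-cong; ∑ₗ-map; ∑ₗ-+; ∑ₗ-*ˡ; ∑ₗ-zero; ∑ₗ-swap; ∑ₗ-concatMap)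

  picks : ∀ {a} {A : Set a} → List A → List (A × List A)
  picks []       = []
  picks (x ∷ xs) = (x , xs) ∷ map (λ (y , ys) → y , x ∷ ys) (picks xs)

  module _ {a} {A : Set a} where

    ∑-picks : ∀ x (xs : List A) (f : A → List A → ℕ) →
              ∑ₗ (picks (x ∷ xs)) (uncurry f) ≡ f x xs + ∑ₗ (picks xs) (λ (y , ys) → f y (x ∷ ys))
    ∑-picks x xs f = cong (f x xs +_) (∑ₗ-map _ (picks xs) (uncurry f))

    ∑-picks-cong : ∀ (xs : List A) {f g : A → List A → ℕ} → (∀ y ys → y ∷ ys ↭ xs → f y ys ≡ g y ys) →
                   ∑ₗ (picks xs) (uncurry f) ≡ ∑ₗ (picks xs) (uncurry g)
    ∑-picks-cong []       f≡g = refl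
    ∑-picks-cong (x ∷ xs) {f} {g} f≡g = begin
      ∑ₗ (picks (x ∷ xs)) (uncurry f)                          ≡⟨ ∑-picks x xs f ⟩
      f x xs + ∑ₗ (picks xs) (λ (y , ys) → f y (x ∷ ys))
        ≡⟨ cong₂ _+_ (f≡g x xs ↭-refl) (∑-picks-cong xs λ y ys p →
                                                                    f≡g y (x ∷ ys) (↭-trans (swap y x ↭-refl) (prep x p))) ⟩
      g x xs + ∑ₗ (picks xs) (λ (y , ys) → g y (x ∷ ys))       ≡⟨ ∑-picks x xs g ⟨
      ∑ₗ (picks (x ∷ xs)) (uncurry g)                          ∎

    ∑-picks² : List A → (A → A → List A → ℕ) → ℕ
    ∑-picks² xs h = ∑ₗ (picks xs) λ (y , ys) → ∑ₗ (picks ys) λ (z , zs) → h y z zs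

    ∑-picks²-∷ : ∀ x xs h → ∑-picks² (x ∷ xs) h ≡
                 ∑ₗ (picks xs) (λ (y , ys) → h x y ys) +
                 (∑ₗ (picks xs) (λ (y , ys) → h y x ys) + ∑-picks² xs (λ y z zs → h y z (x ∷ zs)))
    ∑-picks²-∷ x xs h = trans (∑-picks x xs (λ y ys → ∑ₗ (picks ys) λ (z , zs) → h y z zs))
      (cong (∑ₗ (picks xs) (λ (y , ys) → h x y ys) +_)
        (trans (∑ₗ-cong (picks xs) λ (y , ys) → ∑-picks x ys (h y))
               (∑ₗ-+ (picks xs) (λ (y , ys) → h y x ys) _)))

    -- The sum ranges over ordered pairs of distinct positions, and the entries left over are the
    -- same list whichever of the two is picked first.
    ∑-picks²-swap : ∀ xs h → ∑-picks² xs h ≡ ∑-picks² xs (λ y z → h z y)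
    ∑-picks²-swap []       h = refl
    ∑-picks²-swap (x ∷ xs) h = begin
      ∑-picks² (x ∷ xs) h                                     ≡⟨ ∑-picks²-∷ x xs h ⟩
      s₁ + (s₂ + ∑-picks² xs (λ y z zs → h y z (x ∷ zs)))       ≡⟨ cong (λ s → s₁ + (s₂ + s)) (∑-picks²-swap xs _) ⟩
      s₁ + (s₂ + s₃)                                             ≡⟨ arith s₁ s₂ s₃ ⟩
      s₂ + (s₁ + s₃)                                             ≡⟨ ∑-picks²-∷ x xs (λ y z → h z y) ⟨
      ∑-picks² (x ∷ xs) (λ y z → h z y)                       ∎
      where
      s₁ = ∑ₗ (picks xs) (λ (y , ys) → h x y ys)
      s₂ = ∑ₗ (picks xs) (λ (y , ys) → h y x ys)
      s₃ = ∑-picks² xs (λ y z zs → h z y (x ∷ zs))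
      arith : ∀ a b c → a + (b + c) ≡ b + (a + c)
      arith = solve-∀

  -- The number of bijections between the positions of two lists that match equal entries.
  matchings : List ℕ → List ℕ → ℕ
  matchings []       []      = 1
  matchings []       (_ ∷ _) = 0
  matchings (k ∷ ks) xs      = ∑ₗ (picks xs) λ (y , ys) → [ k ℕ.≟ y ] * matchings ks ys

  matchings-∷∷ : ∀ a b ks xs → matchings (a ∷ b ∷ ks) xs ≡
                 ∑-picks² xs (λ y z zs → [ a ℕ.≟ y ] * [ b ℕ.≟ z ] * matchings ks zs)
  matchings-∷∷ a b ks xs = ∑ₗ-cong (picks xs) λ (y , ys) → trans
    (sym (∑ₗ-*ˡ (picks ys) _ [ a ℕ.≟ y ]))
    (∑ₗ-cong (picks ys) λ (z , zs) → sym (ℕ.*-assoc [ a ℕ.≟ y ] [ b ℕ.≟ z ] (matchings ks zs)))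

  matchings-swap : ∀ a b ks xs → matchings (a ∷ b ∷ ks) xs ≡ matchings (b ∷ a ∷ ks) xs
  matchings-swap a b ks xs = begin
    matchings (a ∷ b ∷ ks) xs                                                    ≡⟨ matchings-∷∷ a b ks xs ⟩
    ∑-picks² xs (λ y z zs → [ a ℕ.≟ y ] * [ b ℕ.≟ z ] * matchings ks zs)         ≡⟨ ∑-picks²-swap xs _ ⟩
    ∑-picks² xs (λ y z zs → [ a ℕ.≟ z ] * [ b ℕ.≟ y ] * matchings ks zs)
      ≡⟨ ∑ₗ-cong (picks xs) (λ (y , ys) → ∑ₗ-cong (picks ys) λ (z , zs) →
         cong (_* matchings ks zs) (ℕ.*-comm [ a ℕ.≟ z ] [ b ℕ.≟ y ])) ⟩
    ∑-picks² xs (λ y z zs → [ b ℕ.≟ y ] * [ a ℕ.≟ z ] * matchings ks zs)         ≡⟨ matchings-∷∷ b a ks xs ⟨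
    matchings (b ∷ a ∷ ks) xs                                                    ∎

  -- An entry k stands for a part of size suc k, so decrementing the entry 0 removes the part.
  lower : ℕ → List ℕ → List ℕ
  lower zero    ks = ks
  lower (suc k) ks = k ∷ ks

  lowerings : List ℕ → List (List ℕ)
  lowerings []       = []
  lowerings (k ∷ ks) = lower k ks ∷ map (k ∷_) (lowerings ks)

  ∑-lowerings : ∀ k ks (f : List ℕ → ℕ) → ∑ₗ (lowerings (k ∷ ks)) f ≡ f (lower k ks) + ∑ₗ (lowerings ks) (f ∘ (k ∷_))
  ∑-lowerings k ks f = cong (f (lower k ks) +_) (∑ₗ-map (k ∷_) (lowerings ks) f)

  -- To pick the entry just lowered to `k` is to pick `suc k`; a lowered 0 has vanished and cannot
  -- be picked, whence the value 0.
  atPred : (ℕ → List ℕ → ℕ) → ℕ → List ℕ → ℕ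
  atPred h zero    r = 0
  atPred h (suc k) r = h k r

  ∑-picks-lower : ∀ k ks (h : ℕ → List ℕ → ℕ) → ∑ₗ (picks (lower k ks)) (uncurry h) ≡
                  atPred h k ks + ∑ₗ (picks ks) (λ (x , r) → h x (lower k r))
  ∑-picks-lower zero    ks h = refl
  ∑-picks-lower (suc k) ks h = ∑-picks k ks h

  -- Either the lowered entry is the one picked, or the two operations concern different positions
  -- and commute.
  ∑-lowerings-picks : ∀ ks (h : ℕ → List ℕ → ℕ) →
    ∑ₗ (lowerings ks) (λ d → ∑ₗ (picks d) (uncurry h)) ≡
    ∑ₗ (picks ks) (uncurry (atPred h)) + ∑ₗ (picks ks) (λ (x , r) → ∑ₗ (lowerings r) (h x))
  ∑-lowerings-picks []       h = refl
  ∑-lowerings-picks (k ∷ ks) h = begin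
    ∑ₗ (lowerings (k ∷ ks)) (λ d → ∑ₗ (picks d) (uncurry h))
      ≡⟨ ∑-lowerings k ks _ ⟩
    ∑ₗ (picks (lower k ks)) (uncurry h) + ∑ₗ (lowerings ks) (λ d → ∑ₗ (picks (k ∷ d)) (uncurry h))
      ≡⟨ cong₂ _+_ (∑-picks-lower k ks h) (trans (∑ₗ-cong (lowerings ks) λ d → ∑-picks k d h) (∑ₗ-+ (lowerings ks) (h k) _)) ⟩
    atPred h k ks + a + (b + ∑ₗ (lowerings ks) (λ d → ∑ₗ (picks d) (λ (x , r) → h x (k ∷ r))))
      ≡⟨ cong (λ s → atPred h k ks + a + (b + s)) (∑-lowerings-picks ks (λ x r → h x (k ∷ r))) ⟩
    atPred h k ks + a + (b + (∑ₗ (picks ks) (uncurry (atPred λ x r → h x (k ∷ r))) + e))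
      ≡⟨ cong (λ s → atPred h k ks + a + (b + (s + e))) (∑-picks-cong ks λ { zero r _ → refl ; (suc x) r _ → refl }) ⟩
    atPred h k ks + a + (b + (d + e))
      ≡⟨ arith (atPred h k ks) a b d e ⟩
    (atPred h k ks + d) + (b + (a + e))
      ≡⟨ cong₂ _+_ (∑-picks k ks (atPred h)) (trans (∑-picks k ks (λ x r → ∑ₗ (lowerings r) (h x)))
           (cong (b +_) (trans (∑ₗ-cong (picks ks) λ (x , r) → ∑-lowerings k r (h x))
             (∑ₗ-+ (picks ks) (λ (x , r) → h x (lower k r)) _)))) ⟨
    ∑ₗ (picks (k ∷ ks)) (uncurry (atPred h)) + ∑ₗ (picks (k ∷ ks)) (λ (x , r) → ∑ₗ (lowerings r) (h x)) ∎
    where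
    a = ∑ₗ (picks ks) (λ (x , r) → h x (lower k r))
    b = ∑ₗ (lowerings ks) (h k)
    d = ∑ₗ (picks ks) (λ (x , r) → atPred h x (k ∷ r))
    e = ∑ₗ (picks ks) (λ (x , r) → ∑ₗ (lowerings r) (λ s → h x (k ∷ s)))
    arith : ∀ p a b d e → p + a + (b + (d + e)) ≡ (p + d) + (b + (a + e))
    arith = solve-∀

  -- Adding an element to a set partition is adjoint, for the pairing `matchings`, to lowering an
  -- entry: enlarge a block on the left, or lower its partner on the right. This moves the recursion
  -- of `types` to the target type.
  matchings-bumps : ∀ ks xs → matchings (0 ∷ ks) xs + ∑ₗ (bumps ks) (λ b → matchings b xs) ≡
                              ∑ₗ (lowerings xs) (matchings ks)
  matchings-bumps [] xs = trans (ℕ.+-identityʳ _) (base xs)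
    where
    base : ∀ xs → matchings (0 ∷ []) xs ≡ ∑ₗ (lowerings xs) (matchings [])
    base []       = refl
    base (x ∷ xs) = begin
      matchings (0 ∷ []) (x ∷ xs)
        ≡⟨ ∑-picks x xs (λ y ys → [ 0 ℕ.≟ y ] * matchings [] ys) ⟩
      [ 0 ℕ.≟ x ] * matchings [] xs + ∑ₗ (picks xs) (λ (y , ys) → [ 0 ℕ.≟ y ] * 0)
        ≡⟨ cong₂ _+_ (first x) (trans (∑ₗ-cong (picks xs) λ (y , _) → ℕ.*-zeroʳ [ 0 ℕ.≟ y ]) (∑ₗ-zero (picks xs))) ⟩
      matchings [] (lower x xs) + 0
        ≡⟨ cong (matchings [] (lower x xs) +_) (∑ₗ-zero (lowerings xs)) ⟨
      matchings [] (lower x xs) + ∑ₗ (lowerings xs) (λ d → 0)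
        ≡⟨ ∑-lowerings x xs (matchings []) ⟨
      ∑ₗ (lowerings (x ∷ xs)) (matchings []) ∎
      where
      first : ∀ x → [ 0 ℕ.≟ x ] * matchings [] xs ≡ matchings [] (lower x xs)
      first zero    = ℕ.*-identityˡ _
      first (suc x) = refl
  matchings-bumps (k ∷ ks) xs = begin
    matchings (0 ∷ k ∷ ks) xs + (matchings (suc k ∷ ks) xs + ∑ₗ (map (k ∷_) (bumps ks)) (λ b → matchings b xs))
      ≡⟨ cong₂ (λ a b → a + (matchings (suc k ∷ ks) xs + b)) (matchings-swap 0 k ks xs)
           (trans (∑ₗ-map (k ∷_) (bumps ks) (λ b → matchings b xs))
             (trans (∑ₗ-swap (bumps ks) (picks xs) (λ b (y , ys) → [ k ℕ.≟ y ] * matchings b ys))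
                    (∑ₗ-cong (picks xs) λ (y , ys) → ∑ₗ-*ˡ (bumps ks) (λ b → matchings b ys) [ k ℕ.≟ y ]))) ⟩
    matchings (k ∷ 0 ∷ ks) xs + (matchings (suc k ∷ ks) xs +
      ∑ₗ (picks xs) (λ (y , ys) → [ k ℕ.≟ y ] * ∑ₗ (bumps ks) (λ b → matchings b ys)))
      ≡⟨ arith (matchings (k ∷ 0 ∷ ks) xs) (matchings (suc k ∷ ks) xs) _ ⟩
    matchings (suc k ∷ ks) xs + (matchings (k ∷ 0 ∷ ks) xs +
      ∑ₗ (picks xs) (λ (y , ys) → [ k ℕ.≟ y ] * ∑ₗ (bumps ks) (λ b → matchings b ys)))
      -- Matching `suc k` with `suc y` is matching `k` with `y`, which is what `atPred h` records.
      ≡⟨ cong₂ _+_ (∑-picks-cong xs λ { zero ys _ → refl ; (suc y) ys _ → refl })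
           (trans (sym (∑ₗ-+ (picks xs) (λ (y , ys) → [ k ℕ.≟ y ] * matchings (0 ∷ ks) ys) _))
             (∑ₗ-cong (picks xs) λ (y , ys) → trans (sym (ℕ.*-distribˡ-+ [ k ℕ.≟ y ] _ _))
               (trans (cong ([ k ℕ.≟ y ] *_) (matchings-bumps ks ys)) (sym (∑ₗ-*ˡ (lowerings ys) (matchings ks) [ k ℕ.≟ y ]))))) ⟩
    ∑ₗ (picks xs) (uncurry (atPred h)) + ∑ₗ (picks xs) (λ (y , ys) → ∑ₗ (lowerings ys) (h y))
      ≡⟨ ∑-lowerings-picks xs h ⟨
    ∑ₗ (lowerings xs) (matchings (k ∷ ks)) ∎
    where
    h : ℕ → List ℕ → ℕ
    h y ys = [ k ℕ.≟ y ] * matchings ks ys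
    arith : ∀ a b c → a + (b + c) ≡ b + (a + c)
    arith = solve-∀

  factorials : List ℕ → ℕ
  factorials ks = ℕ.product (map (λ k → suc k !) ks)

  -- Lowering a part of size s divides the product of factorials by s, so its term contributes s
  -- times `x`, and the sizes add up to the total.
  ∑-lowerings-factorials : ∀ ks (g : List ℕ → ℕ) x →
    (∀ d → suc (ℕ.sum (map suc d)) ≡ ℕ.sum (map suc ks) → g d * factorials d ≡ x) →
    ∑ₗ (lowerings ks) g * factorials ks ≡ ℕ.sum (map suc ks) * x
  ∑-lowerings-factorials []       g x eq = refl
  ∑-lowerings-factorials (k ∷ ks) g x eq = begin
    ∑ₗ (lowerings (k ∷ ks)) g * factorials (k ∷ ks)
      ≡⟨ cong (_* factorials (k ∷ ks)) (∑-lowerings k ks g) ⟩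
    (g (lower k ks) + s) * (suc k ! * factorials ks)
      ≡⟨ arith (g (lower k ks)) s (suc k !) (factorials ks) ⟩
    g (lower k ks) * (suc k ! * factorials ks) + (suc k ! * s) * factorials ks
      ≡⟨ cong₂ _+_ (first k eq) (cong (_* factorials ks) (sym (∑ₗ-*ˡ (lowerings ks) (g ∘ (k ∷_)) (suc k !)))) ⟩
    suc k * x + ∑ₗ (lowerings ks) (λ d → suc k ! * g (k ∷ d)) * factorials ks
      -- The factorial of the untouched head is moved into `g` before recursing on the tail.
      ≡⟨ cong (suc k * x +_) (∑-lowerings-factorials ks (λ d → suc k ! * g (k ∷ d)) x λ d p →
           trans (arith₁ (suc k !) (g (k ∷ d)) (factorials d))
             (eq (k ∷ d) (trans (sym (ℕ.+-suc (suc k) (ℕ.sum (map suc d)))) (cong (suc k +_) p)))) ⟩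
    suc k * x + ℕ.sum (map suc ks) * x
      ≡⟨ ℕ.*-distribʳ-+ x (suc k) (ℕ.sum (map suc ks)) ⟨
    ℕ.sum (map suc (k ∷ ks)) * x ∎
    where
    s = ∑ₗ (lowerings ks) (g ∘ (k ∷_))
    arith : ∀ a s p f → (a + s) * (p * f) ≡ a * (p * f) + (p * s) * f
    arith = solve-∀
    arith₁ : ∀ p g f → p * g * f ≡ g * (p * f)
    arith₁ = solve-∀
    arith₂ : ∀ g k p f → g * ((k * p) * f) ≡ k * (g * (p * f))
    arith₂ = solve-∀
    first : ∀ k → (∀ d → suc (ℕ.sum (map suc d)) ≡ ℕ.sum (map suc (k ∷ ks)) → g d * factorials d ≡ x) →
            g (lower k ks) * (suc k ! * factorials ks) ≡ suc k * x
    first zero    eq = trans (cong (g ks *_) (ℕ.*-identityˡ (factorials ks))) (trans (eq ks refl) (sym (ℕ.*-identityˡ x)))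
    first (suc k) eq = trans (arith₂ (g (k ∷ ks)) (suc (suc k)) (suc k !) (factorials ks)) (cong (suc (suc k) *_) (eq (k ∷ ks) refl))

  -- The sum counts set partitions whose blocks are assigned to the positions of `ks`, that is,
  -- ordered set partitions with prescribed block sizes: a multinomial coefficient.
  ∑-matchings : ∀ n ks → ℕ.sum (map suc ks) ≡ n → ∑ₗ (types n) (λ b → matchings b ks) * factorials ks ≡ n !
  ∑-matchings zero    []       _ = refl
  ∑-matchings (suc n) ks       p = begin
    ∑ₗ (types (suc n)) (λ b → matchings b ks) * factorials ks
      ≡⟨ cong (_* factorials ks) (trans (∑ₗ-concatMap _ (types n) _) (trans (∑ₗ-cong (types n) λ b → matchings-bumps b ks)
           (∑ₗ-swap (types n) (lowerings ks) matchings))) ⟩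
    ∑ₗ (lowerings ks) (λ d → ∑ₗ (types n) (λ b → matchings b d)) * factorials ks
      ≡⟨ ∑-lowerings-factorials ks _ (n !) (λ d q → ∑-matchings n d (ℕ.suc-injective (trans q p))) ⟩
    ℕ.sum (map suc ks) * n !
      ≡⟨ cong (_* n !) p ⟩
    suc n ! ∎

  multiplicity-↭ : ∀ k {xs ys} → xs ↭ ys → multiplicity k xs ≡ multiplicity k ys
  multiplicity-↭ k p = ↭.↭-length (↭.filter-↭ (k ℕ.≟_) p)

  -- The product of m! over all multiplicities m, built entry by entry: a further `k` raises its
  -- factor from m! to (m + 1)!.
  symmetries : List ℕ → ℕ
  symmetries []       = 1
  symmetries (k ∷ ks) = suc (multiplicity k ks) * symmetries ks

  symmetries-↭ : ∀ {xs ys} → xs ↭ ys → symmetries xs ≡ symmetries ys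
  symmetries-↭ ↭.refl        = refl
  symmetries-↭ (prep x p)    = cong₂ (λ a b → suc a * b) (multiplicity-↭ x p) (symmetries-↭ p)
  symmetries-↭ (↭.trans p q) = trans (symmetries-↭ p) (symmetries-↭ q)
  symmetries-↭ {x ∷ y ∷ xs} {y ∷ x ∷ ys} (swap x y p) = begin
    suc (multiplicity x (y ∷ xs)) * (suc (multiplicity y xs) * symmetries xs)
      ≡⟨ cong₂ (λ a b → suc a * (suc (multiplicity y xs) * b)) (multiplicity-∷ x y xs) (symmetries-↭ p) ⟩
    suc ([ x ℕ.≟ y ] + multiplicity x xs) * (suc (multiplicity y xs) * symmetries ys)
      ≡⟨ cong₂ (λ a b → suc ([ x ℕ.≟ y ] + a) * (suc b * symmetries ys)) (multiplicity-↭ x p) (multiplicity-↭ y p) ⟩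
    suc ([ x ℕ.≟ y ] + multiplicity x ys) * (suc (multiplicity y ys) * symmetries ys)
      ≡⟨ exchange (x ℕ.≟ y) (y ℕ.≟ x) ⟩
    suc ([ y ℕ.≟ x ] + multiplicity y ys) * (suc (multiplicity x ys) * symmetries ys)
      ≡⟨ cong (λ a → suc a * (suc (multiplicity x ys) * symmetries ys)) (multiplicity-∷ y x ys) ⟨
    suc (multiplicity y (x ∷ ys)) * (suc (multiplicity x ys) * symmetries ys) ∎
    where
    arith : ∀ a b s → suc a * (suc b * s) ≡ suc b * (suc a * s)
    arith = solve-∀
    exchange : (p : Dec (x ≡ y)) (q : Dec (y ≡ x)) →
      suc ([ p ] + multiplicity x ys) * (suc (multiplicity y ys) * symmetries ys) ≡
      suc ([ q ] + multiplicity y ys) * (suc (multiplicity x ys) * symmetries ys)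
    exchange (yes refl) (yes _) = refl
    exchange (yes p) (no q)  = contradiction (sym p) q
    exchange (no p)  (yes q) = contradiction (sym q) p
    exchange (no _)  (no _)  = arith (multiplicity x ys) (multiplicity y ys) (symmetries ys)

  ∑-picks-multiplicity : ∀ k xs → ∑ₗ (picks xs) (λ (y , _) → [ k ℕ.≟ y ]) ≡ multiplicity k xs
  ∑-picks-multiplicity k []       = refl
  ∑-picks-multiplicity k (x ∷ xs) = trans (∑-picks x xs (λ y _ → [ k ℕ.≟ y ]))
    (trans (cong ([ k ℕ.≟ x ] +_) (∑-picks-multiplicity k xs)) (sym (multiplicity-∷ k x xs)))

  -- The head may be matched with any entry equal to it, and removing that entry leaves a
  -- rearrangement of the tail.
  matchings-↭ : ∀ ks {xs} → ks ↭ xs → matchings ks xs ≡ symmetries ks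
  matchings-↭ [] p with refl ← ↭.↭-empty-inv (↭-sym p) = refl
  matchings-↭ (k ∷ ks) {xs} p = begin
    ∑ₗ (picks xs) (λ (y , ys) → [ k ℕ.≟ y ] * matchings ks ys)
      ≡⟨ ∑-picks-cong xs (λ y ys q → only y ys q (k ℕ.≟ y)) ⟩
    ∑ₗ (picks xs) (λ (y , ys) → symmetries ks * [ k ℕ.≟ y ])
      ≡⟨ ∑ₗ-*ˡ (picks xs) (λ (y , _) → [ k ℕ.≟ y ]) (symmetries ks) ⟩
    symmetries ks * ∑ₗ (picks xs) (λ (y , _) → [ k ℕ.≟ y ])
      ≡⟨ cong (symmetries ks *_) (trans (∑-picks-multiplicity k xs) (sym (multiplicity-↭ k p))) ⟩
    symmetries ks * multiplicity k (k ∷ ks)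
      ≡⟨ cong (symmetries ks *_) (trans (multiplicity-∷ k k ks) (cong (_+ multiplicity k ks) ([]-yes (k ℕ.≟ k) refl))) ⟩
    symmetries ks * suc (multiplicity k ks)
      ≡⟨ ℕ.*-comm (symmetries ks) _ ⟩
    symmetries (k ∷ ks) ∎
    where
    only : ∀ y ys → y ∷ ys ↭ xs → (q : Dec (k ≡ y)) → [ q ] * matchings ks ys ≡ symmetries ks * [ q ]
    only y ys q (yes refl) = trans (ℕ.*-identityˡ _)
      (trans (matchings-↭ ks (↭.drop-∷ (↭-trans p (↭-sym q)))) (sym (ℕ.*-identityʳ _)))
    only y ys q (no _) = sym (ℕ.*-zeroʳ (symmetries ks))

  matchings-¬↭ : ∀ ks {xs} → ¬ (ks ↭ xs) → matchings ks xs ≡ 0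
  matchings-¬↭ []       {[]}    p = contradiction ↭-refl p
  matchings-¬↭ []       {_ ∷ _} p = refl
  matchings-¬↭ (k ∷ ks) {xs}    p = trans (∑-picks-cong xs λ y ys q → none y ys q (k ℕ.≟ y)) (∑ₗ-zero (picks xs))
    where
    none : ∀ y ys → y ∷ ys ↭ xs → (q : Dec (k ≡ y)) → [ q ] * matchings ks ys ≡ 0
    none y ys q (yes refl) = trans (ℕ.*-identityˡ _) (matchings-¬↭ ks λ r → p (↭-trans (prep k r) q))
    none y ys q (no _)     = refl

-- Eulerian polynomials through descents and ascents

module _ where
  open ≡ using (refl; sym; trans; cong; cong₂)
  open ℕSum using (sum; sum-cong-≗)

  isDescent isAscent : ∀ {n} → (Fin (suc n) → ℕ) → Fin n → ℕ
  isDescent f i = [ f (suc i) ℕ.<? f (inject₁ i) ]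
  isAscent f i = 1 ∸ isDescent f i

  descents ascents : ∀ {n} → (Fin (suc n) → ℕ) → ℕ
  descents f = sum (isDescent f)
  ascents f = sum (isAscent f)

  descents-cong : ∀ {n} {f g : Fin (suc n) → ℕ} → f ≗ g → descents f ≡ descents g
  descents-cong f≗g = sum-cong-≗ λ i → cong₂ (λ a b → [ a ℕ.<? b ]) (f≗g (suc i)) (f≗g (inject₁ i))

  ascents-cong : ∀ {n} {f g : Fin (suc n) → ℕ} → f ≗ g → ascents f ≡ ascents g
  ascents-cong f≗g = sum-cong-≗ λ i → cong₂ (λ a b → 1 ∸ [ a ℕ.<? b ]) (f≗g (suc i)) (f≗g (inject₁ i))

  descents+ascents : ∀ {n} (f : Fin (suc n) → ℕ) → descents f ℕ.+ ascents f ≡ n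
  descents+ascents {zero}  f = refl
  descents+ascents {suc n} f with does (f (suc zero) ℕ.<? f zero)
  ... | true  = cong suc (descents+ascents (f ∘ suc))
  ... | false = trans (ℕ.+-suc _ _) (cong suc (descents+ascents (f ∘ suc)))

  values : ∀ {n} → Permutation′ n → Fin n → ℕ
  values π i = toℕ (π ⟨$⟩ʳ i)

  des≡descents : ∀ {n} (π : Permutation′ (suc n)) → des π ≡ descents (values π)
  des≡descents π = length-filter-tabulate (λ i → π ⟨$⟩ʳ suc i <? π ⟨$⟩ʳ inject₁ i) (λ i → i)

  values-insert : ∀ {n} j (π : Permutation′ n) → values (insert j zero π) ≗ insertAt (suc ∘ values π) j 0
  values-insert j π k with j ≟ k
  ... | yes refl = sym (insertAt-lookup (suc ∘ values π) j 0)
  ... | no j≢k   = trans (sym (insertAt-punchIn (suc ∘ values π) j 0 (punchOut j≢k)))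
                         (cong (insertAt (suc ∘ values π) j 0) (punchIn-punchOut j≢k))

  -- `permutations` varies the image of the first letter; for the inverses this varies the position
  -- of the least letter, which is the step that descents can follow.
  flip-insert : ∀ {n} j (π : Permutation′ n) → flip (insert zero j π) ≈ₚ insert j zero (flip π)
  flip-insert j π k with j ≟ k
  ... | yes _ = refl
  ... | no _  = refl

  module Eulerian {c ℓ} (R : CommutativeSemiring c ℓ) where
    open CommutativeSemiring R renaming (refl to ≈-refl; trans to ≈-trans; sym to ≈-sym; reflexive to ≈-reflexive) hiding (zero)
    open ListSum R hiding (sum)
    open Valleys R
    open Reindexing R
    open MonoidSum +-commutativeMonoid using () renaming (sum to ∑; sum-cong-≋ to ∑-cong)
    open import Algebra.Properties.Semiring.Exp semiring using (_^_; ^-congˡ)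
    open import Algebra.Properties.CommutativeSemiring.Exp R using (^-distrib-*)
    open import Algebra.Properties.Semiring.Mult semiring using (×-assoc-*)
    open import Relation.Binary.Reasoning.Setoid setoid
    open import Algebra.Solver.CommutativeMonoid +-commutativeMonoid using (solve; _⊕_; _⊜_)
    open import Algebra.Properties.CommutativeSemigroup *-commutativeSemigroup using (x∙yz≈y∙xz)

    -- split and grow are both the derivation D with D a = D b = ab: split on the monomials aⁱbʲ, and grow on
    -- (ab)ᵛ((a + b)/2)ᵉ, because D(ab) = ab(a + b) and D(a + b) = 2ab.
    split : (ℕ → ℕ → Carrier) → ℕ → ℕ → Carrier
    split g i j = i × g i (suc j) + j × g (suc i) j

    eulerian : ℕ → (ℕ → ℕ → Carrier) → Carrier
    eulerian zero    g = g 1 1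
    eulerian (suc m) g = eulerian m (split g)

    -- A least letter turns the gap it enters into a descent followed by an ascent, so a descent gap
    -- gains an ascent and an ascent gap a descent. The slot after the last letter gains a descent,
    -- whence `suc a`; the slot in front is left out.
    ∑-insertAt-suc : ∀ {n} (f : Fin (suc n) → ℕ) (g : ℕ → ℕ → Carrier) (let d = descents f; a = ascents f) →
      ∑ (λ i → g (descents (insertAt (suc ∘ f) (suc i) 0)) (ascents (insertAt (suc ∘ f) (suc i) 0))) ≈
      d × g d (suc a) + suc a × g (suc d) a
    ∑-insertAt-suc {zero}  f g = ≈-trans (+-identityʳ _) (≈-sym (≈-trans (+-identityˡ _) (+-identityʳ _)))
    ∑-insertAt-suc {suc n} f g = begin
      g (suc d) (suc a) + ∑ (λ i → g (b ℕ.+ descents (insertAt (suc ∘ f ∘ suc) (suc i) 0))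
                                  ((1 ∸ b) ℕ.+ ascents (insertAt (suc ∘ f ∘ suc) (suc i) 0)))
        ≈⟨ +-congˡ (∑-insertAt-suc (f ∘ suc) (λ x y → g (b ℕ.+ x) ((1 ∸ b) ℕ.+ y))) ⟩
      g (suc d) (suc a) + (d × g (b ℕ.+ d) ((1 ∸ b) ℕ.+ suc a) + suc a × g (b ℕ.+ suc d) ((1 ∸ b) ℕ.+ a))
        ≈⟨ byStep (f (suc zero) ℕ.<? f zero) ⟩
      (b ℕ.+ d) × g (b ℕ.+ d) (suc ((1 ∸ b) ℕ.+ a)) + suc ((1 ∸ b) ℕ.+ a) × g (suc (b ℕ.+ d)) ((1 ∸ b) ℕ.+ a) ∎
      where
      b = isDescent f zero
      d = descents (f ∘ suc)
      a = ascents (f ∘ suc)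
      byStep : ∀ {p} {P : Set p} (P? : Dec P) → let b = [ P? ] in
        g (suc d) (suc a) + (d × g (b ℕ.+ d) ((1 ∸ b) ℕ.+ suc a) + suc a × g (b ℕ.+ suc d) ((1 ∸ b) ℕ.+ a)) ≈
        (b ℕ.+ d) × g (b ℕ.+ d) (suc ((1 ∸ b) ℕ.+ a)) + suc ((1 ∸ b) ℕ.+ a) × g (suc (b ℕ.+ d)) ((1 ∸ b) ℕ.+ a)
      byStep (yes _) = ≈-sym (+-assoc _ _ _)
      byStep (no _)  = solve 3 (λ x y z → x ⊕ (y ⊕ z) ⊜ y ⊕ (x ⊕ z)) ≈-refl
        (g (suc d) (suc a)) (d × g d (suc (suc a))) (suc a × g (suc d) (suc a))

    -- The shifts by one frame the word with a large letter at each end: the front slot becomes a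
    -- descent and the last slot an ascent.
    byDescents : ∀ {n} → (ℕ → ℕ → Carrier) → Permutation′ (suc n) → Carrier
    byDescents g π = g (suc (descents (values π))) (suc (ascents (values π)))

    byDescents-cong : ∀ {n} g (π ρ : Permutation′ (suc n)) → π ≈ₚ ρ → byDescents g π ≈ byDescents g ρ
    byDescents-cong g π ρ p = ≈-reflexive (cong₂ (λ a b → g (suc a) (suc b))
      (descents-cong (cong toℕ ∘ p)) (ascents-cong (cong toℕ ∘ p)))

    ∑-flip : ∀ n g → ∑ₗ (permutations (suc n)) (byDescents g ∘ flip) ≈ ∑ₗ (permutations (suc n)) (byDescents g)
    ∑-flip n g = ≈-trans (≈-sym (∑ₗ-map flip (permutations (suc n)) (byDescents g)))
      (∑-reindex (byDescents g) (byDescents-cong g) (flips-enumerate (suc n)) (permutations-enumerates (suc n)))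

    ∑-insert : ∀ {n} g (π : Permutation′ (suc n)) →
      ∑ₗ (allFin (suc (suc n))) (λ j → byDescents g (insert j zero π)) ≈ byDescents (split g) π
    ∑-insert {n} g π = begin
      ∑ₗ (allFin (suc (suc n))) (λ j → byDescents g (insert j zero π))
        ≈⟨ ∑ₗ-tabulate {n = suc (suc n)} (λ j → j) (λ j → byDescents g (insert j zero π)) ⟩
      ∑ (λ j → byDescents g (insert j zero π))
        ≈⟨ ∑-cong (λ j → ≈-reflexive (cong₂ (λ a b → g (suc a) (suc b))
             (descents-cong (values-insert j π)) (ascents-cong (values-insert j π)))) ⟩
      g (suc d) (suc (suc a)) + ∑ (λ i → g (suc (descents (insertAt (suc ∘ values π) (suc i) 0)))
                                          (suc (ascents (insertAt (suc ∘ values π) (suc i) 0))))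
        ≈⟨ +-congˡ (∑-insertAt-suc (values π) (λ x y → g (suc x) (suc y))) ⟩
      g (suc d) (suc (suc a)) + (d × g (suc d) (suc (suc a)) + suc a × g (suc (suc d)) (suc a))
        ≈⟨ +-assoc _ _ _ ⟨
      byDescents (split g) π ∎
      where
      d = descents (values π)
      a = ascents (values π)

    ∑-byDescents : ∀ m g → ∑ₗ (permutations (suc m)) (byDescents g) ≈ eulerian m g
    ∑-byDescents zero    g = +-identityʳ _
    ∑-byDescents (suc m) g = begin
      ∑ₗ (permutations (suc (suc m))) (byDescents g)
        ≈⟨ ∑-flip (suc m) g ⟨
      ∑ₗ (permutations (suc (suc m))) (byDescents g ∘ flip)
        ≈⟨ ∑ₗ-cartesianProductWith (insert zero) (allFin (suc (suc m))) (permutations (suc m)) (byDescents g ∘ flip) ⟩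
      ∑ₗ (allFin (suc (suc m))) (λ j → ∑ₗ (permutations (suc m)) (λ π → byDescents g (flip (insert zero j π))))
        ≈⟨ ∑ₗ-swap (allFin (suc (suc m))) (permutations (suc m)) _ ⟩
      ∑ₗ (permutations (suc m)) (λ π → ∑ₗ (allFin (suc (suc m))) (λ j → byDescents g (flip (insert zero j π))))
        ≈⟨ ∑ₗ-cong (permutations (suc m)) (λ π → ∑ₗ-cong (allFin (suc (suc m))) λ j →
             byDescents-cong g (flip (insert zero j π)) (insert j zero (flip π)) (flip-insert j π)) ⟩
      ∑ₗ (permutations (suc m)) (λ π → ∑ₗ (allFin (suc (suc m))) (λ j → byDescents g (insert j zero (flip π))))
        ≈⟨ ∑ₗ-cong (permutations (suc m)) (λ π → ∑-insert g (flip π)) ⟩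
      ∑ₗ (permutations (suc m)) (byDescents (split g) ∘ flip)
        ≈⟨ ∑-flip m (split g) ⟩
      ∑ₗ (permutations (suc m)) (byDescents (split g))
        ≈⟨ ∑-byDescents m (split g) ⟩
      eulerian m (split g) ∎

    -- expand e i j g is the value at aⁱbʲ(a + b)ᵉ of the linear functional sending each monomial aⁱbʲ to g i j.
    expand : ℕ → ℕ → ℕ → (ℕ → ℕ → Carrier) → Carrier
    expand zero    i j g = g i j
    expand (suc e) i j g = expand e (suc i) j g + expand e i (suc j) g

    -- The Leibniz rule for D on aⁱbʲ(a + b)ᵉ, with `e ℕ.+ e` from D(a + b) = 2ab. At `e` = 0 that
    -- coefficient vanishes, so `pred` does no harm.
    expand-split : ∀ e i j g → expand e i j (split g) ≈
      i × expand e i (suc j) g + j × expand e (suc i) j g + (e ℕ.+ e) × expand (pred e) (suc i) (suc j) g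
    expand-split zero    i j g = ≈-sym (+-identityʳ _)
    expand-split (suc e) i j g = begin
      expand e (suc i) j (split g) + expand e i (suc j) (split g)
        ≈⟨ +-cong (expand-split e (suc i) j g) (expand-split e i (suc j) g) ⟩
      (x + i × x) + j × y + (e ℕ.+ e) × expand (pred e) (suc (suc i)) (suc j) g +
        (i × u + (x + j × x) + (e ℕ.+ e) × expand (pred e) (suc i) (suc (suc j)) g)
        ≈⟨ solve 7 (λ x p q r s t u → ((((x ⊕ p) ⊕ q) ⊕ r) ⊕ ((s ⊕ (x ⊕ t)) ⊕ u)) ⊜
                                          (((p ⊕ s) ⊕ (q ⊕ t)) ⊕ (x ⊕ (x ⊕ (r ⊕ u))))) ≈-refl
             x (i × x) (j × y) _ (i × u) (j × x) _ ⟩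
      (i × x + i × u) + (j × y + j × x) + (x + (x +
        ((e ℕ.+ e) × expand (pred e) (suc (suc i)) (suc j) g + (e ℕ.+ e) × expand (pred e) (suc i) (suc (suc j)) g)))
        ≈⟨ +-cong (+-cong (×-distrib-+ x u i) (×-distrib-+ y x j)) (+-congˡ (+-congˡ (recombine e))) ⟨
      i × (x + u) + j × (y + x) + (x + (x + (e ℕ.+ e) × x))
        ≈⟨ +-congˡ (+-congˡ (×-congˡ (ℕ.+-suc e e))) ⟨
      i × (x + u) + j × (y + x) + (suc e ℕ.+ suc e) × x ∎
      where
      x = expand e (suc i) (suc j) g
      y = expand e (suc (suc i)) j g
      u = expand e i (suc (suc j)) g
      recombine : ∀ e → (e ℕ.+ e) × expand e (suc i) (suc j) g ≈
        (e ℕ.+ e) × expand (pred e) (suc (suc i)) (suc j) g + (e ℕ.+ e) × expand (pred e) (suc i) (suc (suc j)) g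
      recombine zero    = ≈-sym (+-identityˡ 0#)
      recombine (suc e) = ×-distrib-+ _ _ (suc e ℕ.+ suc e)

    -- `f v e` plays the value at (ab)ᵛ((a + b)/2)ᵉ of the functional given by `g`. The factor 2ᵉ
    -- clears the denominators, since `R` need not contain one half.
    _Expands_ : (ℕ → ℕ → Carrier) → (ℕ → ℕ → Carrier) → Set ℓ
    g Expands f = ∀ v e → expand e v v g ≈ (2 ℕ.^ e) × f v e

    split-Expands-grow : ∀ {g f} → g Expands f → split g Expands grow f
    split-Expands-grow {g} {f} rel v e = begin
      expand e v v (split g)
        ≈⟨ expand-split e v v g ⟩
      v × expand e v (suc v) g + v × expand e (suc v) v g + (e ℕ.+ e) × expand (pred e) (suc v) (suc v) g
        ≈⟨ +-congʳ (+-comm _ _) ⟩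
      v × expand e (suc v) v g + v × expand e v (suc v) g + (e ℕ.+ e) × expand (pred e) (suc v) (suc v) g
        ≈⟨ +-congʳ (×-distrib-+ _ _ v) ⟨
      v × expand (suc e) v v g + (e ℕ.+ e) × expand (pred e) (suc v) (suc v) g
        ≈⟨ +-cong (×-congʳ v (rel v (suc e))) (×-congʳ (e ℕ.+ e) (rel (suc v) (pred e))) ⟩
      v × ((2 ℕ.^ suc e) × f v (suc e)) + (e ℕ.+ e) × ((2 ℕ.^ pred e) × f (suc v) (pred e))
        ≈⟨ +-cong (regroup v (2 ℕ.^ suc e) (2 ℕ.^ e) (v ℕ.+ v) (arith v (2 ℕ.^ e)))
                  (regroup (e ℕ.+ e) (2 ℕ.^ pred e) (2 ℕ.^ e) e (powers e)) ⟩
      (2 ℕ.^ e) × ((v ℕ.+ v) × f v (suc e)) + (2 ℕ.^ e) × (e × f (suc v) (pred e))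
        ≈⟨ ×-distrib-+ _ _ (2 ℕ.^ e) ⟨
      (2 ℕ.^ e) × grow f v e ∎
      where
      arith : ∀ v p → v ℕ.* (2 ℕ.* p) ≡ p ℕ.* (v ℕ.+ v)
      arith = solve-∀
      arith′ : ∀ e p → (suc e ℕ.+ suc e) ℕ.* p ≡ 2 ℕ.* p ℕ.* suc e
      arith′ = solve-∀
      powers : ∀ e → (e ℕ.+ e) ℕ.* (2 ℕ.^ pred e) ≡ (2 ℕ.^ e) ℕ.* e
      powers zero    = refl
      powers (suc e) = arith′ e (2 ℕ.^ e)
      regroup : ∀ a b c d {x} → a ℕ.* b ≡ c ℕ.* d → a × (b × x) ≈ c × (d × x)
      regroup a b c d {x} p = ≈-trans (×-assocˡ x a b) (≈-trans (×-congˡ p) (≈-sym (×-assocˡ x c d)))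

    -- The indices differ by one because `eulerian` starts at ab, which is D applied to the starting
    -- point (a + b)/2 of `onCycles`.
    eulerian-onCycles : ∀ m {g f} → g Expands f → eulerian m g ≈ onCycles (suc m) f
    eulerian-onCycles zero    rel = ≈-trans (rel 1 0) (≈-sym (+-identityˡ _))
    eulerian-onCycles (suc m) rel = eulerian-onCycles m (split-Expands-grow rel)

    module _ {a b t : Carrier} (a*b≈t : a * b ≈ t) (a+b≈2 : a + b ≈ 2 × 1#) where

      expand-powers : ∀ e i j → expand e i j (λ i j → a ^ i * b ^ j) ≈ (2 ℕ.^ e) × (a ^ i * b ^ j)
      expand-powers zero    i j = ≈-sym (+-identityʳ _)
      expand-powers (suc e) i j = begin
        expand e (suc i) j (λ i j → a ^ i * b ^ j) + expand e i (suc j) (λ i j → a ^ i * b ^ j)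
          ≈⟨ +-cong (expand-powers e (suc i) j) (expand-powers e i (suc j)) ⟩
        (2 ℕ.^ e) × (a * a ^ i * b ^ j) + (2 ℕ.^ e) × (a ^ i * (b * b ^ j))
          ≈⟨ ×-distrib-+ _ _ (2 ℕ.^ e) ⟨
        (2 ℕ.^ e) × (a * a ^ i * b ^ j + a ^ i * (b * b ^ j))
          ≈⟨ ×-congʳ (2 ℕ.^ e) (+-cong (*-assoc _ _ _) (x∙yz≈y∙xz _ _ _)) ⟩
        (2 ℕ.^ e) × (a * (a ^ i * b ^ j) + b * (a ^ i * b ^ j))
          ≈⟨ ×-congʳ (2 ℕ.^ e) (distribʳ _ a b) ⟨
        (2 ℕ.^ e) × ((a + b) * (a ^ i * b ^ j))
          ≈⟨ ×-congʳ (2 ℕ.^ e) (≈-trans (*-congʳ a+b≈2) (≈-trans (×-assoc-* 2 1# _) (×-congʳ 2 (*-identityˡ _)))) ⟩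
        (2 ℕ.^ e) × (2 × (a ^ i * b ^ j))
          ≈⟨ ×-assocˡ _ (2 ℕ.^ e) 2 ⟩
        (2 ℕ.^ e ℕ.* 2) × (a ^ i * b ^ j)
          ≈⟨ ×-congˡ (ℕ.*-comm (2 ℕ.^ e) 2) ⟩
        (2 ℕ.^ suc e) × (a ^ i * b ^ j) ∎

      -- The functional is now evaluation at `a` and `b`, where each factor (a + b)/2 becomes 1 and
      -- only the valleys remain visible.
      powers-Expands : (λ i j → a ^ i * b ^ j) Expands (λ v _ → t ^ v)
      powers-Expands v e = ≈-trans (expand-powers e v v)
        (×-congʳ (2 ℕ.^ e) (≈-trans (≈-sym (^-distrib-* a b v)) (^-congˡ v a*b≈t)))

      onCycles-eulerian : ∀ {w} → w * b ≈ a → ∀ m →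
        onCycles (suc m) (λ v _ → t ^ v) ≈ b ^ suc (suc m) * ∑ₗ (permutations (suc m)) (λ π → w ^ suc (des π))
      onCycles-eulerian {w} wb≈a m = begin
        onCycles (suc m) (λ v _ → t ^ v)
          ≈⟨ eulerian-onCycles m powers-Expands ⟨
        eulerian m (λ i j → a ^ i * b ^ j)
          ≈⟨ ∑-byDescents m _ ⟨
        ∑ₗ (permutations (suc m)) (byDescents (λ i j → a ^ i * b ^ j))
          ≈⟨ ∑ₗ-cong (permutations (suc m)) factor ⟩
        ∑ₗ (permutations (suc m)) (λ π → b ^ suc (suc m) * w ^ suc (des π))
          ≈⟨ ∑ₗ-*ˡ (permutations (suc m)) _ _ ⟩
        b ^ suc (suc m) * ∑ₗ (permutations (suc m)) (λ π → w ^ suc (des π)) ∎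
        where
        open import Algebra.Properties.Semiring.Exp semiring using (^-homo-*; ^-congʳ)
        -- Writing `a` as `w * b` leaves `b` with an exponent that counts all slots of the word. It
        -- does not depend on `π`, as each of the `m` gaps is either a descent or an ascent.
        factor : ∀ π → byDescents (λ i j → a ^ i * b ^ j) π ≈ b ^ suc (suc m) * w ^ suc (des π)
        factor π = begin
          a ^ suc d * b ^ suc u                   ≈⟨ *-congʳ (^-congˡ (suc d) wb≈a) ⟨
          (w * b) ^ suc d * b ^ suc u             ≈⟨ *-congʳ (^-distrib-* w b (suc d)) ⟩
          w ^ suc d * b ^ suc d * b ^ suc u       ≈⟨ *-assoc _ _ _ ⟩
          w ^ suc d * (b ^ suc d * b ^ suc u)     ≈⟨ *-congˡ (^-homo-* b (suc d) (suc u)) ⟨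
          w ^ suc d * b ^ (suc d ℕ.+ suc u)       ≈⟨ *-comm _ _ ⟩
          b ^ (suc d ℕ.+ suc u) * w ^ suc d
            ≈⟨ *-cong (^-congʳ b (cong suc (trans (ℕ.+-suc d u) (cong suc (descents+ascents (values π))))))
                                                            (^-congʳ w (cong suc (sym (des≡descents π)))) ⟩
          b ^ suc (suc m) * w ^ suc (des π)       ∎
          where
          d = descents (values π)
          u = ascents (values π)

open import Defs
open import Data.Integer.Base using (+_)
open import Data.Nat.Base using (_≤_)
open ≡ using (refl; sym; trans; cong; cong₂; subst; subst₂; module ≡-Reasoning)

-- The ring of power series and the identities for the square root

module _ where
  open +-*-Solver

  -- The coefficient `(f * g) (suc n)` unfolds to `f 0 ℚ.* g (suc n) ℚ.+ (tail f * g) n`, which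
  -- makes the ring laws inductions on the coefficient index.
  tail : Series → Series
  tail f = f ∘ suc

  *-cong : ∀ {f f′ g g′} → f ≗ f′ → g ≗ g′ → f * g ≗ f′ * g′
  *-cong p q zero    = cong (ℚ._+ 0ℚ) (cong₂ ℚ._*_ (p 0) (q 0))
  *-cong p q (suc n) = cong₂ ℚ._+_ (cong₂ ℚ._*_ (p 0) (q (suc n))) (*-cong (p ∘ suc) q n)

  -- Splits off the last term of the convolution where unfolding splits off the first; commutativity
  -- exchanges these two ends.
  *-suc : ∀ f g n → (f * g) (suc n) ≡ (f * tail g) n ℚ.+ f (suc n) ℚ.* g 0
  *-suc f g zero    = solve 4 (λ a b c d → a :* b :+ (c :* d :+ con 0ℚ) := (a :* b :+ con 0ℚ) :+ c :* d)
    refl (f 0) (g 1) (f 1) (g 0)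
  *-suc f g (suc n) = trans (cong (f 0 ℚ.* g (suc (suc n)) ℚ.+_) (*-suc (tail f) g n))
    (sym (ℚ.+-assoc (f 0 ℚ.* g (suc (suc n))) _ _))

  *-comm : ∀ f g → f * g ≗ g * f
  *-comm f g zero    = cong (ℚ._+ 0ℚ) (ℚ.*-comm (f 0) (g 0))
  *-comm f g (suc n) = begin
    f 0 ℚ.* g (suc n) ℚ.+ (tail f * g) n    ≡⟨ ℚ.+-comm (f 0 ℚ.* g (suc n)) _ ⟩
    (tail f * g) n ℚ.+ f 0 ℚ.* g (suc n)    ≡⟨ cong₂ ℚ._+_ (*-comm (tail f) g n) (ℚ.*-comm (f 0) (g (suc n))) ⟩
    (g * tail f) n ℚ.+ g (suc n) ℚ.* f 0    ≡⟨ *-suc g f n ⟨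
    (g * f) (suc n)                         ∎
    where open ≡-Reasoning

  *-distribʳ-+ : ∀ h f g → (f + g) * h ≗ f * h + g * h
  *-distribʳ-+ h f g zero    = solve 3 (λ f g h → (f :+ g) :* h :+ con 0ℚ := (f :* h :+ con 0ℚ) :+ (g :* h :+ con 0ℚ))
    refl (f 0) (g 0) (h 0)
  *-distribʳ-+ h f g (suc n) = trans (cong ((f 0 ℚ.+ g 0) ℚ.* h (suc n) ℚ.+_) (*-distribʳ-+ h (tail f) (tail g) n))
    (solve 5 (λ f g h x y → (f :+ g) :* h :+ (x :+ y) := (f :* h :+ x) :+ (g :* h :+ y))
      refl (f 0) (g 0) (h (suc n)) ((tail f * h) n) ((tail g * h) n))

  •-*-assoc : ∀ q f g → (q • f) * g ≗ q • (f * g)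
  •-*-assoc q f g zero    = solve 3 (λ q f g → q :* f :* g :+ con 0ℚ := q :* (f :* g :+ con 0ℚ)) refl q (f 0) (g 0)
  •-*-assoc q f g (suc n) = trans (cong (q ℚ.* f 0 ℚ.* g (suc n) ℚ.+_) (•-*-assoc q (tail f) g n))
    (solve 4 (λ q f g x → q :* f :* g :+ q :* x := q :* (f :* g :+ x)) refl q (f 0) (g (suc n)) ((tail f * g) n))

  *-assoc : ∀ f g h → (f * g) * h ≗ f * (g * h)
  *-assoc f g h zero    = solve 3 (λ f g h → (f :* g :+ con 0ℚ) :* h :+ con 0ℚ := f :* (g :* h :+ con 0ℚ) :+ con 0ℚ)
    refl (f 0) (g 0) (h 0)
  *-assoc f g h (suc n) = begin
    -- `tail (f * g)` is `f 0 • tail g + tail f * g`.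
    (f * g) 0 ℚ.* h (suc n) ℚ.+ ((f 0 • tail g + tail f * g) * h) n
      ≡⟨ cong ((f * g) 0 ℚ.* h (suc n) ℚ.+_) (*-distribʳ-+ h (f 0 • tail g) (tail f * g) n) ⟩
    (f * g) 0 ℚ.* h (suc n) ℚ.+ (((f 0 • tail g) * h) n ℚ.+ ((tail f * g) * h) n)
      ≡⟨ cong₂ (λ a b → (f * g) 0 ℚ.* h (suc n) ℚ.+ (a ℚ.+ b)) (•-*-assoc (f 0) (tail g) h n) (*-assoc (tail f) g h n) ⟩
    (f * g) 0 ℚ.* h (suc n) ℚ.+ (f 0 ℚ.* (tail g * h) n ℚ.+ (tail f * (g * h)) n)
      ≡⟨ solve 5 (λ f g h x y → (f :* g :+ con 0ℚ) :* h :+ (f :* x :+ y) := f :* (g :* h :+ x) :+ y)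
           refl (f 0) (g 0) (h (suc n)) ((tail g * h) n) ((tail f * (g * h)) n) ⟩
    (f * (g * h)) (suc n) ∎
    where open ≡-Reasoning

  *-zeroˡ : ∀ f g → f ≗ 0# → f * g ≗ 0#
  *-zeroˡ f g p zero    = trans (cong (λ a → a ℚ.* g 0 ℚ.+ 0ℚ) (p 0)) (trans (ℚ.+-identityʳ _) (ℚ.*-zeroˡ (g 0)))
  *-zeroˡ f g p (suc n) = trans (cong₂ (λ a b → a ℚ.* g (suc n) ℚ.+ b) (p 0) (*-zeroˡ (tail f) g (p ∘ suc) n))
                                (trans (ℚ.+-identityʳ _) (ℚ.*-zeroˡ (g (suc n))))

  *-identityˡ : ∀ f → 1# * f ≗ f
  *-identityˡ f zero    = trans (ℚ.+-identityʳ _) (ℚ.*-identityˡ (f 0))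
  *-identityˡ f (suc n) = trans (cong (1ℚ ℚ.* f (suc n) ℚ.+_) (*-zeroˡ (tail 1#) f (λ _ → refl) n))
                                (trans (ℚ.+-identityʳ _) (ℚ.*-identityˡ (f (suc n))))

  seriesRing : CommutativeRing 0ℓ 0ℓ
  seriesRing = record
    { Carrier = Series
    ; _≈_ = _≗_
    ; _+_ = _+_
    ; _*_ = _*_
    ; -_  = -_
    ; 0#  = 0#
    ; 1#  = 1#
    ; isCommutativeRing = record
      { isRing = record
        { +-isAbelianGroup = record
          { isGroup = record
            { isMonoid = record
              { isSemigroup = record
                { isMagma = record
                  { isEquivalence = record { refl = λ _ → refl ; sym = λ p n → sym (p n) ; trans = λ p q n → trans (p n) (q n) }
                  ; ∙-cong = λ p q n → cong₂ ℚ._+_ (p n) (q n)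
                  }
                ; assoc = λ f g h n → ℚ.+-assoc (f n) (g n) (h n)
                }
              ; identity = (λ f n → ℚ.+-identityˡ (f n)) , (λ f n → ℚ.+-identityʳ (f n))
              }
            ; inverse = (λ f n → ℚ.+-inverseˡ (f n)) , (λ f n → ℚ.+-inverseʳ (f n))
            ; ⁻¹-cong = λ p n → cong ℚ.-_ (p n)
            }
          ; comm = λ f g n → ℚ.+-comm (f n) (g n)
          }
        ; *-cong = λ {f} {f′} {g} {g′} → *-cong {f} {f′} {g} {g′}
        ; *-assoc = *-assoc
        ; *-identity = *-identityˡ , λ f n → trans (*-comm f 1# n) (*-identityˡ f n)
        ; distrib = (λ h f g n → trans (*-comm h (f + g) n) (trans (*-distribʳ-+ h f g n)
                      (cong₂ ℚ._+_ (*-comm f h n) (*-comm g h n)))) , *-distribʳ-+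
        }
      ; *-comm = *-comm
      }
    }

  module Ser = CommutativeRing seriesRing
  open import Algebra.Properties.Semiring.Mult Ser.semiring using (_×_)
  open import Algebra.Properties.Group Ser.+-group using (∙-cancelʳ)

  √ 1-√ 1+√ : Series
  √   = √[1-t]
  1-√ = 1# - √
  1+√ = 1# + √

  1-√+1+√ : 1-√ + 1+√ ≗ 2 × 1#
  1-√+1+√ n = solve 2 (λ x s → (x :- s) :+ (x :+ s) := x :+ (x :+ con 0ℚ)) refl (1# n) (√ n)

  1-√*1+√ : 1-√ * 1+√ ≗ t
  1-√*1+√ = ∙-cancelʳ (√ * √) (1-√ * 1+√) t (begin
    1-√ * 1+√ + √ * √               ≈⟨ Ser.+-congʳ {√ * √} (Ser.distribˡ 1-√ 1# √) ⟩
    1-√ * 1# + 1-√ * √ + √ * √      ≈⟨ Ser.+-assoc (1-√ * 1#) (1-√ * √) (√ * √) ⟩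
    1-√ * 1# + (1-√ * √ + √ * √)    ≈⟨ Ser.+-cong (Ser.*-identityʳ 1-√) (λ n → sym (*-distribʳ-+ √ 1-√ √ n)) ⟩
    1-√ + (1-√ + √) * √             ≈⟨ Ser.+-congˡ {1-√} (Ser.*-congʳ {√} complement) ⟩
    1-√ + 1# * √                    ≈⟨ Ser.+-congˡ {1-√} (*-identityˡ √) ⟩
    1-√ + √                         ≈⟨ complement ⟩
    1#                              ≈⟨ (λ n → solve 2 (λ x t → x := t :+ (x :- t)) refl (1# n) (t n)) ⟩
    t + (1# - t)                    ≈⟨ Ser.+-congˡ {t} √[1-t]² ⟨
    t + √ * √                       ∎)
    where
    open import Relation.Binary.Reasoning.Setoid Ser.setoid
    complement : 1-√ + √ ≗ 1#
    complement n = solve 2 (λ x s → (x :- s) :+ s := x) refl (1# n) (√ n)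

  tail-t* : ∀ f n → (t * f) (suc n) ≡ f n
  tail-t* f n = trans (cong₂ ℚ._+_ (ℚ.*-zeroˡ (f (suc n)))
    (trans (*-cong {tail t} {1#} {f} {f} (λ { zero → refl ; (suc _) → refl }) (λ _ → refl) n) (*-identityˡ f n)))
                      (ℚ.+-identityˡ (f n))

  t*-cancel : ∀ f g → t * f ≗ t * g → f ≗ g
  t*-cancel f g p n = trans (sym (tail-t* f n)) (trans (p (suc n)) (tail-t* g n))

  t*t⁻¹ : t * (t⁻¹ 1-√) ≗ 1-√
  t*t⁻¹ zero    = refl
  t*t⁻¹ (suc n) = tail-t* (t⁻¹ 1-√) n

  -- Multiplication by `t` shifts coefficients and can be cancelled. The identity says that w + 1 is
  -- 2/(1 + √), with no division of series.
  t⁻¹[1-√]*1+√ : (t⁻¹ 1-√) * 1+√ ≗ 1#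
  t⁻¹[1-√]*1+√ = t*-cancel ((t⁻¹ 1-√) * 1+√) 1# (begin
    t * ((t⁻¹ 1-√) * 1+√)    ≈⟨ *-assoc t (t⁻¹ 1-√) 1+√ ⟨
    t * (t⁻¹ 1-√) * 1+√      ≈⟨ Ser.*-congʳ {1+√} t*t⁻¹ ⟩
    1-√ * 1+√                ≈⟨ 1-√*1+√ ⟩
    t                        ≈⟨ Ser.*-identityʳ t ⟨
    t * 1#                   ∎)
    where open import Relation.Binary.Reasoning.Setoid Ser.setoid

  w*1+√ : w * 1+√ ≗ 1-√
  w*1+√ = ∙-cancelʳ 1+√ (w * 1+√) 1-√ (begin
    w * 1+√ + 1+√             ≈⟨ Ser.+-congˡ {w * 1+√} (*-identityˡ 1+√) ⟨
    w * 1+√ + 1# * 1+√        ≈⟨ *-distribʳ-+ 1+√ w 1# ⟨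
    (w + 1#) * 1+√
      ≈⟨ Ser.*-congʳ {1+√} (λ n → solve 2 (λ x y → (x :- y) :+ y := x) refl (2ℚ ℚ.* (t⁻¹ 1-√) n) (1# n)) ⟩
    (2ℚ • (t⁻¹ 1-√)) * 1+√    ≈⟨ •-*-assoc 2ℚ (t⁻¹ 1-√) 1+√ ⟩
    2ℚ • ((t⁻¹ 1-√) * 1+√)    ≈⟨ (λ n → cong (2ℚ ℚ.*_) (t⁻¹[1-√]*1+√ n)) ⟩
    2ℚ • 1#                   ≈⟨ (λ n → solve 1 (λ x → con 2ℚ :* x := x :+ (x :+ con 0ℚ)) refl (1# n)) ⟩
    2 × 1#                    ≈⟨ 1-√+1+√ ⟨
    1-√ + 1+√                 ∎)
    where
    open import Relation.Binary.Reasoning.Setoid Ser.setoid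
    2ℚ = + 2 ℚ./ 1

-- Weights restricted to a cycle type

map-suc-injective : ∀ {js ks} → map suc js ↭ map suc ks → js ↭ ks
map-suc-injective {js} {ks} p = subst₂ _↭_ (pred-suc js) (pred-suc ks) (↭.map⁺ pred p)
  where
  pred-suc : ∀ js → map pred (map suc js) ≡ js
  pred-suc js = trans (sym (List.map-∘ js)) (List.map-id js)

module TypeWeights {c ℓ} (R : CommutativeSemiring c ℓ) (t : CommutativeSemiring.Carrier R) where
  private module R = CommutativeSemiring R
  open R using (_≈_)
  open ListSum R hiding (sum)
  open Valleys R
  open import Algebra.Properties.Semiring.Exp R.semiring using (^-homo-*) renaming (_^_ to _^ᵣ_)

  cyclePolynomial : ℕ → R.Carrier
  cyclePolynomial k = onCycles k (λ v _ → t ^ᵣ v)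

  weight : List ℕ → List ℕ → ℕ → R.Carrier
  weight ps sizes v = if does (sizes ↭? ps) then t ^ᵣ v else R.0#

  statsWeight : List ℕ → List Stats → R.Carrier
  statsWeight ps L = weight ps (map size L) (ℕ.sum (map proj₁ L))

  ^-sum : ∀ (L : List Stats) → t ^ᵣ ℕ.sum (map proj₁ L) ≈ ∏ₗ L (λ (v , _) → t ^ᵣ v)
  ^-sum []            = R.refl
  ^-sum ((v , e) ∷ L) = R.trans (^-homo-* t v _) (R.*-congˡ (^-sum L))

  -- The blocks fix the cycle sizes, so the test of the type leaves the sum as an indicator; the
  -- remaining power of `t` factors over the cycles.
  onTypes-statsWeight : ∀ js ks → onTypes js (statsWeight (map suc ks)) ≈ [ js ↭? ks ] × ∏ₗ ks cyclePolynomial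
  onTypes-statsWeight js ks = begin
    onTypes js (statsWeight (map suc ks))
      ≈⟨ onTypes-cong js (λ L p → ofSize L p (js ↭? ks)) ⟩
    onTypes js (λ L → [ js ↭? ks ] × ∏ₗ L (λ (v , _) → t ^ᵣ v))
      ≈⟨ onTypes-× js [ js ↭? ks ] _ ⟩
    [ js ↭? ks ] × onTypes js (λ L → ∏ₗ L (λ (v , _) → t ^ᵣ v))
      ≈⟨ ×-congʳ [ js ↭? ks ] (onTypes-∏ js _) ⟩
    [ js ↭? ks ] × ∏ₗ js cyclePolynomial
      ≈⟨ permute (js ↭? ks) ⟩
    [ js ↭? ks ] × ∏ₗ ks cyclePolynomial ∎
    where
    open import Relation.Binary.Reasoning.Setoid R.setoid
    ofSize : ∀ L → map size L ≡ map suc js → (js↭ks? : Dec (js ↭ ks)) →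
             statsWeight (map suc ks) L ≈ [ js↭ks? ] × ∏ₗ L (λ (v , _) → t ^ᵣ v)
    ofSize L p (yes q) = R.trans
      (R.reflexive (cong (if_then _ else _) (dec-true (map size L ↭? map suc ks) (subst (_↭ _) (sym p) (↭.map⁺ suc q)))))
      (R.trans (^-sum L) (R.sym (×-homo-1 _)))
    ofSize L p (no ¬q) =
      R.reflexive (cong (if_then _ else _) (dec-false (map size L ↭? map suc ks) (¬q ∘ map-suc-injective ∘ subst (_↭ _) p)))
    permute : (js↭ks? : Dec (js ↭ ks)) → [ js↭ks? ] × ∏ₗ js cyclePolynomial ≈ [ js↭ks? ] × ∏ₗ ks cyclePolynomial
    permute (yes q) = ×-congʳ 1 (ListFold.∑ₗ-↭ R.*-commutativeMonoid cyclePolynomial q)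
    permute (no _)  = R.refl

private
  ℕR = ℕ.+-*-commutativeSemiring
  module ℕΣ = ListSum ℕR
  module SR = ListSum Ser.commutativeSemiring
  open Valleys Ser.commutativeSemiring using (onTypes; onCycles; size)
  open Insertion Ser.commutativeSemiring using (∑-labelled)
  open Reindexing Ser.commutativeSemiring using (∑-reindex)
  open Eulerian Ser.commutativeSemiring using (onCycles-eulerian)
  open SR using (_×_; ∑ₗ; ∏ₗ)

-- Multiplicities of parts and the factors of z

multiplicity-unique : ∀ {k ks} → Unique ks → k ∈ ks → multiplicity k ks ≡ 1
multiplicity-unique {k} {x ∷ xs} (x∉xs ∷ _) (here refl) = trans (multiplicity-∷ k k xs)
  (cong₂ ℕ._+_ ([]-yes (k ℕ.≟ k) refl) (cong List.length (List.filter-none (k ℕ.≟_) x∉xs)))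
multiplicity-unique {k} {x ∷ xs} (x∉xs ∷ u) (there k∈xs) = trans (multiplicity-∷ k x xs)
  (cong₂ ℕ._+_ ([]-no (k ℕ.≟ x) (All.lookup x∉xs k∈xs ∘ sym)) (multiplicity-unique u k∈xs))

multiplicity-[1…] : ∀ {n k} → suc k ≤ n → multiplicity (suc k) [1… n ] ≡ 1
multiplicity-[1…] {n} k<n = multiplicity-unique (Unique.map⁺ ℕ.suc-injective (Unique.upTo⁺ n)) (∈-map⁺ suc (∈-upTo⁺ k<n))

All-≤-sum : ∀ ks → All (_≤ ℕ.sum ks) ks
All-≤-sum []       = []
All-≤-sum (k ∷ ks) = ℕ.m≤m+n k _ ∷ All.map (λ p → ℕ.≤-trans p (ℕ.m≤n+m _ k)) (All-≤-sum ks)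

parts-once : ∀ {n} ks → ℕ.sum (map suc ks) ≡ n → All (λ k → multiplicity k [1… n ] ≡ 1) (map suc ks)
parts-once ks refl = All.map⁺ (All.map multiplicity-[1…] (All.map⁻ (All-≤-sum (map suc ks))))

multiplicity-suc : ∀ k ks → multiplicity (suc k) (map suc ks) ≡ multiplicity k ks
multiplicity-suc k []       = refl
multiplicity-suc k (x ∷ ks) = trans (multiplicity-∷ (suc k) (suc x) (map suc ks))
  (trans (cong ([ k ℕ.≟ x ] ℕ.+_) (multiplicity-suc k ks)) (sym (multiplicity-∷ k x ks)))

symmetries-suc : ∀ ks → symmetries (map suc ks) ≡ symmetries ks
symmetries-suc []       = refl
symmetries-suc (k ∷ ks) = cong₂ (λ a b → suc a ℕ.* b) (multiplicity-suc k ks) (symmetries-suc ks)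

private
  module ℕΠ = ListFold ℕ.*-1-commutativeMonoid
  open import Algebra.Properties.CommutativeMonoid.Mult ℕ.*-1-commutativeMonoid using ()
    renaming (_×_ to _×ₚ_; ×-congˡ to ×ₚ-congˡ)

×ₚ-^ : ∀ n x → n ×ₚ x ≡ x ℕ.^ n
×ₚ-^ zero    x = refl
×ₚ-^ (suc n) x = cong (x ℕ.*_) (×ₚ-^ n x)

-- A further `k` changes only the factor at `k`, from m! to (m + 1) m!, and `is` contains `k` once.
∏-multiplicity! : ∀ is ks → All (λ k → multiplicity k is ≡ 1) ks →
                  ℕΠ.∑ₗ is (λ i → multiplicity i ks !) ≡ symmetries ks
∏-multiplicity! is []       []       = ℕΠ.∑ₗ-zero is
∏-multiplicity! is (k ∷ ks) (p ∷ ps) = begin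
  ℕΠ.∑ₗ is (λ i → multiplicity i (k ∷ ks) !)
    ≡⟨ ℕΠ.∑ₗ-cong is (λ i → trans (cong _! (multiplicity-∷ i k ks)) (split i (i ℕ.≟ k))) ⟩
  ℕΠ.∑ₗ is (λ i → [ i ℕ.≟ k ] ×ₚ suc (multiplicity k ks) ℕ.* multiplicity i ks !)
    ≡⟨ ℕΠ.∑ₗ-+ is (λ i → [ i ℕ.≟ k ] ×ₚ suc (multiplicity k ks)) _ ⟩
  ℕΠ.∑ₗ is (λ i → [ i ℕ.≟ k ] ×ₚ suc (multiplicity k ks)) ℕ.* ℕΠ.∑ₗ is (λ i → multiplicity i ks !)
    ≡⟨ cong₂ ℕ._*_ (trans (ℕΠ.∑ₗ-indicator k is _) (trans (×ₚ-congˡ p) (ℕ.*-identityʳ (suc (multiplicity k ks)))))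
                   (∏-multiplicity! is ks ps) ⟩
  symmetries (k ∷ ks) ∎
  where
  open ≡-Reasoning
  split : ∀ i (i≟k : Dec (i ≡ k)) → ([ i≟k ] ℕ.+ multiplicity i ks) ! ≡ [ i≟k ] ×ₚ suc (multiplicity k ks) ℕ.* multiplicity i ks !
  split i (yes refl) = cong (ℕ._* multiplicity i ks !) (sym (ℕ.*-identityʳ (suc (multiplicity i ks))))
  split i (no _)     = sym (ℕ.*-identityˡ _)

∏-factorials : ∀ ks → ℕ.product (map suc ks) ℕ.* ℕ.product (map _! ks) ≡ factorials ks
∏-factorials []       = refl
∏-factorials (k ∷ ks) = trans (arith (suc k) (ℕ.product (map suc ks)) (k !) (ℕ.product (map _! ks)))
  (cong (suc k ! ℕ.*_) (∏-factorials ks))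
  where
  arith : ∀ a b c d → (a ℕ.* b) ℕ.* (c ℕ.* d) ≡ (a ℕ.* c) ℕ.* (b ℕ.* d)
  arith = solve-∀

-- Rational coefficients and inverse factorials

ι : ℕ → ℚ
ι n = + n / 1

/-unique : ∀ a b .{{_ : NonZero b}} → (+ (a ℕ.* b)) / b ≡ ι a
/-unique a (suc b) = ℚ.toℚᵘ-injective (begin
  ℚ.toℚᵘ ((+ (a ℕ.* suc b)) / suc b)    ≈⟨ ℚ.toℚᵘ-fromℚᵘ (ℚᵘ.mkℚᵘ (+ (a ℕ.* suc b)) b) ⟩
  ℚᵘ.mkℚᵘ (+ (a ℕ.* suc b)) b           ≈⟨ ℚᵘ.*≡* (trans (ℤ.*-identityʳ _) (ℤ.pos-* a (suc b))) ⟩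
  ℚᵘ.mkℚᵘ (+ a) 0                       ≈⟨ ℚ.toℚᵘ-fromℚᵘ (ℚᵘ.mkℚᵘ (+ a) 0) ⟨
  ℚ.toℚᵘ (ι a)                          ∎)
  where open import Relation.Binary.Reasoning.Setoid ℚᵘ.≃-setoid

ι-* : ∀ a b → ι (a ℕ.* b) ≡ ι a ℚ.* ι b
ι-* a b = ℚ.toℚᵘ-injective (begin
  ℚ.toℚᵘ (ι (a ℕ.* b))                   ≈⟨ ℚ.toℚᵘ-fromℚᵘ (ℚᵘ.mkℚᵘ (+ (a ℕ.* b)) 0) ⟩
  ℚᵘ.mkℚᵘ (+ (a ℕ.* b)) 0                ≈⟨ ℚᵘ.*≡* (cong (ℤ._* + 1) (ℤ.pos-* a b)) ⟩
  ℚᵘ.mkℚᵘ (+ a) 0 ℚᵘ.* ℚᵘ.mkℚᵘ (+ b) 0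
    ≈⟨ ℚᵘ.*-cong (ℚ.toℚᵘ-fromℚᵘ (ℚᵘ.mkℚᵘ (+ a) 0)) (ℚ.toℚᵘ-fromℚᵘ (ℚᵘ.mkℚᵘ (+ b) 0)) ⟨
  ℚ.toℚᵘ (ι a) ℚᵘ.* ℚ.toℚᵘ (ι b)         ≈⟨ ℚ.toℚᵘ-homo-* (ι a) (ι b) ⟨
  ℚ.toℚᵘ (ι a ℚ.* ι b)                   ∎)
  where open import Relation.Binary.Reasoning.Setoid ℚᵘ.≃-setoid

ι-suc : ∀ a → ι (suc a) ≡ 1ℚ ℚ.+ ι a
ι-suc a = ℚ.toℚᵘ-injective (begin
  ℚ.toℚᵘ (ι (suc a))                     ≈⟨ ℚ.toℚᵘ-fromℚᵘ (ℚᵘ.mkℚᵘ (+ suc a) 0) ⟩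
  ℚᵘ.mkℚᵘ (+ suc a) 0                    ≈⟨ ℚᵘ.*≡* (cong (ℤ._* + 1) (cong (ℤ._+_ (+ 1)) (sym (ℤ.*-identityʳ (+ a))))) ⟩
  ℚᵘ.1ℚᵘ ℚᵘ.+ ℚᵘ.mkℚᵘ (+ a) 0            ≈⟨ ℚᵘ.+-congʳ ℚᵘ.1ℚᵘ (ℚ.toℚᵘ-fromℚᵘ (ℚᵘ.mkℚᵘ (+ a) 0)) ⟨
  ℚ.toℚᵘ 1ℚ ℚᵘ.+ ℚ.toℚᵘ (ι a)            ≈⟨ ℚ.toℚᵘ-homo-+ 1ℚ (ι a) ⟨
  ℚ.toℚᵘ (1ℚ ℚ.+ ι a)                    ∎)
  where open import Relation.Binary.Reasoning.Setoid ℚᵘ.≃-setoid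

/-cancel : ∀ b .{{_ : NonZero b}} → (+ 1) / b ℚ.* ι b ≡ 1ℚ
/-cancel (suc b) = ℚ.toℚᵘ-injective (begin
  ℚ.toℚᵘ ((+ 1) / suc b ℚ.* ι (suc b))            ≈⟨ ℚ.toℚᵘ-homo-* ((+ 1) / suc b) (ι (suc b)) ⟩
  ℚ.toℚᵘ ((+ 1) / suc b) ℚᵘ.* ℚ.toℚᵘ (ι (suc b))
    ≈⟨ ℚᵘ.*-cong (ℚ.toℚᵘ-fromℚᵘ (ℚᵘ.mkℚᵘ (+ 1) b)) (ℚ.toℚᵘ-fromℚᵘ (ℚᵘ.mkℚᵘ (+ suc b) 0)) ⟩
  ℚᵘ.mkℚᵘ (+ 1) b ℚᵘ.* ℚᵘ.mkℚᵘ (+ suc b) 0        ≈⟨ ℚᵘ.*≡* (ℤ.*-assoc (+ 1) (+ suc b) (+ 1)) ⟩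
  ℚᵘ.1ℚᵘ                                          ∎)
  where open import Relation.Binary.Reasoning.Setoid ℚᵘ.≃-setoid

×≗• : ∀ n f → n × f ≗ ι n • f
×≗• zero    f k = sym (ℚ.*-zeroˡ (f k))
×≗• (suc n) f k = trans (cong (f k ℚ.+_) (×≗• n f k)) (sym (trans (cong (ℚ._* f k) (ι-suc n))
  (trans (ℚ.*-distribʳ-+ (f k) 1ℚ (ι n)) (cong (ℚ._+ ι n ℚ.* f k) (ℚ.*-identityˡ (f k))))))

*-• : ∀ q f g → f * (q • g) ≗ q • (f * g)
*-• q f g n = trans (*-comm f (q • g) n) (trans (•-*-assoc q g f n) (cong (q ℚ.*_) (*-comm g f n)))

inverseFactorials : List ℕ → ℚ
inverseFactorials []       = 1ℚ
inverseFactorials (k ∷ ks) = ((+ 1) / (k !)) {{k !≢0}} ℚ.* inverseFactorials ks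

inverseFactorials-cancel : ∀ ks → ι (ℕ.product (map _! ks)) ℚ.* inverseFactorials ks ≡ 1ℚ
inverseFactorials-cancel []       = refl
inverseFactorials-cancel (k ∷ ks) = begin
  ι (k ! ℕ.* ℕ.product (map _! ks)) ℚ.* (r ℚ.* inverseFactorials ks)
    ≡⟨ cong (ℚ._* (r ℚ.* inverseFactorials ks)) (ι-* (k !) (ℕ.product (map _! ks))) ⟩
  ι (k !) ℚ.* ι (ℕ.product (map _! ks)) ℚ.* (r ℚ.* inverseFactorials ks)      ≡⟨ interchange (ι (k !)) _ r _ ⟩
  ι (k !) ℚ.* r ℚ.* (ι (ℕ.product (map _! ks)) ℚ.* inverseFactorials ks)
    ≡⟨ cong₂ ℚ._*_ (trans (ℚ.*-comm (ι (k !)) r) (/-cancel (k !) {{k !≢0}}))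
                  (inverseFactorials-cancel ks) ⟩
  1ℚ ℚ.* 1ℚ ∎
  where
  open ≡-Reasoning
  open import Algebra.Properties.CommutativeSemigroup (CommutativeRing.*-commutativeSemigroup ℚ.+-*-commutativeRing)
    using (interchange)
  r = ((+ 1) / (k !)) {{k !≢0}}

∏-• : ∀ ks (f : ℕ → Series) → ∏ₗ ks (λ k → ((+ 1) / (k !)) {{k !≢0}} • f k) ≗ inverseFactorials ks • ∏ₗ ks f
∏-• []       f n = sym (ℚ.*-identityˡ (1# n))
∏-• (k ∷ ks) f n = trans (Ser.*-congˡ {x = r • f k} (∏-• ks f) n)
  (trans (•-*-assoc r (f k) (inverseFactorials ks • ∏ₗ ks f) n)
  (trans (cong (r ℚ.*_) (*-• (inverseFactorials ks) (f k) (∏ₗ ks f) n)) (sym (ℚ.*-assoc r (inverseFactorials ks) _))))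
  where r = ((+ 1) / (k !)) {{k !≢0}}

-- The sum over one cycle type

cycles-cong : ∀ {n} (π ρ : Permutation′ n) → π ≈ₚ ρ → cycles π ≡ cycles ρ
cycles-cong {n} π ρ π≈ρ = cong (deduplicate _) (List.map-cong (λ i → cong (⋃ ∘ map ⁅_⁆) (iterate-cong i n)) (allFin n))
  where
  iterate-cong : ∀ i k → iterate (π ⟨$⟩ʳ_) i k ≡ iterate (ρ ⟨$⟩ʳ_) i k
  iterate-cong i zero    = refl
  iterate-cong i (suc k) = cong (i ∷_) (trans (iterate-cong (π ⟨$⟩ʳ i) k) (cong (λ j → iterate (ρ ⟨$⟩ʳ_) j k) (π≈ρ i)))

cval-cong : ∀ {n} (π ρ : Permutation′ n) → π ≈ₚ ρ → cval π ≡ cval ρ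
cval-cong π ρ π≈ρ = cong List.length (List.filter-≐ (isValley? π) (isValley? ρ) (⊆ π ρ π≈ρ , ⊆ ρ π (sym ∘ π≈ρ)) (allFin _))
  where
  ⊆ : ∀ {n} (π ρ : Permutation′ n) → π ≈ₚ ρ → ∀ {i} → IsValley π i → IsValley ρ i
  ⊆ π ρ π≈ρ {i} (p , q) = subst (i Fin.<_) (flip-cong π ρ π≈ρ i) p , subst (i Fin.<_) (π≈ρ i) q

open TypeWeights Ser.commutativeSemiring t

typeCount : ℕ → List ℕ → ℕ
typeCount n ks = foldr ℕ._+_ 0 (map (λ js → [ js ↭? ks ]) (types n))

-- Each rearrangement of `ks` has `symmetries ks` matchings with it and every other list has none,
-- so the weighted count is the sum in `∑-matchings`.
typeCount-! : ∀ n ks → ℕ.sum (map suc ks) ≡ n → typeCount n ks ℕ.* symmetries ks ℕ.* factorials ks ≡ n !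
typeCount-! n ks p = trans (cong (ℕ._* factorials ks) (begin
  typeCount n ks ℕ.* symmetries ks                           ≡⟨ ℕ.*-comm (typeCount n ks) _ ⟩
  symmetries ks ℕ.* typeCount n ks
    ≡⟨ ℕΣ.∑ₗ-*ˡ (types n) (λ js → [ js ↭? ks ]) (symmetries ks) ⟨
  ℕΣ.∑ₗ (types n) (λ js → symmetries ks ℕ.* [ js ↭? ks ])    ≡⟨ ℕΣ.∑ₗ-cong (types n) (λ js → indicator js (js ↭? ks)) ⟩
  ℕΣ.∑ₗ (types n) (λ js → matchings js ks)                   ∎)) (∑-matchings n ks p)
  where
  open ≡-Reasoning
  indicator : ∀ js (js↭ks? : Dec (js ↭ ks)) → symmetries ks ℕ.* [ js↭ks? ] ≡ matchings js ks
  indicator js (yes q) = trans (ℕ.*-identityʳ _) (trans (symmetries-↭ (↭-sym q)) (sym (matchings-↭ js q)))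
  indicator js (no ¬q) = trans (ℕ.*-zeroʳ (symmetries ks)) (sym (matchings-¬↭ js ¬q))

module _ {n} (Λ : Partition n) (ks : List ℕ) (parts≡ : parts Λ ≡ map suc ks) where

  private
    weightOf : Permutation′ n → Series
    weightOf π = weight (parts Λ) (map ∣_∣ (cycles π)) (cval π)

  weightOf-labelling : ∀ {π} (L : Labelling π) → weightOf π ≡ statsWeight (parts Λ) (Labelling.cycleStats L)
  weightOf-labelling {π} L = cong₂ (λ b v → if b then t ^ v else 0#)
    (does-⇔ (mk⇔ (↭-trans (↭-sym (cycleSizes L))) (↭-trans (cycleSizes L)))
      (map ∣_∣ (cycles π) ↭? parts Λ) (map size (Labelling.cycleStats L) ↭? parts Λ))
    (cval-labelling L)

  -- The filter becomes a weight that is 0 off the type. It respects pointwise equality, so the sum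
  -- may move to `labelled`, where the weight is a function of `cycleStats`.
  ∑-cval : ∑ (map (λ π → t ^ cval π) (𝔖 Λ)) ≗ typeCount n ks × ∏ₗ ks cyclePolynomial
  ∑-cval = begin
    ∑ₗ (𝔖 Λ) (λ π → t ^ cval π)
      ≈⟨ SR.∑ₗ-filter (hasCycleType? Λ) (permutations n) (λ π → t ^ cval π) ⟩
    ∑ₗ (permutations n) weightOf
      ≈⟨ ∑-reindex weightOf (λ π ρ p → Ser.reflexive
           (cong₂ (λ cs v → weight (parts Λ) (map ∣_∣ cs) v) (cycles-cong π ρ p) (cval-cong π ρ p)))
           (permutations-enumerates n) (labelled-enumerates n) ⟩
    ∑ₗ (map proj₁ (labelled n)) weightOf
      ≈⟨ SR.∑ₗ-map proj₁ (labelled n) weightOf ⟩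
    ∑ₗ (labelled n) (weightOf ∘ proj₁)
      ≈⟨ SR.∑ₗ-cong (labelled n) (λ (_ , L) → Ser.reflexive (weightOf-labelling L)) ⟩
    ∑ₗ (labelled n) (λ (_ , L) → statsWeight (parts Λ) (Labelling.cycleStats L))
      ≈⟨ ∑-labelled n (statsWeight (parts Λ)) ⟩
    ∑ₗ (types n) (λ js → onTypes js (statsWeight (parts Λ)))
      ≈⟨ SR.∑ₗ-cong (types n) (λ js → subst (λ ps → onTypes js (statsWeight ps) ≗ _) (sym parts≡)
           (onTypes-statsWeight js ks)) ⟩
    ∑ₗ (types n) (λ js → [ js ↭? ks ] × ∏ₗ ks cyclePolynomial)
      ≈⟨ SR.∑ₗ-× (types n) (λ js → [ js ↭? ks ]) (∏ₗ ks cyclePolynomial) ⟩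
    typeCount n ks × ∏ₗ ks cyclePolynomial ∎
    where open import Relation.Binary.Reasoning.Setoid Ser.setoid

exponent : List ℕ → ℕ
exponent []           = 0
exponent (zero ∷ ks)  = exponent ks
exponent (suc k ∷ ks) = suc (suc k) ℕ.+ exponent ks

exponent-multiplicity : ∀ ks → exponent ks ℕ.+ multiplicity 0 ks ≡ ℕ.sum (map suc ks)
exponent-multiplicity []           = refl
exponent-multiplicity (zero ∷ ks)  = trans (ℕ.+-suc (exponent ks) _) (cong suc (exponent-multiplicity ks))
exponent-multiplicity (suc k ∷ ks) = trans (ℕ.+-assoc (suc (suc k)) (exponent ks) _)
  (cong (suc (suc k) ℕ.+_) (exponent-multiplicity ks))

module _ {c ℓ} (R : CommutativeSemiring c ℓ) where
  open CommutativeSemiring R using (Carrier; _≈_) renaming (_*_ to _*ᵣ_)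
  private module R = CommutativeSemiring R
  open ListSum R using () renaming (∏ₗ to ∏ᵣ)
  open import Algebra.Properties.Semiring.Exp R.semiring using (^-homo-*) renaming (_^_ to _^ᵣ_)
  open import Algebra.Properties.CommutativeSemigroup R.*-commutativeSemigroup using (interchange; x∙yz≈y∙xz)

  ∏-exponent : ∀ b (f g : ℕ → Carrier) → f 0 ≈ g 0 → (∀ k → f (suc k) ≈ b ^ᵣ suc (suc k) *ᵣ g (suc k)) →
               ∀ ks → ∏ᵣ ks f ≈ b ^ᵣ exponent ks *ᵣ ∏ᵣ ks g
  ∏-exponent b f g f0≈g0 fs≈gs []           = R.sym (R.*-identityˡ _)
  ∏-exponent b f g f0≈g0 fs≈gs (zero ∷ ks)  = R.trans (R.*-cong f0≈g0 (∏-exponent b f g f0≈g0 fs≈gs ks)) (x∙yz≈y∙xz _ _ _)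
  ∏-exponent b f g f0≈g0 fs≈gs (suc k ∷ ks) = R.trans (R.*-cong (fs≈gs k) (∏-exponent b f g f0≈g0 fs≈gs ks))
    (R.trans (interchange _ _ _ _) (R.*-congʳ (R.sym (^-homo-* b (suc (suc k)) (exponent ks)))))

-- A longer cycle brings `1+√` to the power of its length, whereas for a fixed point
-- `cyclePolynomial 0` and `A 0 w` are both 1. Hence `exponent` adds up only the parts of size at
-- least 2.
∏-cyclePolynomial : ∀ ks → ∏ₗ ks cyclePolynomial ≗ 1+√ ^ exponent ks * ∏ₗ ks (λ k → A k w)
∏-cyclePolynomial = ∏-exponent Ser.commutativeSemiring 1+√ cyclePolynomial (λ k → A k w) (λ _ → refl)
  (onCycles-eulerian {a = 1-√} {b = 1+√} {t = t} 1-√*1+√ 1-√+1+√ {w = w} w*1+√)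

map-suc-pred : ∀ {ps} → All NonZero ps → ps ≡ map suc (map pred ps)
map-suc-pred []                   = refl
map-suc-pred {suc p ∷ _} (_ ∷ ps) = cong (suc p ∷_) (map-suc-pred ps)

module _ {n} (Λ : Partition n) where
  predParts : List ℕ
  predParts = map pred (parts Λ)

  private
    ks : List ℕ
    ks = predParts

  parts≡ : parts Λ ≡ map suc predParts
  parts≡ = map-suc-pred (positive Λ)

  sum-predParts : ℕ.sum (map suc predParts) ≡ n
  sum-predParts = trans (cong ℕ.sum (sym parts≡)) (sum≡ Λ)

  once : All (λ k → multiplicity k [1… n ] ≡ 1) (parts Λ)
  once = subst (All _) (sym parts≡) (parts-once ks sum-predParts)

  z≡ : z Λ ≡ ℕ.product (map suc predParts) ℕ.* symmetries predParts
  z≡ = trans (ℕΠ.∑ₗ-+ [1… n ] (λ i → i ℕ.^ m Λ i) (λ i → m Λ i !)) (cong₂ ℕ._*_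
    (begin
      ℕΠ.∑ₗ [1… n ] (λ i → i ℕ.^ m Λ i)    ≡⟨ ℕΠ.∑ₗ-cong [1… n ] (λ i → sym (×ₚ-^ (m Λ i) i)) ⟩
      ℕΠ.∑ₗ [1… n ] (λ i → m Λ i ×ₚ i)     ≡⟨ ℕΠ.∑ₗ-multiplicity [1… n ] (parts Λ) (λ i → i) once ⟩
      ℕΠ.∑ₗ (parts Λ) (λ i → i)            ≡⟨ cong ℕ.product (trans (List.map-id (parts Λ)) parts≡) ⟩
      ℕ.product (map suc ks)                 ∎)
    (trans (∏-multiplicity! [1… n ] (parts Λ) once) (trans (cong symmetries parts≡) (symmetries-suc ks))))
    where open ≡-Reasoning

  -- Splitting each (k + 1)! into (k + 1) and k! sends the sizes into `z` and leaves the k!, which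
  -- become the denominators under the Eulerian polynomials.
  n!≡ : n ! ≡ typeCount n predParts ℕ.* ℕ.product (map _! predParts) ℕ.* z Λ
  n!≡ = begin
    n !
      ≡⟨ typeCount-! n ks sum-predParts ⟨
    typeCount n ks ℕ.* symmetries ks ℕ.* factorials ks
      ≡⟨ cong (typeCount n ks ℕ.* symmetries ks ℕ.*_) (∏-factorials ks) ⟨
    typeCount n ks ℕ.* symmetries ks ℕ.* (ℕ.product (map suc ks) ℕ.* ℕ.product (map _! ks))
      ≡⟨ arith (typeCount n ks) (symmetries ks) (ℕ.product (map suc ks)) (ℕ.product (map _! ks)) ⟩
    typeCount n ks ℕ.* ℕ.product (map _! ks) ℕ.* (ℕ.product (map suc ks) ℕ.* symmetries ks)
      ≡⟨ cong (typeCount n ks ℕ.* ℕ.product (map _! ks) ℕ.*_) z≡ ⟨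
    typeCount n ks ℕ.* ℕ.product (map _! ks) ℕ.* z Λ                                       ∎
    where
    open ≡-Reasoning
    arith : ∀ a s p f → a ℕ.* s ℕ.* (p ℕ.* f) ≡ a ℕ.* f ℕ.* (p ℕ.* s)
    arith = solve-∀

  typeCount-ℚ : ((+ (n !)) / z Λ) {{z≢0 Λ}} ℚ.* inverseFactorials predParts ≡ ι (typeCount n predParts)
  typeCount-ℚ = begin
    ((+ (n !)) / z Λ) {{z≢0 Λ}} ℚ.* r                           ≡⟨ cong (λ a → ((+ a) / z Λ) {{z≢0 Λ}} ℚ.* r) n!≡ ⟩
    ((+ (typeCount n ks ℕ.* ℕ.product (map _! ks) ℕ.* z Λ)) / z Λ) {{z≢0 Λ}} ℚ.* r
      ≡⟨ cong (ℚ._* r) (/-unique (typeCount n ks ℕ.* ℕ.product (map _! ks)) (z Λ) {{z≢0 Λ}}) ⟩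
    ι (typeCount n ks ℕ.* ℕ.product (map _! ks)) ℚ.* r
      ≡⟨ cong (ℚ._* r) (ι-* (typeCount n ks) (ℕ.product (map _! ks))) ⟩
    ι (typeCount n ks) ℚ.* ι (ℕ.product (map _! ks)) ℚ.* r
      ≡⟨ ℚ.*-assoc (ι (typeCount n ks)) (ι (ℕ.product (map _! ks))) r ⟩
    ι (typeCount n ks) ℚ.* (ι (ℕ.product (map _! ks)) ℚ.* r)
      ≡⟨ cong (ι (typeCount n ks) ℚ.*_) (inverseFactorials-cancel ks) ⟩
    ι (typeCount n ks) ℚ.* 1ℚ                                   ≡⟨ ℚ.*-identityʳ _ ⟩
    ι (typeCount n ks)                                          ∎
    where
    open ≡-Reasoning
    r = inverseFactorials ks

  n∸m₁≡exponent : n ∸ m Λ 1 ≡ exponent predParts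
  n∸m₁≡exponent = begin
    n ∸ m Λ 1
      ≡⟨ cong₂ _∸_ (trans (sym sum-predParts) (sym (exponent-multiplicity ks)))
                                                                        (trans (cong (multiplicity 1) parts≡) (multiplicity-suc 0 ks)) ⟩
    exponent ks ℕ.+ multiplicity 0 ks ∸ multiplicity 0 ks  ≡⟨ ℕ.m+n∸n≡m (exponent ks) (multiplicity 0 ks) ⟩
    exponent ks                                            ∎
    where open ≡-Reasoning

theorem13 : (n : ℕ) .{{_ : NonZero n}} (Λ : Partition n) →
    ∑ (map (λ π → t ^ cval π) (𝔖 Λ))
      ≗ (((+ (n !)) / z Λ) {{z≢0 Λ}}) • ((1# + √[1-t]) ^ (n ∸ m Λ 1)
          * ∏ (map (λ i → (((+ 1) / ((i ∸ 1) !)) {{(i ∸ 1) !≢0}} • A (i ∸ 1) w) ^ m Λ i) [1… n ]))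
theorem13 n Λ = begin
  ∑ (map (λ π → t ^ cval π) (𝔖 Λ))
    ≈⟨ ∑-cval Λ ks (parts≡ Λ) ⟩
  typeCount n ks × ∏ₗ ks cyclePolynomial
    ≈⟨ ×≗• (typeCount n ks) (∏ₗ ks cyclePolynomial) ⟩
  ι (typeCount n ks) • ∏ₗ ks cyclePolynomial
    -- `q` is n!/z and `r` is the product of the 1/(i - 1)! over the parts; together they are the
    -- number of set partitions of this type.
    ≈⟨ (λ k → cong₂ ℚ._*_ (sym (typeCount-ℚ Λ)) (∏-cyclePolynomial ks k)) ⟩
  (q ℚ.* r) • (1+√ ^ exponent ks * ∏ₗ ks (λ k → A k w))
    ≈⟨ (λ k → trans (ℚ.*-assoc q r _) (cong (q ℚ.*_) (sym (*-• r (1+√ ^ exponent ks) (∏ₗ ks (λ k → A k w)) k)))) ⟩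
  q • (1+√ ^ exponent ks * (r • ∏ₗ ks (λ k → A k w)))
    ≈⟨ (λ k → cong (q ℚ.*_) (*-cong {1+√ ^ exponent ks} {1+√ ^ (n ∸ m Λ 1)}
         (Ser.reflexive (cong (1+√ ^_) (sym (n∸m₁≡exponent Λ)))) factors k)) ⟩
  q • (1+√ ^ (n ∸ m Λ 1) * ∏ (map (λ i → f i ^ m Λ i) [1… n ])) ∎
  where
  open import Relation.Binary.Reasoning.Setoid Ser.setoid
  ks = predParts Λ
  q = ((+ (n !)) / z Λ) {{z≢0 Λ}}
  r = inverseFactorials ks
  module Π = ListFold Ser.*-commutativeMonoid
  f : ℕ → Series
  f i = (((+ 1) / ((i ∸ 1) !)) {{(i ∸ 1) !≢0}} • A (i ∸ 1) w)
  factors : r • ∏ₗ ks (λ k → A k w) ≗ ∏ (map (λ i → f i ^ m Λ i) [1… n ])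
  factors = begin
    r • ∏ₗ ks (λ k → A k w)                  ≈⟨ ∏-• ks (λ k → A k w) ⟨
    -- A part `suc k` takes the factor of index `k`, since `suc k ∸ 1` computes to `k`.
    ∏ₗ ks (λ k → f (suc k))                  ≈⟨ Π.∑ₗ-map suc ks f ⟨
    ∏ₗ (map suc ks) f                        ≡⟨ cong (λ ps → ∏ₗ ps f) (parts≡ Λ) ⟨
    ∏ₗ (parts Λ) f                           ≈⟨ Π.∑ₗ-multiplicity [1… n ] (parts Λ) f (once Λ) ⟨
    ∏ (map (λ i → f i ^ m Λ i) [1… n ])      ∎
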